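{- Let $f\in\mathbf{B}_{k,n}$ and $P\in\mathcal{P}_{k,n}$. Suppose $\overline f=(a^{(1)}_1\cdots a^{(1)}_{n_1})(a^{(2)}_1\cdots a^{(2)}_{n_2})\cdots(a^{(r)}_1\cdots a^{(r)}_{n_r})$ is the cycle decomposition of $\overline f\in S_n$ (cycles of length $1$ included). For each $j\in[r]$ let $S_j\subset\mathbb{Z}$ be the set of all integers congruent modulo $n$ to one of $a^{(j)}_1,\dots,a^{(j)}_{n_j}$, let $f_j:=f|_{S_j}$ be the restriction of $f$ to $S_j$, viewed as an $n_j$-periodic affine permutation via the order-preserving identification $S_j\cong\mathbb{Z}$, let $P_j:=P|_{S_j}$ be the path obtained by restricting $P$ to the steps indexed by $S_j$, and let $k_j:=\operatorname{av}(f_j)$. Then $f_j\in\mathbf{B}_{k_j,n_j}$ for every $j\in[r]$, and: (1) if $P_j\notin\mathcal{P}_{k_j,n_j}$ for some $j\in[r]$, then $\operatorname{Deo}^{\max}_{f,P}=\varnothing$; (2) otherwise, there is a bijection $\operatorname{Deo}^{\max}_{f,P}\longrightarrow\prod_{j=1}^r\operatorname{Deo}^{\max}_{f_j,P_j}$.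
   Context: Let $n\ge 1$, $0\le k\le n$, $[n]=\{1,\dots,n\}$. An $n$-periodic affine permutation is a bijection $f:\mathbb{Z}\to\mathbb{Z}$ with $f(i+n)=f(i)+n$ for all $i$; put $\operatorname{av}(f)=\frac1n\sum_{i=1}^n(f(i)-i)$. $\mathbf{B}_{k,n}$ is the set of $n$-periodic affine permutations with $\operatorname{av}(f)=k$ and $i\le f(i)\le i+n$ for all $i$. $\overline f\in S_n$ is $f$ reduced modulo $n$, and $c(\overline f)$ is its number of cycles (fixed points included). Restriction: each $S_j$ is stable under $f$ and under translation by $n$; it is identified with $\mathbb{Z}$ by the order-preserving bijection sending $\min(S_j\cap\mathbb{Z}_{\ge1})$ to $1$. $P_j$ is the lattice path with $n_j$ steps obtained by keeping, in order, the steps of $P$ with indices in $S_j\cap[n]$. Lattice paths: $\mathcal{P}_{k,n}$ is the set of lattice paths $P$ from $(0,0)$ to $(n-k,k)$ with unit steps $P_1,\dots,P_n\in\{\mathrm R,\mathrm U\}$ (right, up). Extend $P$ to a bi-infinite path with steps indexed by $\mathbb{Z}$ via $P_{i+n}=P_i$ (step $1$ starts at $(0,0)$); it is invariant under translation by $(n-k,k)$. The strip of $P$ is the region between the extended path $P$ (southern boundary) and its translate $P+(0,k)$ (northern boundary). On each boundary the unit edges are labeled by $\mathbb{Z}$: the southern edge labeled $i$ is step $i$ of $P$, and the northern edge labeled $i$ is its translate by $(0,k)$. Fillings: a periodic filling assigns to each unit box of the strip a crossing or an elbow, invariantly under translation by $(n-k,k)$. Strands enter at the northern boundary edges and travel right/down: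 in a crossing box a strand entering from the left exits right and one entering from the top exits at the bottom; in an elbow box a strand entering from the left exits at the bottom and one entering from the top exits right. Each strand ends at a southern boundary edge; the strand permutation sends $i$ to $j$ if the strand entering at northern edge $i$ exits at southern edge $j$. (If $k\in\{0,n\}$ the strip has no boxes, the two boundaries coincide, and each strand exits at the edge where it enters.) An $(f,P)$-affine Deogram is a periodic filling such that (a) its strand permutation is $f$, and (b) (distinguished) whenever two strands form an elbow in a box, they have crossed each other an even number of times in boxes they traversed before it (counting from the northern boundary). $\operatorname{Deo}^{\max}_{f,P}$ is the set of maximal ones: those having exactly $n-c(\overline f)$ elbows modulo translation by $(n-k,k)$. -}

module Defs where

open import Data.Fin.Base using (Fin; toℕ; fromℕ<; cast)
import Data.Fin.Properties as Fin
open import Data.Integer.Base using (ℤ; +_; -[1+_]; 0ℤ; 1ℤ; _+_; _-_; _*_; -_; _≤_)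
import Data.Integer.Properties as ℤ
open import Data.Integer.DivMod using (_/ℕ_; n%ℕd<d)
open import Data.List.Base using (List; []; _∷_; _∷ʳ_; map; filter; length; lookup; concatMap; allFin; upTo; cartesianProduct; deduplicate; foldr)
open import Data.List.NonEmpty.Base as List⁺ using (List⁺; toList; head; tail)
open import Data.List.Relation.Binary.Permutation.Propositional using (_↭_)
open import Data.List.Relation.Binary.Permutation.Propositional.Properties using (↭-length)
import Data.List.Sort
open import Data.Nat.Base using (ℕ; zero; suc; NonZero; _∸_; _<_)
open import Data.Nat.Divisibility using (_∣_)
open import Data.Nat.GeneralisedArithmetic using (fold)
open import Data.Product.Base using (∃-syntax; _×_; _,_)
open import Data.Product.Properties using (≡-dec)
open import Data.Rational.Base using (ℚ; _/_)
open import Function.Base using (_∘_)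
open import Function.Definitions using (Bijective)
open import Level using (0ℓ)
open import Relation.Binary.Bundles using (Setoid)
open import Relation.Binary.Definitions using (Decidable; DecidableEquality)
open import Relation.Binary.Indexed.Homogeneous.Bundles using (IndexedSetoid)
open import Relation.Binary.PropositionalEquality using (_≡_; refl; sym; trans)
open import Relation.Nullary.Decidable using (Dec; yes; no; _×-dec_)
open import Relation.Unary using (_∈_)

-- The element i of Fin n stands for the element suc (toℕ i) of
-- [n] = {1,…,n}, so that  z = rep (res n z) + quot n z * n.

rep : ∀ {n} → Fin n → ℤ
rep i = + suc (toℕ i)

res : ∀ n .{{_ : NonZero n}} → ℤ → Fin n
res n z = fromℕ< (n%ℕd<d (z - 1ℤ) n)

quot : ∀ n .{{_ : NonZero n}} → ℤ → ℤ
quot n z = (z - 1ℤ) /ℕ n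

sumℤ : List ℤ → ℤ
sumℤ = foldr _+_ 0ℤ

av : ∀ n .{{_ : NonZero n}} → (ℤ → ℤ) → ℚ
av n f = sumℤ (map (λ i → f (rep i) - rep i) (allFin n)) / n

record IsAffinePermutation (n : ℕ) (f : ℤ → ℤ) : Set where
  field
    bijective : Bijective _≡_ _≡_ f
    periodic  : ∀ i → f (i + + n) ≡ f i + + n

record 𝐁 (k n : ℕ) .{{_ : NonZero n}} (f : ℤ → ℤ) : Set where
  field
    isAffinePermutation : IsAffinePermutation n f
    average             : av n f ≡ + k / 1
    lower               : ∀ i → i ≤ f i
    upper               : ∀ i → f i ≤ i + + n

reduce : ∀ n .{{_ : NonZero n}} → (ℤ → ℤ) → Fin n → Fin n
reduce n f = res n ∘ f ∘ rep

-- The entries of (a₁ a₂ … a_m) satisfy σ a₁ = a₂, …, σ a_m = a₁.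
IsCycle : ∀ {n} → (Fin n → Fin n) → List⁺ (Fin n) → Set
IsCycle σ c = map σ (toList c) ≡ tail c ∷ʳ head c

record CycleDecomposition {n} (σ : Fin n → Fin n) : Set where
  field
    cycles    : List (List⁺ (Fin n))
    areCycles : ∀ j → IsCycle σ (lookup cycles j)
    -- every element of [n] occurs exactly once
    partition : concatMap toList cycles ↭ allFin n

  r : ℕ
  r = length cycles

  cycle : Fin r → List⁺ (Fin n)
  cycle = lookup cycles

SameCycle : ∀ {n} → (Fin n → Fin n) → Fin n → Fin n → Set
SameCycle {n} σ i j = ∃[ t ] fold i σ (toℕ {n} t) ≡ j

sameCycle? : ∀ {n} (σ : Fin n → Fin n) → Decidable (SameCycle σ)
sameCycle? σ i j = Fin.any? (λ t → fold i σ (toℕ t) Fin.≟ j)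

-- For a permutation σ of [n], one representative is kept from each cycle.
#cycles : ∀ {n} → (Fin n → Fin n) → ℕ
#cycles {n} σ = length (deduplicate (sameCycle? σ) (allFin n))

data Step : Set where
  R U : Step

Path : ℕ → Set
Path n = Fin n → Step

-- The bi-infinite path: the step with label i ∈ ℤ.
step : ∀ {n} .{{_ : NonZero n}} → Path n → ℤ → Step
step {n} P i = P (res n i)

Point : Set
Point = ℤ × ℤ

infixl 6 _⊕_ _⊖_

_⊕_ : Point → Point → Point
(x , y) ⊕ (x′ , y′) = x + x′ , y + y′

_⊖_ : Point → Point → Point
(x , y) ⊖ (x′ , y′) = x - x′ , y - y′

direction : Step → Point
direction R = 1ℤ , 0ℤ
direction U = 0ℤ , 1ℤ

-- vertex P i is the endpoint of step i and the starting point of step i + 1.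
module _ {n} .{{_ : NonZero n}} (P : Path n) where

  forward : ℕ → Point
  forward zero    = 0ℤ , 0ℤ
  forward (suc m) = forward m ⊕ direction (step P (+ suc m))

  backward : ℕ → Point
  backward zero    = 0ℤ , 0ℤ
  backward (suc m) = backward m ⊖ direction (step P (- (+ m)))

  vertex : ℤ → Point
  vertex (+ m)    = forward m
  vertex -[1+ m ] = backward (suc m)

𝒫 : ∀ k n .{{_ : NonZero n}} → Path n → Set
𝒫 k n P = vertex P (+ n) ≡ (+ n - + k , + k)

-- A unit box is named by its lower left corner.

-- The box at height h above step i of P, meant for step P i ≡ R.
boxAbove : ∀ {n} .{{_ : NonZero n}} → Path n → ℤ → ℕ → Point
boxAbove P i h = vertex P (i - 1ℤ) ⊕ (0ℤ , + h)

Strip : ∀ {n} .{{_ : NonZero n}} → ℕ → Path n → Point → Set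
Strip k P b = ∃[ i ] ∃[ h ] step P i ≡ R × h < k × b ≡ boxAbove P i h

-- A unit edge is named by its left, respectively lower, endpoint.
data Edge : Set where
  horizontal vertical : Point → Edge

edgeFrom : Step → Point → Edge
edgeFrom R = horizontal
edgeFrom U = vertical

southEdge : ∀ {n} .{{_ : NonZero n}} → Path n → ℤ → Edge
southEdge P i = edgeFrom (step P i) (vertex P (i - 1ℤ))

northEdge : ∀ {n} .{{_ : NonZero n}} → ℕ → Path n → ℤ → Edge
northEdge k P i = edgeFrom (step P i) (vertex P (i - 1ℤ) ⊕ (0ℤ , + k))

top bottom left right : Point → Edge
top    b = horizontal (b ⊕ (0ℤ , 1ℤ))
bottom b = horizontal b
left   b = vertical b
right  b = vertical (b ⊕ (1ℤ , 0ℤ))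

data Tile : Set where
  crossing elbow : Tile

_≟ₜ_ : DecidableEquality Tile
crossing ≟ₜ crossing = yes refl
crossing ≟ₜ elbow    = no λ ()
elbow    ≟ₜ crossing = no λ ()
elbow    ≟ₜ elbow    = yes refl

_≟ₚ_ : DecidableEquality Point
_≟ₚ_ = ≡-dec ℤ._≟_ ℤ._≟_

-- Only the values on the boxes of the strip matter: see _≈Deo_ below.
Filling : Set
Filling = Point → Tile

-- The box entered through a given edge by a strand travelling right or down.
boxEntered : Edge → Point
boxEntered (horizontal p) = p ⊖ (0ℤ , 1ℤ)
boxEntered (vertical p)   = p

exit : Tile → Edge → Edge
exit crossing e@(horizontal _) = bottom (boxEntered e)
exit crossing e@(vertical _)   = right  (boxEntered e)
exit elbow    e@(horizontal _) = right  (boxEntered e)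
exit elbow    e@(vertical _)   = bottom (boxEntered e)

next : Filling → Edge → Edge
next T e = exit (T (boxEntered e)) e

module _ {n} .{{_ : NonZero n}} (k : ℕ) (P : Path n) (T : Filling) where

  -- The edge reached after t boxes by the strand entering at northern edge i.
  -- Beyond the southern boundary this continues through boxes outside the
  -- strip; since the boundary is a right/up path and strands travel right/down,
  -- such a continuation never meets the boundary or the strip again.
  strand : ℤ → ℕ → Edge
  strand i t = fold (northEdge k P i) (next T) t

  HasStrandPermutation : (ℤ → ℤ) → Set
  HasStrandPermutation f = ∀ i → ∃[ t ] strand i t ≡ southEdge P (f i)

  Periodic : Set
  Periodic = ∀ b → b ∈ Strip k P → T (b ⊕ (+ n - + k , + k)) ≡ T b

  -- The strand i in its box number s and the strand j in its box number t
  -- are in the same box, and that box is a crossing.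
  CrossAt : ℤ → ℤ → ℕ × ℕ → Set
  CrossAt i j (s , t) =
    boxEntered (strand i s) ≡ boxEntered (strand j t) ×
    T (boxEntered (strand i s)) ≡ crossing

  crossAt? : ∀ i j st → Dec (CrossAt i j st)
  crossAt? i j (s , t) =
    (boxEntered (strand i s) ≟ₚ boxEntered (strand j t)) ×-dec
    (T (boxEntered (strand i s)) ≟ₜ crossing)

  -- The number of times that strands i and j cross within the first s boxes
  -- of i and the first t boxes of j.  A strand visits a box at most once, so
  -- this counts boxes.
  #crossings : ℤ → ℕ → ℤ → ℕ → ℕ
  #crossings i s j t =
    length (filter (crossAt? i j) (cartesianProduct (upTo s) (upTo t)))

  Distinguished : Set
  Distinguished = ∀ b i s j t → b ∈ Strip k P → T b ≡ elbow →
    strand i s ≡ top b → strand j t ≡ left b → 2 ∣ #crossings i s j t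

  ElbowAbove : Fin n × ℕ → Set
  ElbowAbove (i , h) = P i ≡ R × T (boxAbove P (rep i) h) ≡ elbow

  elbowAbove? : ∀ ih → Dec (ElbowAbove ih)
  elbowAbove? (i , h) = (P i ≟ₛ R) ×-dec (T (boxAbove P (rep i) h) ≟ₜ elbow)
    where
    _≟ₛ_ : DecidableEquality Step
    R ≟ₛ R = yes refl
    R ≟ₛ U = no λ ()
    U ≟ₛ R = no λ ()
    U ≟ₛ U = yes refl

  -- The number of elbows modulo translation by (n - k , k): the boxes above
  -- steps 1,…,n of P are a fundamental domain of the strip.
  #elbows : ℕ
  #elbows = length (filter elbowAbove? (cartesianProduct (allFin n) (upTo k)))

  record IsDeogram (f : ℤ → ℤ) : Set where
    field
      periodic          : Periodic
      strandPermutation : HasStrandPermutation f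
      distinguished     : Distinguished

module _ (k n : ℕ) .{{_ : NonZero n}} (f : ℤ → ℤ) (P : Path n) where

  record MaximalDeogram : Set where
    field
      tile      : Filling
      isDeogram : IsDeogram k P tile f
      maximal   : #elbows k P tile ≡ n ∸ #cycles (reduce n f)

  open MaximalDeogram

  _≈Deo_ : MaximalDeogram → MaximalDeogram → Set
  D ≈Deo E = ∀ b → b ∈ Strip k P → tile D b ≡ tile E b

  Deoᵐᵃˣ : Setoid 0ℓ 0ℓ
  Deoᵐᵃˣ = record
    { Carrier       = MaximalDeogram
    ; _≈_           = _≈Deo_
    ; isEquivalence = record
      { refl  = λ _ _ → refl
      ; sym   = λ p b b∈ → sym (p b b∈)
      ; trans = λ p q b b∈ → trans (p b b∈) (q b b∈)
      }
    }

Πₛ : ∀ {I : Set} → (I → Setoid 0ℓ 0ℓ) → Setoid 0ℓ 0ℓ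
Πₛ {I} S = IndexedSetoid.setoid {I = I} (record
  { Carrierᵢ       = λ i → Setoid.Carrier (S i)
  ; _≈ᵢ_           = λ {i} → Setoid._≈_ (S i)
  ; isEquivalenceᵢ = record
    { reflᵢ  = λ {i} → Setoid.refl (S i)
    ; symᵢ   = λ {i} → Setoid.sym (S i)
    ; transᵢ = λ {i} → Setoid.trans (S i)
    }
  })

-- Restriction to the set S ⊂ ℤ of the integers congruent modulo n to an
-- entry of the cycle c.

module _ {n} .{{_ : NonZero n}} (c : List⁺ (Fin n)) where

  open Data.List.Sort (Fin.≤-decTotalOrder n) using (sort; sort-↭)

  size : ℕ
  size = List⁺.length c

  -- The elements of S ∩ [n] in increasing order.
  enumerate : Fin size → Fin n
  enumerate p =
    lookup (sort (toList c)) (cast (sym (↭-length (sort-↭ (toList c)))) p)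

  -- The number of elements of S ∩ [n] less than x.
  rank : Fin n → ℕ
  rank x = length (filter (Fin._<? x) (toList c))

  -- The order-preserving bijection ℤ → S sending 1 to min (S ∩ ℤ≥1), and its
  -- inverse S → ℤ, extended to all of ℤ.
  fromIndex : ℤ → ℤ
  fromIndex z = rep (enumerate (res size z)) + quot size z * + n

  toIndex : ℤ → ℤ
  toIndex z = + suc (rank (res n z)) + quot n z * + size

  restrict : (ℤ → ℤ) → (ℤ → ℤ)
  restrict f = toIndex ∘ f ∘ fromIndex

  restrictPath : Path n → Path size
  restrictPath P = P ∘ enumerate

{-# OPTIONS --safe #-}

-- Form a graph on [n]: an elbow in the column of step i and the row of step j joins i and
-- j modulo n.  A strand changes wires only at elbows, so the northern and the southern label
-- of a strand lie in one component, and every component is a union of cycles of f modulo n.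
-- With only n - c elbows the graph is a forest whose components are exactly the cycles;
-- hence the two wires through an elbow always have the same colour (cycle).  A strand
-- therefore stays on wires of its own colour, and crosses the other wires straight.
-- Deleting all columns and rows of other colours turns a maximal Deogram into one for
-- f_j and P_j, and superposing maximal Deograms for all colours, with crossings in the
-- boxes of mixed colour, is the inverse operation.  The elbow counts match because each
-- colour needs at least n_j - 1 elbows.  That P_j has k_j up-steps follows by letting the
-- strands run from the northern to the southern boundary: at the start the displacements
-- on colour j sum to n_j times the number of up-steps, and an elbow exchanges two labels,
-- which preserves the sum.

module Submission where

open import Defs
open import Data.Empty using (⊥; ⊥-elim)
open import Data.Fin.Base as Fin using (Fin; toℕ; fromℕ<)
import Data.Fin.Properties as FinP
open import Data.Fin.Properties using (toℕ-injective; toℕ-fromℕ<; toℕ<n)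
open import Data.Integer.Base using (ℤ; +_; -[1+_]; 0ℤ; 1ℤ; _+_; _-_; _*_; -_; +≤+; +<+; ∣_∣)
  renaming (_≤_ to _≤ᶻ_; _<_ to _<ᶻ_)
open import Data.Integer.DivMod using (_%ℕ_; n%ℕd<d; a≡a%ℕn+[a/ℕn]*n)
import Data.Integer.Divisibility.Signed as ℤD
import Data.Integer.Properties as ℤP
open import Data.Integer.Tactic.RingSolver using (solve-∀)
open import Data.List.Base using
  (List; []; _∷_; _∷ʳ_; _++_; map; filter; length; lookup; tabulate; concatMap; allFin; upTo;
    cartesianProduct; deduplicate)
open import Data.List.Membership.DecPropositional using () renaming (_∈?_ to decide-∈)
open import Data.List.Membership.Propositional using () renaming (_∈_ to _∈ₗ_)
open import Data.List.Membership.Propositional.Properties using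
  (∈-allFin; ∈-map⁺; ∈-map⁻; ∈-filter⁺; ∈-filter⁻; ∈-concatMap⁺; ∈-concatMap⁻; ∈-lookup;
    ∈-cartesianProduct⁺; ∈-upTo⁺; ∈-++⁻; ∈-++⁺ˡ; ∈-++⁺ʳ)
open import Data.List.Membership.Propositional.Properties.WithK using (unique∧set⇒bag)
open import Data.List.NonEmpty.Base using (List⁺; toList; head; tail)
import Data.List.Properties as ListP
open import Data.List.Relation.Binary.BagAndSetEquality using (∼bag⇒↭)
open import Data.List.Relation.Binary.Permutation.Propositional as Perm using (_↭_; ↭-sym; ↭⇒↭ₛ)
open import Data.List.Relation.Binary.Permutation.Propositional.Properties using
  (↭-length; ∈-resp-↭; filter-↭)
import Data.List.Relation.Binary.Permutation.Setoid.Properties as PermS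
open import Data.List.Relation.Unary.All as All using (All; []; _∷_)
open import Data.List.Relation.Unary.AllPairs as AllPairs using (AllPairs; []; _∷_)
import Data.List.Relation.Unary.AllPairs.Properties as AllPairsP
open import Data.List.Relation.Unary.Any as Any using (Any; here; there)
import Data.List.Relation.Unary.Any.Properties as AnyP
open import Data.List.Relation.Unary.Sorted.TotalOrder.Properties using (Sorted⇒AllPairs)
open import Data.List.Relation.Unary.Unique.Propositional using (Unique)
import Data.List.Relation.Unary.Unique.Propositional.Properties as UniqueP
open import Data.List.Relation.Unary.Unique.Propositional.Properties using (allFin⁺)
import Data.List.Sort
open import Data.Nat.Base as ℕ using (ℕ; zero; suc; NonZero; _≤_)
open import Data.Nat.Divisibility using (_∣_)
open import Data.Nat.GeneralisedArithmetic using (fold)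
open import Data.Nat.Induction using (<-rec)
import Data.Nat.Properties as ℕP
open import Data.Product.Base using (∃; ∃-syntax; Σ-syntax; _×_; _,_; proj₁; proj₂)
open import Data.Rational.Base using (_/_)
open import Data.Rational.Properties using (fromℚᵘ-cong)
open import Data.Rational.Unnormalised.Base using (mkℚᵘ; *≡*)
open import Data.Sum.Base using (_⊎_; inj₁; inj₂)
open import Function.Base using (_∘_; _∋_; id)
open import Function.Bundles using (Bijection; mk⇔)
open import Relation.Binary.Bundles using (DecTotalOrder; Setoid)
open import Relation.Binary.PropositionalEquality using
  (_≡_; _≢_; refl; sym; trans; cong; cong₂; subst; subst₂; setoid; module ≡-Reasoning)
open import Relation.Nullary.Decidable using (Dec; yes; no; _×-dec_; map′; ¬?)
open import Relation.Nullary.Negation.Core using (¬_; contradiction)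
open import Relation.Unary using (_∈_; _∉_)

-- Integers and residues

-- The strips of P and of P_j have different coordinates, and they are compared through labels
-- alone. A box is a pair `a < b < a + n` of an R-step and a U-step, and `Labels` follows strands in
-- terms of a tile function on such pairs. A `Realization` says that the columns and rows picked out
-- by an increasing `φ` in some strip carry a given label tiling. One label tiling is realized
-- twice: by colour j inside the strip of P, and by the whole strip of P_j. Permutation, parity of
-- crossings and number of elbows are read off it on both sides.
--
-- On labels a strand is traced from its current wire back to the north, because then each
-- antidiagonal acts by an involution `τ` of the wires that commutes with the period. Injectivity,
-- the displacement sum and constancy on graph components become short inductions on antidiagonals.
--
-- The label computation uses the steps of the path, not where it ends. It thus applies to colour j
-- before P_j is known to have k_j up-steps, and statement (1) is obtained from it; only the
-- realization on the strip of P_j presupposes a path with the right endpoint.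

lin : ∀ {a b c d} → a ≤ᶻ b → d - c ≡ b - a → c ≤ᶻ d
lin a≤b eq = ℤP.0≤i-j⇒j≤i (subst (0ℤ ≤ᶻ_) (sym eq) (ℤP.i≤j⇒0≤j-i a≤b))

z+d-d : ∀ z d → z + d - d ≡ z
z+d-d = solve-∀

z-d+d : ∀ z d → z - d + d ≡ z
z-d+d = solve-∀

infixl 6 _⊹_
_⊹_ : ∀ {a b c d} → a ≤ᶻ b → c ≤ᶻ d → a + c ≤ᶻ b + d
_⊹_ = ℤP.+-mono-≤

-- Pattern for refuting linear systems: the hypotheses are added up with `_⊹_`, and the ring solver
-- checks that the total slack is -1. `lin` and `lin<` derive inequalities in the same way.
lin-absurd : ∀ {a b} → a ≤ᶻ b → b - a ≡ - 1ℤ → ⊥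
lin-absurd a≤b eq with subst (0ℤ ≤ᶻ_) eq (ℤP.i≤j⇒0≤j-i a≤b)
... | ()

<⇒+1≤ : ∀ {a b} → a <ᶻ b → a + 1ℤ ≤ᶻ b
<⇒+1≤ {a} {b} a<b = subst (_≤ᶻ b) (ℤP.+-comm 1ℤ a) (ℤP.i<j⇒suc[i]≤j a<b)

+1≤⇒< : ∀ a {b} → a + 1ℤ ≤ᶻ b → a <ᶻ b
+1≤⇒< a {b} a<b = ℤP.suc[i]≤j⇒i<j (subst (_≤ᶻ b) (ℤP.+-comm a 1ℤ) a<b)

lin< : ∀ {a b c d} → a ≤ᶻ b → d - (c + 1ℤ) ≡ b - a → c <ᶻ d
lin< {c = c} a≤b eq = +1≤⇒< c (lin a≤b eq)

≤-split : ∀ a b → a ≤ᶻ b ⊎ b <ᶻ a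
≤-split a b with a ℤP.≤? b
... | yes a≤b = inj₁ a≤b
... | no  a≰b = inj₂ (ℤP.≰⇒> a≰b)

≤⇒distance : ∀ {a b} → a ≤ᶻ b → ∃[ t ] b ≡ a + + t
≤⇒distance {a} {b} a≤b = ∣ b - a ∣ , sym (begin
  a + + ∣ b - a ∣ ≡⟨ cong (_+_ a) (ℤP.0≤i⇒+∣i∣≡i (ℤP.i≤j⇒0≤j-i a≤b)) ⟩
  a + (b - a)     ≡⟨ ((∀ x y → x + (y - x) ≡ y) ∋ solve-∀) a b ⟩
  b ∎)
  where open ≡-Reasoning

ℤ-induction : (Q : ℤ → Set) → Q 0ℤ → (∀ i → Q i → Q (i + 1ℤ)) → (∀ i → Q (i + 1ℤ) → Q i) → ∀ i → Q i
ℤ-induction Q base up down (+ zero)  = base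
ℤ-induction Q base up down (+ suc m) =
  subst Q (ℤP.+-comm (+ m) 1ℤ) (up (+ m) (ℤ-induction Q base up down (+ m)))
ℤ-induction Q base up down -[1+ zero ] = down -[1+ zero ] base
ℤ-induction Q base up down -[1+ suc m ] = down -[1+ suc m ] (ℤ-induction Q base up down -[1+ m ])

shift-all : (Q : ℤ → Set) (n : ℤ) → (∀ i → Q i → Q (i + n)) → (∀ i → Q (i + n) → Q i) →
            ∀ q i → Q i → Q (i + q * n)
shift-all Q n up down q i Qi = ℤ-induction (λ q → Q (i + q * n))
  (subst Q (((∀ x y → x ≡ x + 0ℤ * y) ∋ solve-∀) i n) Qi)
  (λ q H → subst Q (sym (next-multiple i q n)) (up _ H))
  (λ q H → down _ (subst Q (next-multiple i q n) H)) q
  where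
  next-multiple : ∀ i q n → i + (q + 1ℤ) * n ≡ i + q * n + n
  next-multiple = solve-∀

shift-map : (g : ℤ → ℤ) (n c : ℤ) → (∀ i → g (i + n) ≡ g i + c) → ∀ q i → g (i + q * n) ≡ g i + q * c
shift-map g n c per q i = trans
  (sym (((∀ u v w → u - v * w + v * w ≡ u) ∋ solve-∀) (g (i + q * n)) q c))
  (cong (_+ q * c) (ℤ-induction (λ q → g (i + q * n) - q * c ≡ g i) base up down q))
  where
  base : g (i + 0ℤ * n) - 0ℤ * c ≡ g i
  base = trans (((∀ u c → u - 0ℤ * c ≡ u) ∋ solve-∀) _ c)
               (cong g (((∀ x y → x + 0ℤ * y ≡ x) ∋ solve-∀) i n))
  step′ : ∀ q → g (i + (q + 1ℤ) * n) - (q + 1ℤ) * c ≡ g (i + q * n) - q * c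
  step′ q = trans
    (cong (λ w → g w - (q + 1ℤ) * c) (((∀ i q n → i + (q + 1ℤ) * n ≡ i + q * n + n) ∋ solve-∀) i q n))
    (trans (cong (_- (q + 1ℤ) * c) (per (i + q * n)))
           (((∀ u q c → u + c - (q + 1ℤ) * c ≡ u - q * c) ∋ solve-∀) (g (i + q * n)) q c))
  up : ∀ q → g (i + q * n) - q * c ≡ g i → g (i + (q + 1ℤ) * n) - (q + 1ℤ) * c ≡ g i
  up q H = trans (step′ q) H
  down : ∀ q → g (i + (q + 1ℤ) * n) - (q + 1ℤ) * c ≡ g i → g (i + q * n) - q * c ≡ g i
  down q H = trans (sym (step′ q)) H

module _ (n : ℕ) .{{_ : NonZero n}} where

  rep-lower : (i : Fin n) → 1ℤ ≤ᶻ rep i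
  rep-lower i = +≤+ (ℕ.s≤s ℕ.z≤n)

  rep-upper : (i : Fin n) → rep i ≤ᶻ + n
  rep-upper i = +≤+ (toℕ<n i)

  rep-injective : {i j : Fin n} → rep i ≡ rep j → i ≡ j
  rep-injective eq = toℕ-injective (ℕP.suc-injective (ℤP.+-injective eq))

  rep-res-quot : ∀ z → z ≡ rep (res n z) + quot n z * + n
  rep-res-quot z = begin
    z                                         ≡⟨ ((∀ z → z ≡ 1ℤ + (z - 1ℤ)) ∋ solve-∀) z ⟩
    1ℤ + (z - 1ℤ)                             ≡⟨ cong (_+_ 1ℤ) (a≡a%ℕn+[a/ℕn]*n (z - 1ℤ) n) ⟩
    1ℤ + (+ ((z - 1ℤ) %ℕ n) + quot n z * + n) ≡⟨ ℤP.+-assoc 1ℤ (+ ((z - 1ℤ) %ℕ n)) (quot n z * + n) ⟨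
    1ℤ + + ((z - 1ℤ) %ℕ n) + quot n z * + n   ≡⟨ cong (λ w → 1ℤ + + w + quot n z * + n)
                                                   (toℕ-fromℕ< (n%ℕd<d (z - 1ℤ) n)) ⟨
    rep (res n z) + quot n z * + n ∎
    where open ≡-Reasoning

  private
    below : ∀ (i j : Fin n) a b → rep i + a * + n ≡ rep j + b * + n → a ≤ᶻ b
    below i j a b eq with ≤-split a b
    ... | inj₁ a≤b = a≤b
    ... | inj₂ b<a = ⊥-elim (lin-absurd
      (ℤP.*-monoʳ-≤-nonNeg (+ n) (<⇒+1≤ b<a) ⊹ rep-lower i ⊹ rep-upper j)
      (trans (((∀ a b n ri rj →
        a * n + ri + n - ((b + 1ℤ) * n + 1ℤ + rj) ≡ (ri + a * n) - (rj + b * n) - 1ℤ) ∋ solve-∀) a b (+ n)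
          (rep i) (rep j))
        (trans (cong (λ w → w - (rep j + b * + n) - 1ℤ) eq)
          (((∀ w → w - w - 1ℤ ≡ - 1ℤ) ∋ solve-∀) (rep j + b * + n)))))

  rep+-unique : ∀ {i j : Fin n} {a b} → rep i + a * + n ≡ rep j + b * + n → i ≡ j × a ≡ b
  rep+-unique {i} {j} {a} {b} eq with ℤP.≤-antisym (below i j a b eq) (below j i b a (sym eq))
  ... | refl = rep-injective (trans (((∀ x y → x ≡ x + y - y) ∋ solve-∀) (rep i) (a * + n))
                (trans (cong (_- a * + n) eq) (((∀ x y → x + y - y ≡ x) ∋ solve-∀) (rep j) (a * + n)))) ,
                  refl

  res-rep+ : ∀ (i : Fin n) q → res n (rep i + q * + n) ≡ i
  res-rep+ i q = sym (proj₁
    (rep+-unique {a = q} {b = quot n (rep i + q * + n)} (rep-res-quot (rep i + q * + n))))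

  quot-rep+ : ∀ (i : Fin n) q → quot n (rep i + q * + n) ≡ q
  quot-rep+ i q = sym (proj₂
    (rep+-unique {a = q} {b = quot n (rep i + q * + n)} (rep-res-quot (rep i + q * + n))))

  res-rep : ∀ (i : Fin n) → res n (rep i) ≡ i
  res-rep i = trans (cong (res n) (((∀ x y → x ≡ x + 0ℤ * y) ∋ solve-∀) (rep i) (+ n))) (res-rep+ i 0ℤ)

  quot-rep : ∀ (i : Fin n) → quot n (rep i) ≡ 0ℤ
  quot-rep i = trans (cong (quot n) (((∀ x y → x ≡ x + 0ℤ * y) ∋ solve-∀) (rep i) (+ n))) (quot-rep+ i 0ℤ)

  private
    shifted : ∀ z q → z + q * + n ≡ rep (res n z) + (quot n z + q) * + n
    shifted z q = trans (cong (_+ q * + n) (rep-res-quot z))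
      (((∀ r a q n → r + a * n + q * n ≡ r + (a + q) * n) ∋ solve-∀) (rep (res n z)) (quot n z) q (+ n))

  res-shift : ∀ z q → res n (z + q * + n) ≡ res n z
  res-shift z q = trans (cong (res n) (shifted z q)) (res-rep+ (res n z) (quot n z + q))

  quot-shift : ∀ z q → quot n (z + q * + n) ≡ quot n z + q
  quot-shift z q = trans (cong (quot n) (shifted z q)) (quot-rep+ (res n z) (quot n z + q))

  res-+n : ∀ z → res n (z + + n) ≡ res n z
  res-+n z = trans (cong (λ w → res n (z + w)) (sym (ℤP.*-identityˡ (+ n)))) (res-shift z 1ℤ)

  quot-+n : ∀ z → quot n (z + + n) ≡ quot n z + 1ℤ
  quot-+n z = trans (cong (λ w → quot n (z + w)) (sym (ℤP.*-identityˡ (+ n)))) (quot-shift z 1ℤ)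

  res≡⇒shift : ∀ {x y} → res n x ≡ res n y → x ≡ y + (quot n x - quot n y) * + n
  res≡⇒shift {x} {y} eq = begin
    x                                         ≡⟨ rep-res-quot x ⟩
    rep (res n x) + quot n x * + n            ≡⟨ cong (λ w → rep w + quot n x * + n) eq ⟩
    rep (res n y) + quot n x * + n            ≡⟨
      ((∀ r a b n → r + a * n ≡ r + b * n + (a - b) * n) ∋ solve-∀) (rep (res n y)) (quot n x) (quot n y)
        (+ n) ⟩
    rep (res n y) + quot n y * + n + (quot n x - quot n y) * + n ≡⟨
      cong (_+ (quot n x - quot n y) * + n) (rep-res-quot y) ⟨
    y + (quot n x - quot n y) * + n ∎
    where open ≡-Reasoning

module Increasing {φ : ℤ → ℤ} (φ-increasing : ∀ {a b} → a <ᶻ b → φ a <ᶻ φ b) where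

  φ-mono : ∀ {a b} → a ≤ᶻ b → φ a ≤ᶻ φ b
  φ-mono {a} {b} a≤b with a ℤP.≟ b
  ... | yes refl = ℤP.≤-refl
  ... | no  a≢b  = ℤP.<⇒≤ (φ-increasing (ℤP.≤∧≢⇒< a≤b a≢b))

  φ-cancel-< : ∀ {a b} → φ a <ᶻ φ b → a <ᶻ b
  φ-cancel-< {a} {b} φa<φb with ≤-split b a
  ... | inj₁ b≤a = contradiction (φ-mono b≤a) (ℤP.<⇒≱ φa<φb)
  ... | inj₂ a<b = a<b

  φ-cancel-≤ : ∀ {a b} → φ a ≤ᶻ φ b → a ≤ᶻ b
  φ-cancel-≤ {a} {b} φa≤φb with ≤-split a b
  ... | inj₁ a≤b = a≤b
  ... | inj₂ b<a = contradiction φa≤φb (ℤP.<⇒≱ (φ-increasing b<a))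

  φ-injective : ∀ {a b} → φ a ≡ φ b → a ≡ b
  φ-injective eq = ℤP.≤-antisym (φ-cancel-≤ (ℤP.≤-reflexive eq)) (φ-cancel-≤ (ℤP.≤-reflexive (sym eq)))

-- Tiles, walks and lattice paths

boxEntered-top : ∀ b → boxEntered (top b) ≡ b
boxEntered-top (x , y) =
  cong₂ _,_ (((∀ x → x + 0ℤ - 0ℤ ≡ x) ∋ solve-∀) x) (((∀ x → x + 1ℤ - 1ℤ ≡ x) ∋ solve-∀) y)

top-boxEntered : ∀ p → top (boxEntered (horizontal p)) ≡ horizontal p
top-boxEntered (x , y) = cong horizontal (cong₂ _,_ (z-d+d x 0ℤ) (z-d+d y 1ℤ))

module Tiles (T : Filling) where

  next-top-crossing : ∀ b → T b ≡ crossing → next T (top b) ≡ bottom b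
  next-top-crossing b eq = trans
    (cong (λ t → exit t (top b)) (trans (cong T (boxEntered-top b)) eq)) (cong bottom (boxEntered-top b))

  next-top-elbow : ∀ b → T b ≡ elbow → next T (top b) ≡ right b
  next-top-elbow b eq = trans
    (cong (λ t → exit t (top b)) (trans (cong T (boxEntered-top b)) eq)) (cong right (boxEntered-top b))

  next-left-crossing : ∀ b → T b ≡ crossing → next T (left b) ≡ right b
  next-left-crossing b eq rewrite eq = refl

  next-left-elbow : ∀ b → T b ≡ elbow → next T (left b) ≡ bottom b
  next-left-elbow b eq rewrite eq = refl

  private
    enterBottom enterRight : Tile → Point → Edge
    enterBottom crossing = top
    enterBottom elbow    = left
    enterRight  crossing = left
    enterRight  elbow    = top

    ⊕⊖ : ∀ b → b ⊕ (1ℤ , 0ℤ) ⊖ (1ℤ , 0ℤ) ≡ b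
    ⊕⊖ (x , y) = cong₂ _,_ (((∀ x → x + 1ℤ - 1ℤ ≡ x) ∋ solve-∀) x) (((∀ x → x + 0ℤ - 0ℤ ≡ x) ∋ solve-∀) y)

  -- A left inverse of `next T`: an edge determines the box that it leaves, and the tile of that box
  -- determines the edge of entry. Strands can therefore be traced back.
  previous : Edge → Edge
  previous (horizontal b) = enterBottom (T b) b
  previous (vertical p)   = enterRight (T (p ⊖ (1ℤ , 0ℤ))) (p ⊖ (1ℤ , 0ℤ))

  previous-next : ∀ e → previous (next T e) ≡ e
  previous-next (horizontal p) with T (boxEntered (horizontal p)) in eq
  ... | crossing = trans (cong (λ t → enterBottom t (boxEntered (horizontal p))) eq) (top-boxEntered p)
  ... | elbow    = trans
    (cong (λ b → enterRight (T b) b) (⊕⊖ (boxEntered (horizontal p))))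
    (trans (cong (λ t → enterRight t (boxEntered (horizontal p))) eq) (top-boxEntered p))
  previous-next (vertical p) with T p in eq
  ... | crossing = trans (cong (λ b → enterRight (T b) b) (⊕⊖ p)) (cong (λ t → enterRight t p) eq)
  ... | elbow    = cong (λ t → enterBottom t p) eq

  next-injective : ∀ {e e′} → next T e ≡ next T e′ → e ≡ e′
  next-injective {e} {e′} eq = trans (sym (previous-next e)) (trans (cong previous eq) (previous-next e′))

  -- Twice the coordinates of the midpoint of an edge.
  midX midY : Edge → ℤ
  midX (horizontal (x , y)) = x + x + 1ℤ
  midX (vertical   (x , y)) = x + x
  midY (horizontal (x , y)) = y + y
  midY (vertical   (x , y)) = y + y + 1ℤ

  IsHorizontal IsVertical : Edge → Set
  IsHorizontal e = ∃[ p ] e ≡ horizontal p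
  IsVertical   e = ∃[ p ] e ≡ vertical p

  private
    -- A strand entering from the top loses height whatever the tile, and one entering from the left
    -- gains horizontally; the other coordinate stands still at a crossing.
    move : ∀ e → (midX e ≤ᶻ midX (next T e) × midY (next T e) ≤ᶻ midY e) ×
                 (IsHorizontal e → midY (next T e) <ᶻ midY e) ×
                 (IsVertical e → midX e <ᶻ midX (next T e))
    move (horizontal (x , y)) with T (boxEntered (horizontal (x , y)))
    ... | crossing = (lin (ℤP.≤-refl {0ℤ})
        (((∀ x → x - 0ℤ + (x - 0ℤ) + 1ℤ - (x + x + 1ℤ) ≡ 0ℤ - 0ℤ) ∋ solve-∀) x) ,
                      lin (+≤+ {0} {2} ℕ.z≤n)
                        (((∀ y → y + y - (y - 1ℤ + (y - 1ℤ)) ≡ + 2 - 0ℤ) ∋ solve-∀) y)) ,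
                     (λ _ → lin< (+≤+ {0} {1} ℕ.z≤n)
                       (((∀ y → y + y - (y - 1ℤ + (y - 1ℤ) + 1ℤ) ≡ + 1 - 0ℤ) ∋ solve-∀) y)) ,
                     λ ()
    ... | elbow = (lin (+≤+ {0} {1} ℕ.z≤n)
        (((∀ x → x - 0ℤ + 1ℤ + (x - 0ℤ + 1ℤ) - (x + x + 1ℤ) ≡ + 1 - 0ℤ) ∋ solve-∀) x) ,
                   lin (+≤+ {0} {1} ℕ.z≤n)
                     (((∀ y → y + y - (y - 1ℤ + 0ℤ + (y - 1ℤ + 0ℤ) + 1ℤ) ≡ + 1 - 0ℤ) ∋ solve-∀) y)) ,
                  (λ _ → lin< (ℤP.≤-refl {0ℤ})
                    (((∀ y → y + y - (y - 1ℤ + 0ℤ + (y - 1ℤ + 0ℤ) + 1ℤ + 1ℤ) ≡ 0ℤ - 0ℤ) ∋ solve-∀) y)) ,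
                  λ ()
    move (vertical (x , y)) with T (x , y)
    ... | crossing = (lin (+≤+ {0} {2} ℕ.z≤n) (((∀ x → x + 1ℤ + (x + 1ℤ) - (x + x) ≡ + 2 - 0ℤ) ∋ solve-∀) x)
        ,
                      lin (ℤP.≤-refl {0ℤ}) (((∀ y → y + y + 1ℤ - (y + 0ℤ + (y + 0ℤ) + 1ℤ) ≡ 0ℤ - 0ℤ) ∋
                        solve-∀) y)) ,
                     (λ ()) ,
                     λ _ → lin< (+≤+ {0} {1} ℕ.z≤n)
                       (((∀ x → x + 1ℤ + (x + 1ℤ) - (x + x + 1ℤ) ≡ + 1 - 0ℤ) ∋ solve-∀) x)
    ... | elbow = (lin (+≤+ {0} {1} ℕ.z≤n) (((∀ x → x + x + 1ℤ - (x + x) ≡ + 1 - 0ℤ) ∋ solve-∀) x) ,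
                   lin (+≤+ {0} {1} ℕ.z≤n) (((∀ y → y + y + 1ℤ - (y + y) ≡ + 1 - 0ℤ) ∋ solve-∀) y)) ,
                  (λ ()) ,
                  λ _ → +1≤⇒< (x + x) ℤP.≤-refl

  walk : Edge → ℕ → Edge
  walk e = fold e (next T)

  midX-walk : ∀ e s → midX e ≤ᶻ midX (walk e s)
  midX-walk e zero    = ℤP.≤-refl
  midX-walk e (suc s) = ℤP.≤-trans (midX-walk e s) (proj₁ (proj₁ (move (walk e s))))

  midY-walk : ∀ e s → midY (walk e s) ≤ᶻ midY e
  midY-walk e zero    = ℤP.≤-refl
  midY-walk e (suc s) = ℤP.≤-trans (proj₂ (proj₁ (move (walk e s)))) (midY-walk e s)

  midY-walk-strict : ∀ e s → IsHorizontal e → midY (walk e (suc s)) <ᶻ midY e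
  midY-walk-strict e zero    h = proj₁ (proj₂ (move e)) h
  midY-walk-strict e (suc s) h =
    ℤP.≤-<-trans (proj₂ (proj₁ (move (walk e (suc s))))) (midY-walk-strict e s h)

  midX-walk-strict : ∀ e s → IsVertical e → midX e <ᶻ midX (walk e (suc s))
  midX-walk-strict e zero    v = proj₂ (proj₂ (move e)) v
  midX-walk-strict e (suc s) v =
    ℤP.<-≤-trans (midX-walk-strict e s v) (proj₁ (proj₁ (move (walk e (suc s)))))

  walk-cancel : ∀ e e′ s t → walk e s ≡ walk e′ (s ℕ.+ t) → e ≡ walk e′ t
  walk-cancel e e′ zero    t eq = eq
  walk-cancel e e′ (suc s) t eq = walk-cancel e e′ s t (next-injective eq)

<⇒≤-1 : ∀ {a b} → a <ᶻ b → a ≤ᶻ b - 1ℤ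
<⇒≤-1 {a} {b} a<b = lin (<⇒+1≤ a<b) (((∀ a b → b - 1ℤ - a ≡ b - (a + 1ℤ)) ∋ solve-∀) a b)

step-cases : (s : Step) → s ≡ R ⊎ s ≡ U
step-cases R = inj₁ refl
step-cases U = inj₂ refl

-- The two coordinates are separate functions of the label, so that columns and rows can share
-- arguments such as `label-unique` and `label?`. For the instance `periodicPath`, the edges `N` and
-- `S` agree by computation with `northEdge` and `southEdge`, so strands are walks from `N`.
record PeriodicPath (n k : ℕ) : Set where
  field
    p           : ℤ → Step
    X Y         : ℤ → ℤ
    vertex-step : ∀ l → (X l , Y l) ≡ (X (l - 1ℤ) , Y (l - 1ℤ)) ⊕ direction (p l)
    p-periodic  : ∀ l → p (l + + n) ≡ p l
    X-periodic  : ∀ l → X (l + + n) ≡ X l + (+ n - + k)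
    Y-periodic  : ∀ l → Y (l + + n) ≡ Y l + + k

  N : ℤ → Edge
  N i = edgeFrom (p i) ((X (i - 1ℤ) , Y (i - 1ℤ)) ⊕ (0ℤ , + k))

  S : ℤ → Edge
  S i = edgeFrom (p i) (X (i - 1ℤ) , Y (i - 1ℤ))

module Geometry {n k : ℕ} (Γ : PeriodicPath n k) where
  open PeriodicPath Γ

  module _ {l} (l-R : p l ≡ R) where
    X-R : X l ≡ X (l - 1ℤ) + 1ℤ
    X-R = trans (cong proj₁ (vertex-step l)) (cong (λ s → X (l - 1ℤ) + proj₁ (direction s)) l-R)

    Y-R : Y l ≡ Y (l - 1ℤ)
    Y-R = trans (cong proj₂ (vertex-step l))
      (trans (cong (λ s → Y (l - 1ℤ) + proj₂ (direction s)) l-R) (ℤP.+-identityʳ _))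

  module _ {l} (l-U : p l ≡ U) where
    X-U : X l ≡ X (l - 1ℤ)
    X-U = trans (cong proj₁ (vertex-step l))
      (trans (cong (λ s → X (l - 1ℤ) + proj₁ (direction s)) l-U) (ℤP.+-identityʳ _))

    Y-U : Y l ≡ Y (l - 1ℤ) + 1ℤ
    Y-U = trans (cong proj₂ (vertex-step l)) (cong (λ s → Y (l - 1ℤ) + proj₂ (direction s)) l-U)

  X≤ : ∀ l → X (l - 1ℤ) ≤ᶻ X l
  X≤ l with step-cases (p l)
  ... | inj₁ r = subst (X (l - 1ℤ) ≤ᶻ_) (sym (X-R r)) (ℤP.i≤i+j _ 1ℤ)
  ... | inj₂ u = ℤP.≤-reflexive (sym (X-U u))

  Y≤ : ∀ l → Y (l - 1ℤ) ≤ᶻ Y l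
  Y≤ l with step-cases (p l)
  ... | inj₁ r = ℤP.≤-reflexive (sym (Y-R r))
  ... | inj₂ u = subst (Y (l - 1ℤ) ≤ᶻ_) (sym (Y-U u)) (ℤP.i≤i+j _ 1ℤ)

  private
    monotone : (Z : ℤ → ℤ) → (∀ l → Z (l - 1ℤ) ≤ᶻ Z l) → ∀ {a b} → a ≤ᶻ b → Z a ≤ᶻ Z b
    monotone Z Z≤ {a} a≤b with ≤⇒distance a≤b
    ... | t , refl = go t
      where
      go : ∀ t → Z a ≤ᶻ Z (a + + t)
      go zero    = ℤP.≤-reflexive (cong Z (sym (ℤP.+-identityʳ a)))
      go (suc t) = ℤP.≤-trans (go t) (subst (λ w → Z w ≤ᶻ Z (a + + suc t))
        (((∀ x y → x + (1ℤ + y) - 1ℤ ≡ x + y) ∋ solve-∀) a (+ t)) (Z≤ (a + + suc t)))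

  X-mono : ∀ {a b} → a ≤ᶻ b → X a ≤ᶻ X b
  X-mono = monotone X X≤

  Y-mono : ∀ {a b} → a ≤ᶻ b → Y a ≤ᶻ Y b
  Y-mono = monotone Y Y≤

  X-strict : ∀ {a b} → p a ≡ R → a ≤ᶻ b → X (a - 1ℤ) <ᶻ X b
  X-strict {a} {b} r a≤b = +1≤⇒< (X (a - 1ℤ)) (subst (_≤ᶻ X b) (X-R r) (X-mono a≤b))

  Y-strict : ∀ {a b} → p a ≡ U → a ≤ᶻ b → Y (a - 1ℤ) <ᶻ Y b
  Y-strict {a} {b} u a≤b = +1≤⇒< (Y (a - 1ℤ)) (subst (_≤ᶻ Y b) (Y-U u) (Y-mono a≤b))

  private
    label-unique : (Z : ℤ → ℤ) (s : Step) → (∀ {a b} → p a ≡ s → a ≤ᶻ b → Z (a - 1ℤ) <ᶻ Z b) →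
                   ∀ {a b} → p a ≡ s → p b ≡ s → Z (a - 1ℤ) ≡ Z (b - 1ℤ) → a ≡ b
    label-unique Z s strict {a} {b} sa sb eq with ≤-split a b | ≤-split b a
    ... | inj₁ a≤b | inj₁ b≤a = ℤP.≤-antisym a≤b b≤a
    ... | inj₂ b<a | _        = ⊥-elim (ℤP.<-irrefl (sym eq) (strict {b} {a - 1ℤ} sb (<⇒≤-1 b<a)))
    ... | inj₁ _   | inj₂ a<b = ⊥-elim (ℤP.<-irrefl eq (strict {a} {b - 1ℤ} sa (<⇒≤-1 a<b)))

  column-unique : ∀ {a b} → p a ≡ R → p b ≡ R → X (a - 1ℤ) ≡ X (b - 1ℤ) → a ≡ b
  column-unique = label-unique X R X-strict

  row-unique : ∀ {a b} → p a ≡ U → p b ≡ U → Y (a - 1ℤ) ≡ Y (b - 1ℤ) → a ≡ b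
  row-unique = label-unique Y U Y-strict

  -- The box in the column of the R-step a and the row of the U-step b.
  Box : ℤ → ℤ → Point
  Box a b = X (a - 1ℤ) , Y (b - 1ℤ)

  Box-injective : ∀ {a b a′ b′} → p a ≡ R → p b ≡ U → p a′ ≡ R → p b′ ≡ U →
                  Box a b ≡ Box a′ b′ → a ≡ a′ × b ≡ b′
  Box-injective ra ub ra′ ub′ eq = column-unique ra ra′ (cong proj₁ eq) , row-unique ub ub′ (cong proj₂ eq)

  -- The edge of column `a` on top of row `b`, and the edge of row `b` to the right of column `a`.
  -- The second label of the first and the first label of the second may be steps of the wrong kind;
  -- lowering such a label by one leaves the edge unchanged (`columnEdge-R`, `rowEdge-U`), so a
  -- strand can be followed label by label.
  columnEdge rowEdge : ℤ → ℤ → Edge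
  columnEdge a b = horizontal (X (a - 1ℤ) , Y b)
  rowEdge    a b = vertical (X a , Y (b - 1ℤ))

  module _ {a b} (a-R : p a ≡ R) (b-U : p b ≡ U) where
    top-Box : top (Box a b) ≡ columnEdge a b
    top-Box = cong horizontal (cong₂ _,_ (ℤP.+-identityʳ _) (sym (Y-U b-U)))

    right-Box : right (Box a b) ≡ rowEdge a b
    right-Box = cong vertical (cong₂ _,_ (sym (X-R a-R)) (ℤP.+-identityʳ _))

    boxEntered-columnEdge : boxEntered (columnEdge a b) ≡ Box a b
    boxEntered-columnEdge = trans (cong boxEntered (sym top-Box)) (boxEntered-top (Box a b))

  columnEdge-R : ∀ a {b} → p b ≡ R → columnEdge a b ≡ columnEdge a (b - 1ℤ)
  columnEdge-R a r = cong (λ y → horizontal (X (a - 1ℤ) , y)) (Y-R r)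

  rowEdge-U : ∀ b {a} → p a ≡ U → rowEdge a b ≡ rowEdge (a - 1ℤ) b
  rowEdge-U b u = cong (λ x → vertical (x , Y (b - 1ℤ))) (X-U u)

  module _ (T : Filling) where
    open Tiles T

    private
      N-horizontal : ∀ {a} → p a ≡ R → IsHorizontal (N a)
      N-horizontal {a} r rewrite r = _ , refl

      N-vertical : ∀ {a} → p a ≡ U → IsVertical (N a)
      N-vertical {a} u rewrite u = _ , refl

      midX-N : ∀ a → midX (N a) ≡ X (a - 1ℤ) + X a
      midX-N a with p a in eq
      ... | R = trans (((∀ x → x + 0ℤ + (x + 0ℤ) + 1ℤ ≡ x + (x + 1ℤ)) ∋ solve-∀) (X (a - 1ℤ)))
                      (cong (_+_ (X (a - 1ℤ))) (sym (X-R eq)))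
      ... | U = trans (((∀ x → x + 0ℤ + (x + 0ℤ) ≡ x + x) ∋ solve-∀) (X (a - 1ℤ)))
                      (cong (_+_ (X (a - 1ℤ))) (sym (X-U eq)))

      midY-N : ∀ a → midY (N a) ≡ Y (a - 1ℤ) + Y a + (+ k + + k)
      midY-N a with p a in eq
      ... | R = trans (((∀ y k → y + k + (y + k) ≡ y + y + (k + k)) ∋ solve-∀) (Y (a - 1ℤ)) (+ k))
                      (cong (λ w → Y (a - 1ℤ) + w + (+ k + + k)) (sym (Y-R eq)))
      ... | U = trans (((∀ y k → y + k + (y + k) + 1ℤ ≡ y + (y + 1ℤ) + (k + k)) ∋ solve-∀) (Y (a - 1ℤ))
          (+ k))
                      (cong (λ w → Y (a - 1ℤ) + w + (+ k + + k)) (sym (Y-U eq)))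

      -1-mono : ∀ {a b} → a ≤ᶻ b → a - 1ℤ ≤ᶻ b - 1ℤ
      -1-mono = ℤP.+-monoˡ-≤ (- 1ℤ)

      midX-N-mono : ∀ {a b} → a ≤ᶻ b → midX (N a) ≤ᶻ midX (N b)
      midX-N-mono {a} {b} a≤b = subst₂ _≤ᶻ_ (sym (midX-N a)) (sym (midX-N b))
        (X-mono (-1-mono a≤b) ⊹ X-mono a≤b)

      midY-N-mono : ∀ {a b} → a ≤ᶻ b → midY (N a) ≤ᶻ midY (N b)
      midY-N-mono {a} {b} a≤b = subst₂ _≤ᶻ_ (sym (midY-N a)) (sym (midY-N b))
        (Y-mono (-1-mono a≤b) ⊹ Y-mono a≤b ⊹ ℤP.≤-refl {+ k + + k})

      midX-N-strict : ∀ {a b} → p b ≡ R → a <ᶻ b → midX (N a) <ᶻ midX (N b)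
      midX-N-strict {a} {b} r a<b = subst₂ _<ᶻ_ (sym (midX-N a)) (sym (midX-N b))
        (lin< (X-mono (-1-mono (ℤP.<⇒≤ a<b)) ⊹ X-mono (<⇒≤-1 a<b))
          (trans (cong (λ w → X (b - 1ℤ) + w - (X (a - 1ℤ) + X a + 1ℤ)) (X-R r))
            (((∀ x y z → x + (x + 1ℤ) - (y + z + 1ℤ) ≡ x + x - (y + z)) ∋ solve-∀) (X (b - 1ℤ)) (X (a - 1ℤ))
              (X a))))

      midY-N-strict : ∀ {a b} → p a ≡ U → a <ᶻ b → midY (N a) <ᶻ midY (N b)
      midY-N-strict {a} {b} u a<b = subst₂ _<ᶻ_ (sym (midY-N a)) (sym (midY-N b))
        (lin< (Y-mono (<⇒≤-1 a<b) ⊹ Y-mono (ℤP.<⇒≤ a<b))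
          (trans (cong (λ w → Y (b - 1ℤ) + Y b + (+ k + + k) - (Y (a - 1ℤ) + w + (+ k + + k) + 1ℤ)) (Y-U u))
            (trans (((∀ x y z k →
              x + y + (k + k) - (z + (z + 1ℤ) + (k + k) + 1ℤ) ≡ x + y - (z + 1ℤ + (z + 1ℤ))) ∋ solve-∀)
                (Y (b - 1ℤ)) (Y b) (Y (a - 1ℤ)) (+ k))
              (cong (λ w → Y (b - 1ℤ) + Y b - (w + w)) (sym (Y-U u))))))

    -- Strands move right and down, whereas the northern boundary moves right and up.
    north-never-returns : ∀ a b s → walk (N a) s ≡ N b → s ≡ 0
    north-never-returns a b zero eq = refl
    north-never-returns a b (suc s) eq with step-cases (p a) | ≤-split a b | ≤-split b a
    ... | inj₁ r | inj₁ a≤b | _ = ⊥-elim (ℤP.<⇒≱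
          (subst (λ e → midY e <ᶻ midY (N a)) eq (midY-walk-strict (N a) s (N-horizontal r)))
            (midY-N-mono a≤b))
    ... | inj₁ r | inj₂ b<a | _ = ⊥-elim (ℤP.<⇒≱ (midX-N-strict r b<a)
          (subst (λ e → midX (N a) ≤ᶻ midX e) eq (midX-walk (N a) (suc s))))
    ... | inj₂ u | _ | inj₁ b≤a = ⊥-elim (ℤP.<⇒≱
          (subst (λ e → midX (N a) <ᶻ midX e) eq (midX-walk-strict (N a) s (N-vertical u)))
            (midX-N-mono b≤a))
    ... | inj₂ u | _ | inj₂ a<b = ⊥-elim (ℤP.<⇒≱ (midY-N-strict u a<b)
          (subst (λ e → midY e ≤ᶻ midY (N a)) eq (midY-walk (N a) (suc s))))

    private
      N-distinct : ∀ {a b} → a <ᶻ b → N a ≡ N b → ⊥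
      N-distinct {a} {b} a<b eq with step-cases (p b) | step-cases (p a)
      ... | inj₁ r | _      = ℤP.<-irrefl (cong midX eq) (midX-N-strict r a<b)
      ... | inj₂ _ | inj₂ u = ℤP.<-irrefl (cong midY eq) (midY-N-strict u a<b)
      ... | inj₂ u | inj₁ r with N-horizontal r | N-vertical u
      ... | _ , e | _ , e′ with trans (sym e) (trans eq e′)
      ... | ()

      N-injective : ∀ {a b} → N a ≡ N b → a ≡ b
      N-injective {a} {b} eq with ≤-split a b | ≤-split b a
      ... | inj₁ a≤b | inj₁ b≤a = ℤP.≤-antisym a≤b b≤a
      ... | inj₂ b<a | _        = ⊥-elim (N-distinct b<a (sym eq))
      ... | inj₁ _   | inj₂ a<b = ⊥-elim (N-distinct a<b eq)

    -- Both walks are traced back until the shorter one stands on its northern edge. What remains of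
    -- the longer one joins two northern edges, so it has length 0.
    walk-unique : ∀ i s j t → walk (N i) s ≡ walk (N j) t → i ≡ j × s ≡ t
    walk-unique i s j t eq with ℕP.≤-total s t
    ... | inj₁ s≤t with ℕP.m≤n⇒∃[o]m+o≡n s≤t
    ... | u , refl with sym (walk-cancel (N i) (N j) s u eq)
    ... | eq′ with north-never-returns j i u eq′
    ... | refl = sym (N-injective eq′) , sym (ℕP.+-identityʳ s)
    walk-unique i s j t eq | inj₂ t≤s with ℕP.m≤n⇒∃[o]m+o≡n t≤s
    ... | u , refl with sym (walk-cancel (N j) (N i) t u (sym eq))
    ... | eq′ with north-never-returns i j u eq′
    ... | refl = N-injective eq′ , ℕP.+-identityʳ t

_≟ˢ_ : (s t : Step) → Dec (s ≡ t)
R ≟ˢ R = yes refl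
R ≟ˢ U = no λ ()
U ≟ˢ R = no λ ()
U ≟ˢ U = yes refl

R≢U : ∀ {s} → s ≡ R → s ≡ U → ⊥
R≢U refl ()

-- Boxes of the strip named by labels

module StripLabels {n k : ℕ} (Γ : PeriodicPath n k) where
  open PeriodicPath Γ
  open Geometry Γ

  InStrip : Point → Set
  InStrip b = ∃[ i ] ∃[ h ] p i ≡ R × h ℕ.< k × b ≡ (X (i - 1ℤ) , Y (i - 1ℤ)) ⊕ (0ℤ , + h)

  private
    -- A discrete intermediate value argument: `Y` rises by at most one per step, so the step at
    -- which it passes `y` is a U-step that starts at height `y`.
    row-search : ∀ a y t → Y (a - 1ℤ) ≤ᶻ y → y <ᶻ Y (a - 1ℤ + + t) →
                 ∃[ l ] a ≤ᶻ l × l ≤ᶻ a - 1ℤ + + t × p l ≡ U × Y (l - 1ℤ) ≡ y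
    row-search a y zero lo hi = ⊥-elim (ℤP.<⇒≱ (subst (λ w → y <ᶻ Y w) (ℤP.+-identityʳ (a - 1ℤ)) hi) lo)
    row-search a y (suc t) lo hi with ≤-split (Y (a - 1ℤ + + t)) y
    ... | inj₂ y< with row-search a y t lo y<
    ... | l , a≤l , l≤ , rest = l , a≤l , ℤP.≤-trans l≤ (ℤP.+-monoʳ-≤ (a - 1ℤ) (+≤+ (ℕP.n≤1+n t))) , rest
    row-search a y (suc t) lo hi | inj₁ ≤y with step-cases (p l)
      where l = a - 1ℤ + + suc t
    ... | inj₁ r = ⊥-elim
        (ℤP.<⇒≱ hi (subst (_≤ᶻ y) (sym (trans (Y-R r) (cong Y (previous-label a (+ t))))) ≤y))
      where
      previous-label : ∀ a t → a - 1ℤ + (1ℤ + t) - 1ℤ ≡ a - 1ℤ + t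
      previous-label = solve-∀
    ... | inj₂ u = a - 1ℤ + + suc t , lin (+≤+ {0} {t} ℕ.z≤n)
        (((∀ a t → a - 1ℤ + (1ℤ + t) - a ≡ t - 0ℤ) ∋ solve-∀) a (+ t)) ,
      ℤP.≤-refl , u , ℤP.≤-antisym (subst (_≤ᶻ y) (cong Y (sym (previous-label a (+ t)))) ≤y)
        (subst (y ≤ᶻ_) (ℤP.+-identityʳ _)
          (lin (<⇒+1≤ hi) (trans (((∀ u y → u + 0ℤ - y ≡ u + 1ℤ - (y + 1ℤ)) ∋ solve-∀) (Y (l - 1ℤ)) y)
           (cong (_- (y + 1ℤ)) (sym (Y-U u))))))
      where
      l = a - 1ℤ + + suc t
      previous-label : ∀ a t → a - 1ℤ + (1ℤ + t) - 1ℤ ≡ a - 1ℤ + t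
      previous-label = solve-∀

  private
    Y-over-period : ∀ a → Y (a - 1ℤ + + n) ≡ Y (a - 1ℤ) + + k
    Y-over-period a = Y-periodic (a - 1ℤ)

  -- Over one period `Y` gains `k`, so the row at height `h < k` above step `a` belongs to one of
  -- the next labels within the period; it is not `a` itself, which is an R-step.
  strip-labels : ∀ {b} → InStrip b → ∃[ a ] ∃[ c ] p a ≡ R × p c ≡ U × a <ᶻ c × c <ᶻ a + + n × b ≡ Box a c
  strip-labels {b} (a , h , r , h<k , refl)
    with row-search a (Y (a - 1ℤ) + + h) n (ℤP.i≤i+j (Y (a - 1ℤ)) (+ h))
           (subst (Y (a - 1ℤ) + + h <ᶻ_) (sym (Y-over-period a)) (ℤP.+-monoʳ-< (Y (a - 1ℤ)) (+<+ h<k)))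
  ... | l , a≤l , l≤ , u , eq = a , l , r , u , ℤP.≤∧≢⇒< a≤l (λ { refl → R≢U r u }) ,
        lin< l≤ (((∀ a n l → a + n - (l + 1ℤ) ≡ a - 1ℤ + n - l) ∋ solve-∀) a (+ n) l) ,
        cong₂ _,_ (ℤP.+-identityʳ _) (sym eq)

  labels-strip : ∀ {a c} → p a ≡ R → p c ≡ U → a <ᶻ c → c <ᶻ a + + n → InStrip (Box a c)
  labels-strip {a} {c} r u a<c c<a+n with ≤⇒distance (Y-mono (ℤP.+-monoˡ-≤ (- 1ℤ) (ℤP.<⇒≤ a<c)))
  ... | h , eq = a , h , r , h<k , cong₂ _,_ (sym (ℤP.+-identityʳ _)) eq
    where
    c≤ : c ≤ᶻ a - 1ℤ + + n
    c≤ = lin (<⇒+1≤ c<a+n) (((∀ a n l → a - 1ℤ + n - l ≡ a + n - (l + 1ℤ)) ∋ solve-∀) a (+ n) c)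
    h<k : h ℕ.< k
    h<k = ℤP.drop‿+<+ (lin< (<⇒+1≤ (subst₂ _<ᶻ_ eq (Y-over-period a) (Y-strict u c≤)))
            (((∀ y h k → k - (h + 1ℤ) ≡ y + k - (y + h + 1ℤ)) ∋ solve-∀) (Y (a - 1ℤ)) (+ h) (+ k)))

  p-shift : ∀ q l → p (l + q * + n) ≡ p l
  p-shift q l = shift-all (λ i → p i ≡ p l) (+ n) (λ i → trans (p-periodic i))
    (λ i → trans (sym (p-periodic i))) q l refl

  Box-+n : ∀ a b → Box (a + + n) (b + + n) ≡ Box a b ⊕ (+ n - + k , + k)
  Box-+n a b = cong₂ _,_
    (trans (cong X (((∀ a w → a + w - 1ℤ ≡ a - 1ℤ + w) ∋ solve-∀) a (+ n))) (X-periodic (a - 1ℤ)))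
    (trans (cong Y (((∀ a w → a + w - 1ℤ ≡ a - 1ℤ + w) ∋ solve-∀) b (+ n))) (Y-periodic (b - 1ℤ)))

  module _ .{{_ : NonZero n}} where

    private
      -- The unbounded search reduces to a finite one: a shift by the period changes `Z` by `c`, so
      -- one label per residue is tested, up to divisibility by `c`. This covers `c = 0`, where
      -- divisibility means equality.
      label? : (Z : ℤ → ℤ) (c : ℤ) → (∀ l → Z (l + + n) ≡ Z l + c) → (s : Step) → ∀ z →
               Dec (∃[ l ] p l ≡ s × Z (l - 1ℤ) ≡ z)
      label? Z c Z-per s z = map′ found search
        (FinP.any? λ ρ → (p (rep ρ) ≟ˢ s) ×-dec (c ℤD.∣? (z - Z (rep ρ - 1ℤ))))
        where
        Z-shift : ∀ q l → Z (l + q * + n - 1ℤ) ≡ Z (l - 1ℤ) + q * c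
        Z-shift q l = trans (cong Z (((∀ a w → a + w - 1ℤ ≡ a - 1ℤ + w) ∋ solve-∀) l (q * + n)))
          (shift-map Z (+ n) c Z-per q (l - 1ℤ))
        found : (∃[ ρ ] p (rep {n} ρ) ≡ s × c ℤD.∣ (z - Z (rep ρ - 1ℤ))) → ∃[ l ] p l ≡ s × Z (l - 1ℤ) ≡ z
        found (ρ , ps , ℤD.divides q eq) = rep ρ + q * + n , trans (p-shift q (rep ρ)) ps ,
          trans (Z-shift q (rep ρ))
            (trans (cong (_+_ (Z (rep ρ - 1ℤ))) (sym eq))
              (((∀ u z → u + (z - u) ≡ z) ∋ solve-∀) (Z (rep ρ - 1ℤ)) z))
        search : ∃[ l ] p l ≡ s × Z (l - 1ℤ) ≡ z → ∃[ ρ ] p (rep {n} ρ) ≡ s × c ℤD.∣ (z - Z (rep ρ - 1ℤ))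
        search (l , ps , refl) =
          res n l , trans (sym (p-shift (quot n l) (rep (res n l))))
            (trans (cong p (sym (rep-res-quot n l))) ps) ,
          ℤD.divides (quot n l)
            (trans (cong (_- Z (rep (res n l) - 1ℤ))
              (trans (cong (λ w → Z (w - 1ℤ)) (rep-res-quot n l)) (Z-shift (quot n l) (rep (res n l)))))
            (((∀ u v → u + v - u ≡ v) ∋ solve-∀) (Z (rep (res n l) - 1ℤ)) (quot n l * c)))

    column? : ∀ x → Dec (∃[ a ] p a ≡ R × X (a - 1ℤ) ≡ x)
    column? = label? X (+ n - + k) X-periodic R

    row? : ∀ y → Dec (∃[ b ] p b ≡ U × Y (b - 1ℤ) ≡ y)
    row? = label? Y (+ k) Y-periodic U

    abstract
      -- The label tiling is followed on every `Box a b`, inside the strip or not, because the field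
      -- `E≡T` of a `Realization` is not limited to the strip. Points in no column or no row get the
      -- default `crossing`.
      fill : (ℤ → ℤ → Tile) → Filling
      fill E (x , y) with column? x | row? y
      ... | yes (a , _) | yes (b , _) = E a b
      ... | yes _       | no _        = crossing
      ... | no _        | _           = crossing

      fill-Box : ∀ E {a b} → p a ≡ R → p b ≡ U → fill E (Box a b) ≡ E a b
      fill-Box E {a} {b} r u with column? (X (a - 1ℤ)) | row? (Y (b - 1ℤ))
      ... | yes (a′ , r′ , eqa) | yes (b′ , u′ , eqb) =
          cong₂ E (column-unique r′ r eqa) (row-unique u′ u eqb)
      ... | yes _       | no ¬b        = contradiction (b , u , refl) ¬b
      ... | no ¬a       | _            = contradiction (a , r , refl) ¬a

-- Strands as sequences of labels

tile-cases : (t : Tile) → t ≡ crossing ⊎ t ≡ elbow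
tile-cases crossing = inj₁ refl
tile-cases elbow    = inj₂ refl

crossing≢elbow : crossing ≢ elbow
crossing≢elbow ()

indicator : ∀ {A : Set} → Dec A → ℕ
indicator (yes _) = 1
indicator (no _)  = 0

indicator-cong : ∀ {A B : Set} (a? : Dec A) (b? : Dec B) → (A → B) → (B → A) → indicator a? ≡ indicator b?
indicator-cong (yes _) (yes _) _ _ = refl
indicator-cong (yes a) (no ¬b) f _ = contradiction (f a) ¬b
indicator-cong (no ¬a) (yes b) _ g = contradiction (g b) ¬a
indicator-cong (no _)  (no _)  _ _ = refl

indicator-no : ∀ {A : Set} (a? : Dec A) → ¬ A → indicator a? ≡ 0
indicator-no (yes a) ¬a = contradiction a ¬a
indicator-no (no _)  _  = refl

-- The newest term stands in front, in step with `Match` and with the histories `H`, whose head is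
-- the box visited last.
Σ< : ℕ → (ℕ → ℕ) → ℕ
Σ< zero    F = 0
Σ< (suc s) F = F s ℕ.+ Σ< s F

Σ<-cong : ∀ s {F G} → (∀ u → u ℕ.< s → F u ≡ G u) → Σ< s F ≡ Σ< s G
Σ<-cong zero    _  = refl
Σ<-cong (suc s) eq = cong₂ ℕ._+_ (eq s ℕP.≤-refl) (Σ<-cong s (λ u u<s → eq u (ℕP.m<n⇒m<1+n u<s)))

module _ {A : Set} where
  Σ∈ : List A → (A → ℕ) → ℕ
  Σ∈ []       F = 0
  Σ∈ (x ∷ xs) F = F x ℕ.+ Σ∈ xs F

-- A box is a pair of labels a < b with an R-step a (its column) and a U-step b (its
-- row).  All boxes with b - a = d lie on one antidiagonal, so the wires meet in pairs
-- there; d decreases from m, at the northern boundary, to 0, at the southern one.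
module Labels (m : ℕ) (p : ℤ → Step) (E : ℤ → ℤ → Tile) where

  Elbow : ℤ → ℤ → Set
  Elbow a b = p a ≡ R × p b ≡ U × E a b ≡ elbow

  elbow? : ∀ a b → Dec (Elbow a b)
  elbow? a b = (p a ≟ˢ R) ×-dec ((p b ≟ˢ U) ×-dec (E a b ≟ₜ elbow))

  -- Only one of `(z , z + d)` and `(z - d , z)` can be a box, according to whether `z` is a column
  -- or a row. Hence the three cases exclude each other.
  data Turn (d z : ℤ) : ℤ → Set where
    stay  : ¬ Elbow z (z + d) → ¬ Elbow (z - d) z → Turn d z z
    forth : Elbow z (z + d) → Turn d z (z + d)
    back  : Elbow (z - d) z → Turn d z (z - d)

  turn : ∀ d z → ∃ (Turn d z)
  turn d z with elbow? z (z + d) | elbow? (z - d) z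
  ... | yes e | _     = z + d , forth e
  ... | no _  | yes e = z - d , back e
  ... | no ¬e | no ¬e′ = z , stay ¬e ¬e′

  Turn-functional : ∀ {d z y y′} → Turn d z y → Turn d z y′ → y ≡ y′
  Turn-functional (stay _ _)   (stay _ _)   = refl
  Turn-functional (stay ¬e _)  (forth e)    = contradiction e ¬e
  Turn-functional (stay _ ¬e)  (back e)     = contradiction e ¬e
  Turn-functional (forth e)    (stay ¬e _)  = contradiction e ¬e
  Turn-functional (forth _)    (forth _)    = refl
  Turn-functional (forth e)    (back e′)    = ⊥-elim (R≢U (proj₁ e) (proj₁ (proj₂ e′)))
  Turn-functional (back e)     (stay _ ¬e)  = contradiction e ¬e
  Turn-functional (back e)     (forth e′)   = ⊥-elim (R≢U (proj₁ e′) (proj₁ (proj₂ e)))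
  Turn-functional (back _)     (back _)     = refl

  Turn-symmetric : ∀ {d z y} → Turn d z y → Turn d y z
  Turn-symmetric t@(stay _ _) = t
  Turn-symmetric {d} {z} (forth e) =
    subst (Turn d (z + d)) (z+d-d z d) (back (subst (λ w → Elbow w (z + d)) (sym (z+d-d z d)) e))
  Turn-symmetric {d} {z} (back e)  =
    subst (Turn d (z - d)) (z-d+d z d) (forth (subst (Elbow (z - d)) (sym (z-d+d z d)) e))

  τ : ℤ → ℤ → ℤ
  τ d z = proj₁ (turn d z)

  τ≡ : ∀ {d z y} → Turn d z y → τ d z ≡ y
  τ≡ {d} {z} t = Turn-functional (proj₂ (turn d z)) t

  τ-involutive : ∀ d z → τ d (τ d z) ≡ z
  τ-involutive d z = τ≡ (Turn-symmetric (proj₂ (turn d z)))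

  δ : ℕ → ℤ
  δ e = + m - + e

  -- A column begins at the northern edge with its own label. A row begins one period earlier: the
  -- northern boundary is the path raised by as much as it climbs in a period, so the edge at the
  -- height of U-step `z` has label `z - m`.
  start : Step → ℤ → ℤ
  start R z = z
  start U z = z - + m

  -- D e z is the northern label of the strand that is on wire z just before the
  -- antidiagonal δ e, and H e z lists the boxes that this strand has visited.
  D : ℕ → ℤ → ℤ
  D zero    z = start (p z) z
  D (suc e) z = D e (τ (δ e) z)

  -- The three steps are those of `z`, `z + d` and `z - d`. The box is recorded whatever its tile;
  -- `LabelCross` later selects the crossings.
  meet : Step → Step → Step → ℤ → ℤ → List (ℤ × ℤ)
  meet R U _ d z = (z , z + d) ∷ []
  meet R R _ d z = []
  meet U _ R d z = (z - d , z) ∷ []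
  meet U _ U d z = []

  H : ℕ → ℤ → List (ℤ × ℤ)
  H zero    z = []
  H (suc e) z = meet (p z) (p (z + δ e)) (p (z - δ e)) (δ e) z ++ H e (τ (δ e) z)

  H-suc : ∀ e {z s s₊ s₋ y} → p z ≡ s → p (z + δ e) ≡ s₊ → p (z - δ e) ≡ s₋ → τ (δ e) z ≡ y →
          H (suc e) z ≡ meet s s₊ s₋ (δ e) z ++ H e y
  H-suc e {z} refl refl refl eq = cong (λ y → meet (p z) (p (z + δ e)) (p (z - δ e)) (δ e) z ++ H e y) eq

  H-suc-R : ∀ e {z s₊ y} → p z ≡ R → p (z + δ e) ≡ s₊ → τ (δ e) z ≡ y →
    H (suc e) z ≡ meet R s₊ R (δ e) z ++ H e y
  H-suc-R e {s₊ = R} r r₊ eq = H-suc e r r₊ refl eq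
  H-suc-R e {s₊ = U} r u₊ eq = H-suc e r u₊ refl eq

  H-suc-U : ∀ e {z s₋ y} → p z ≡ U → p (z - δ e) ≡ s₋ → τ (δ e) z ≡ y →
    H (suc e) z ≡ meet U R s₋ (δ e) z ++ H e y
  H-suc-U e {s₋ = R} u r₋ eq = H-suc e u refl r₋ eq
  H-suc-U e {s₋ = U} u u₋ eq = H-suc e u refl u₋ eq

  module _ (p-periodic : ∀ l → p (l + + m) ≡ p l)
           (E-periodic : ∀ {a b} → p a ≡ R → p b ≡ U → a <ᶻ b → b <ᶻ a + + m →
             E (a + + m) (b + + m) ≡ E a b) where

    elbow-range : ∀ {e z} → e ℕ.< m → p z ≡ R → p (z + δ e) ≡ U → z <ᶻ z + δ e × z + δ e <ᶻ z + + m
    -- On the antidiagonal `δ 0 = m` the two labels differ by a period and are steps of the same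
    -- kind, so there is no box.
    elbow-range {zero} {z} _ r u =
      ⊥-elim (R≢U r (trans (sym (p-periodic z))
        (trans (cong (λ w → p (z + w)) (sym (ℤP.+-identityʳ (+ m)))) u)))
    elbow-range {suc e} {z} e<m r u =
      lin< (+≤+ e<m) (((∀ z m e → z + (m - e) - (z + 1ℤ) ≡ m - (1ℤ + e)) ∋ solve-∀) z (+ m) (+ suc e)) ,
      lin< (+≤+ {0} {e} ℕ.z≤n)
        (((∀ z m e → z + m - (z + (m - (1ℤ + e)) + 1ℤ) ≡ e - 0ℤ) ∋ solve-∀) z (+ m) (+ e))

    private
      swap : ∀ z d n → z + n + d ≡ z + d + n
      swap = solve-∀

      elbow-shift : ∀ {a b} → a <ᶻ b → b <ᶻ a + + m →
        (Elbow a b → Elbow (a + + m) (b + + m)) ×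
          (p a ≡ R → p b ≡ U → Elbow (a + + m) (b + + m) → Elbow a b)
      elbow-shift {a} {b} a<b b<a+m =
        (λ { (r , u , e) → trans (p-periodic a) r , trans (p-periodic b) u , trans
          (E-periodic r u a<b b<a+m) e }) ,
        (λ { r u (_ , _ , e) → r , u , trans (sym (E-periodic r u a<b b<a+m)) e })

      elbow-+m : ∀ {e z} → e ℕ.< m → Elbow z (z + δ e) → Elbow (z + + m) (z + + m + δ e)
      elbow-+m {e} {z} e<m el with elbow-range {e} {z} e<m (proj₁ el) (proj₁ (proj₂ el))
      ... | lo , hi = subst (Elbow (z + + m)) (sym (swap z (δ e) (+ m))) (proj₁ (elbow-shift lo hi) el)

      elbow--m : ∀ {e z} → e ℕ.< m → Elbow (z + + m) (z + + m + δ e) → Elbow z (z + δ e)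
      elbow--m {e} {z} e<m el@(r , u , _) with trans (sym (p-periodic z)) r | trans
        (sym (p-periodic (z + δ e))) (trans (cong p (sym (swap z (δ e) (+ m)))) u)
      ... | r′ | u′ with elbow-range {e} {z} e<m r′ u′
      ... | lo , hi = proj₂ (elbow-shift lo hi) r′ u′ (subst (Elbow (z + + m)) (swap z (δ e) (+ m)) el)

      elbowˡ : ∀ e z → Elbow (z - δ e) z → Elbow (z - δ e) (z - δ e + δ e)
      elbowˡ e z = subst (Elbow (z - δ e)) (sym (z-d+d z (δ e)))

      elbowʳ : ∀ e z → Elbow (z - δ e) (z - δ e + δ e) → Elbow (z - δ e) z
      elbowʳ e z = subst (Elbow (z - δ e)) (z-d+d z (δ e))

    τ-periodic : ∀ {e} → e ℕ.< m → ∀ z → τ (δ e) (z + + m) ≡ τ (δ e) z + + m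
    τ-periodic {e} e<m z with turn (δ e) z
    ... | _ , forth el = trans (τ≡ (forth (elbow-+m e<m el))) (swap z (δ e) (+ m))
    ... | _ , back el  = trans (τ≡ (back (back-+m el))) (swap z (- δ e) (+ m))
      where
      back-+m : Elbow (z - δ e) z → Elbow (z + + m - δ e) (z + + m)
      back-+m el = elbowʳ e (z + + m)
        (subst (λ w → Elbow w (w + δ e)) (sym (swap z (- δ e) (+ m)))
          (elbow-+m {e} {z - δ e} e<m (elbowˡ e z el)))
    ... | _ , stay ¬r ¬l = τ≡ (stay (¬r ∘ elbow--m e<m) (¬l ∘ back--m))
      where
      back--m : Elbow (z + + m - δ e) (z + + m) → Elbow (z - δ e) z
      back--m el = elbowʳ e z
        (elbow--m {e} {z - δ e} e<m
          (subst (λ w → Elbow w (w + δ e)) (swap z (- δ e) (+ m)) (elbowˡ e (z + + m) el)))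

    D-periodic : ∀ {e} → e ℕ.≤ m → ∀ z → D e (z + + m) ≡ D e z + + m
    D-periodic {zero} _ z rewrite p-periodic z with p z
    ... | R = refl
    ... | U = swap z (- (+ m)) (+ m)
    D-periodic {suc e} e<m z = trans (cong (D e) (τ-periodic e<m z)) (D-periodic (ℕP.<⇒≤ e<m) (τ (δ e) z))

  -- Distinct wires carry distinct strands. At the start, a column and a row with the same northern
  -- label would be steps of different kinds a period apart; afterwards `τ`, being an involution,
  -- preserves injectivity.
  D-injective : ∀ e {y z} → (∀ l → p (l - + m) ≡ p l) → D e y ≡ D e z → y ≡ z
  D-injective zero {y} {z} p-per eq with p y in eqy | p z in eqz
  ... | R | R = eq
  ... | U | U = trans (sym (z-d+d y (+ m))) (trans (cong (_+ + m) eq) (z-d+d z (+ m)))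
  ... | R | U = ⊥-elim (R≢U (trans (trans (sym (p-per z)) (cong p (sym eq))) eqy) eqz)
  ... | U | R = ⊥-elim (R≢U (trans (trans (sym (p-per y)) (cong p eq)) eqz) eqy)
  D-injective (suc e) {y} {z} p-per eq =
    trans (sym (τ-involutive (δ e) y))
      (trans (cong (τ (δ e)) (D-injective e p-per eq)) (τ-involutive (δ e) z))

  LabelCross : ℤ × ℤ → ℤ × ℤ → Set
  LabelCross x y = x ≡ y × E (proj₁ x) (proj₂ x) ≡ crossing

  labelCross? : ∀ x y → Dec (LabelCross x y)
  labelCross? x y = (x ≟ₚ y) ×-dec (E (proj₁ x) (proj₂ x) ≟ₜ crossing)

  labelCrossings : List (ℤ × ℤ) → List (ℤ × ℤ) → ℕ
  labelCrossings h h′ = Σ∈ h λ x → Σ∈ h′ λ y → indicator (labelCross? x y)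

-- Strands of a tiled strip

-- The strip of Γ tiled by T, together with the columns and rows whose labels are
-- in the image of φ.  Along the latter, T looks like the label tiling E.
record Realization {n k} (Γ : PeriodicPath n k) (T : Filling) (m : ℕ) (q : ℤ → Step) (E : ℤ → ℤ → Tile) :
  Set where
  open PeriodicPath Γ
  open Geometry Γ
  field
    φ            : ℤ → ℤ
    φ-increasing : ∀ {a b} → a <ᶻ b → φ a <ᶻ φ b
    φ-periodic   : ∀ z → φ (z + + m) ≡ φ z + + n
    q≡p          : ∀ z → q z ≡ p (φ z)
    E≡T          : ∀ {a b} → q a ≡ R → q b ≡ U → E a b ≡ T (Box (φ a) (φ b))

  In : ℤ → Set
  In x = ∃[ z ] φ z ≡ x

  field
    -- No elbow of the strip joins a wire of the realization to a foreign one, so strands on its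
    -- wires stay on them and cross the foreign ones straight.
    elbow-In : ∀ {a b} → p a ≡ R → p b ≡ U → a <ᶻ b → b <ᶻ a + + n → T (Box a b) ≡ elbow →
      (In a → In b) × (In b → In a)

module StrandCrossings {n k : ℕ} (Γ : PeriodicPath n k) (T : Filling) where
  open PeriodicPath Γ
  open Tiles T

  Cross : Point → Point → Set
  Cross b b′ = b ≡ b′ × T b ≡ crossing

  cross? : ∀ b b′ → Dec (Cross b b′)
  cross? b b′ = (b ≟ₚ b′) ×-dec (T b ≟ₜ crossing)

  crossings : ℤ → ℕ → ℤ → ℕ → ℕ
  crossings i s j t = Σ< s λ u → Σ< t λ v →
    indicator (cross? (boxEntered (walk (N i) u)) (boxEntered (walk (N j) v)))

module Realized {n k} {Γ : PeriodicPath n k} {T m q E} (ρ : Realization Γ T m q E) where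
  open PeriodicPath Γ
  open Geometry Γ
  open Realization ρ
  open Labels m q E
  open Tiles T
  open StrandCrossings Γ T

  open Increasing φ-increasing public

  gap : ∀ {w l} → φ w <ᶻ l → l <ᶻ φ (w + 1ℤ) → ¬ In l
  gap {w} lo hi (v , refl) = ℤP.<⇒≱ (φ-cancel-< lo)
    (lin (<⇒+1≤ (φ-cancel-< hi)) (((∀ w v → w - v ≡ w + 1ℤ - (v + 1ℤ)) ∋ solve-∀) w v))

  q-periodic : ∀ z → q (z + + m) ≡ q z
  q-periodic z = trans (q≡p (z + + m))
    (trans (cong p (φ-periodic z)) (trans (p-periodic (φ z)) (sym (q≡p z))))

  private
    crossing-outside : ∀ {a b} → p a ≡ R → p b ≡ U → a <ᶻ b → b <ᶻ a + + n →
      ¬ ((In a → In b) × (In b → In a)) → T (Box a b) ≡ crossing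
    crossing-outside {a} {b} r u a<b b<a+n ¬same with T (Box a b) in eq
    ... | crossing = refl
    ... | elbow    = contradiction (elbow-In r u a<b b<a+n eq) ¬same

  -- The edge enters a box only one of whose two wires belongs to the realization.
  Skipped : Edge → Set
  Skipped e = ∃[ a ] ∃[ b ] p a ≡ R × p b ≡ U ×
    ((In a × ¬ In b × e ≡ columnEdge a b) ⊎ (¬ In a × In b × e ≡ rowEdge (a - 1ℤ) b))

  -- h lists the label boxes among the first s boxes of the strand i.
  data Match (i : ℤ) : List (ℤ × ℤ) → ℕ → Set where
    enter : Match i [] 0
    hit   : ∀ {h s a b} → Match i h s → q a ≡ R → q b ≡ U →
            boxEntered (walk (N i) s) ≡ Box (φ a) (φ b) → Match i ((a , b) ∷ h) (suc s)
    skip  : ∀ {h s} → Match i h s → Skipped (walk (N i) s) → Match i h (suc s)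

  Visit : ℤ → List (ℤ × ℤ) → Edge → Set
  Visit i h e = ∃[ s ] walk (N i) s ≡ e × Match i h s

  private
    next-columnEdge : ∀ {a b} → p a ≡ R → p b ≡ U →
      (T (Box a b) ≡ crossing → next T (columnEdge a b) ≡ columnEdge a (b - 1ℤ)) ×
      (T (Box a b) ≡ elbow    → next T (columnEdge a b) ≡ rowEdge a b)
    next-columnEdge {a} {b} r u =
      (λ c → trans (cong (next T) (sym (top-Box r u))) (next-top-crossing (Box a b) c)) ,
      (λ c → trans (cong (next T) (sym (top-Box r u))) (trans (next-top-elbow (Box a b) c) (right-Box r u)))

    next-rowEdge : ∀ {a b} → p a ≡ R → p b ≡ U →
      (T (Box a b) ≡ crossing → next T (rowEdge (a - 1ℤ) b) ≡ rowEdge a b) ×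
      (T (Box a b) ≡ elbow    → next T (rowEdge (a - 1ℤ) b) ≡ columnEdge a (b - 1ℤ))
    next-rowEdge {a} {b} r u =
      (λ c → trans (next-left-crossing (Box a b) c) (right-Box r u)) ,
      next-left-elbow (Box a b)

    -- Foreign labels are passed one at a time: an R-step leaves the edge of the column where it is,
    -- and the row of a U-step is crossed, since an elbow there would contradict `elbow-In`.
    -- `skip-right` is the same along a row.
    skip-down : ∀ {i h a} → p a ≡ R → In a → ∀ t {b} → (∀ l → b <ᶻ l → l ≤ᶻ b + + t → ¬ In l) →
                a ≤ᶻ b → b + + t <ᶻ a + + n → Visit i h (columnEdge a (b + + t)) →
                  Visit i h (columnEdge a b)
    skip-down {i} {h} {a} r ia zero {b} _ _ _ v =
      subst (λ w → Visit i h (columnEdge a w)) (ℤP.+-identityʳ b) v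
    skip-down {i} {h} {a} r ia (suc t) {b} out lo hi v = skip-down r ia t
      (λ l b<l l≤ → out l b<l (ℤP.≤-trans l≤ t≤)) lo (ℤP.≤-<-trans t≤ hi)
      (subst (λ w → Visit i h (columnEdge a w)) (((∀ b t → b + (1ℤ + t) - 1ℤ ≡ b + t) ∋ solve-∀) b (+ t))
        (pass (step-cases (p c)) v))
      where
      c = b + + suc t
      t≤ : b + + t ≤ᶻ c
      t≤ = ℤP.+-monoʳ-≤ b (+≤+ (ℕP.n≤1+n t))
      b<c : b <ᶻ c
      b<c = lin< (+≤+ {0} {t} ℕ.z≤n) (((∀ b t → b + (1ℤ + t) - (b + 1ℤ) ≡ t - 0ℤ) ∋ solve-∀) b (+ t))
      ¬ic : ¬ In c
      ¬ic = out c b<c ℤP.≤-refl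
      pass : p c ≡ R ⊎ p c ≡ U → Visit i h (columnEdge a c) → Visit i h (columnEdge a (c - 1ℤ))
      pass (inj₁ cr) v = subst (Visit i h) (columnEdge-R a cr) v
      pass (inj₂ cu) (s , eq , match) = suc s ,
        trans (cong (next T) eq) (proj₁ (next-columnEdge r cu)
          (crossing-outside r cu (ℤP.≤-<-trans lo b<c) hi (λ same → ¬ic (proj₁ same ia)))) ,
        skip match (a , c , r , cu , inj₁ (ia , ¬ic , eq))

    skip-right : ∀ {i h b} → p b ≡ U → In b → ∀ t {a} → (∀ l → a <ᶻ l → l ≤ᶻ a + + t → ¬ In l) →
                 a + + t <ᶻ b → b <ᶻ a + 1ℤ + + n → Visit i h (rowEdge a b) →
                   Visit i h (rowEdge (a + + t) b)
    skip-right {i} {h} {b} u ib zero {a} _ _ _ v =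
      subst (λ w → Visit i h (rowEdge w b)) (sym (ℤP.+-identityʳ a)) v
    skip-right {i} {h} {b} u ib (suc t) {a} out hi lo v =
      subst (Visit i h) (cong (λ w → rowEdge w b) refl) (pass (step-cases (p c)))
      where
      c = a + + suc t
      before : Visit i h (rowEdge (c - 1ℤ) b)
      before = subst (λ w → Visit i h (rowEdge w b))
        (((∀ a t → a + t ≡ a + (1ℤ + t) - 1ℤ) ∋ solve-∀) a (+ t))
        (skip-right u ib t (λ l a<l l≤ → out l a<l (ℤP.≤-trans l≤ (ℤP.+-monoʳ-≤ a (+≤+ (ℕP.n≤1+n t)))))
          (ℤP.≤-<-trans (ℤP.+-monoʳ-≤ a (+≤+ (ℕP.n≤1+n t))) hi) lo v)
      a+1≤c : a + 1ℤ ≤ᶻ c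
      a+1≤c = ℤP.+-monoʳ-≤ a (+≤+ (ℕ.s≤s ℕ.z≤n))
      ¬ic : ¬ In c
      ¬ic = out c (+1≤⇒< a a+1≤c) ℤP.≤-refl
      pass : p c ≡ R ⊎ p c ≡ U → Visit i h (rowEdge c b)
      pass (inj₂ cu) = subst (Visit i h) (sym (rowEdge-U b cu)) before
      pass (inj₁ cr) with before
      ... | s , eq , match = suc s ,
        trans (cong (next T) eq) (proj₁ (next-rowEdge cr u)
          (crossing-outside cr u hi (ℤP.<-≤-trans lo (ℤP.+-monoˡ-≤ (+ n) a+1≤c))
            (λ same → ¬ic (proj₂ same ib)))) ,
        skip match (c , b , cr , u , inj₂ (¬ic , ib , eq))

    to-next-row : ∀ {i h z w} → q z ≡ R → z <ᶻ w → w ≤ᶻ z + + m →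
                  Visit i h (columnEdge (φ z) (φ w - 1ℤ)) → Visit i h (columnEdge (φ z) (φ (w - 1ℤ)))
    to-next-row {i} {h} {z} {w} r z<w w≤ v with ≤⇒distance
      (<⇒≤-1 (φ-increasing {w - 1ℤ} {w}
        (lin< (ℤP.≤-refl {0ℤ}) (((∀ w → w - (w - 1ℤ + 1ℤ) ≡ 0ℤ - 0ℤ) ∋ solve-∀) w))))
    ... | t , eq = skip-down (trans (sym (q≡p z)) r) (z , refl) t
      (λ l lo hi → gap lo (subst (λ x → l <ᶻ φ x) (((∀ w → w ≡ w - 1ℤ + 1ℤ) ∋ solve-∀) w)
        (lin< (subst (l ≤ᶻ_) (sym eq) hi) (((∀ l x → x - (l + 1ℤ) ≡ x - 1ℤ - l) ∋ solve-∀) l (φ w)))))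
      (φ-mono (<⇒≤-1 z<w))
      (subst (_<ᶻ φ z + + n) eq (lin< (subst (φ w ≤ᶻ_) (φ-periodic z) (φ-mono w≤))
        (((∀ x y → y - (x - 1ℤ + 1ℤ) ≡ y - x) ∋ solve-∀) (φ w) (φ z + + n))))
      (subst (λ x → Visit i h (columnEdge (φ z) x)) eq v)

    to-next-column : ∀ {i h z w} → q z ≡ U → w <ᶻ z → z ≤ᶻ w + + m →
                     Visit i h (rowEdge (φ w) (φ z)) → Visit i h (rowEdge (φ (w + 1ℤ) - 1ℤ) (φ z))
    to-next-column {i} {h} {z} {w} u w<z z≤ v with ≤⇒distance
      (<⇒≤-1 (φ-increasing {w} {w + 1ℤ}
        (lin< (ℤP.≤-refl {0ℤ}) (((∀ w → w + 1ℤ - (w + 1ℤ) ≡ 0ℤ - 0ℤ) ∋ solve-∀) w))))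
    ... | t , eq = subst (λ x → Visit i h (rowEdge x (φ z))) (sym eq)
        (skip-right (trans (sym (q≡p z)) u) (z , refl) t
      (λ l lo hi → gap lo (lin< (subst (l ≤ᶻ_) (sym eq) hi)
        (((∀ l x → x - (l + 1ℤ) ≡ x - 1ℤ - l) ∋ solve-∀) l (φ (w + 1ℤ)))))
      (subst (_<ᶻ φ z) eq (lin< (φ-mono {w + 1ℤ} {z} (<⇒+1≤ w<z))
        (((∀ x y → y - (x - 1ℤ + 1ℤ) ≡ y - x) ∋ solve-∀) (φ (w + 1ℤ)) (φ z))))
      (lin< (subst (φ z ≤ᶻ_) (φ-periodic w) (φ-mono z≤))
        (((∀ x y n → y + 1ℤ + n - (x + 1ℤ) ≡ y + n - x) ∋ solve-∀) (φ z) (φ w) (+ n))) v)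

    1≤δ : ∀ {e} → e ℕ.< m → 1ℤ ≤ᶻ δ e
    1≤δ {e} e<m = lin (+≤+ e<m) (((∀ m e → m - e - 1ℤ ≡ m - (1ℤ + e)) ∋ solve-∀) (+ m) (+ e))

    δ≤m : ∀ e → δ e ≤ᶻ + m
    δ≤m e = lin (+≤+ {0} {e} ℕ.z≤n) (((∀ m e → m - (m - e) ≡ e - 0ℤ) ∋ solve-∀) (+ m) (+ e))

    z+d-1 : ∀ z e → z + δ e - 1ℤ ≡ z + δ (suc e)
    z+d-1 z e = ((∀ z m e → z + (m - e) - 1ℤ ≡ z + (m - (1ℤ + e))) ∋ solve-∀) z (+ m) (+ e)

    z-d+1 : ∀ z e → z - δ e + 1ℤ ≡ z - δ (suc e)
    z-d+1 z e = ((∀ z m e → z - (m - e) + 1ℤ ≡ z - (m - (1ℤ + e))) ∋ solve-∀) z (+ m) (+ e)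

  -- The invariant of the sweep over antidiagonals: the strand found by tracing wire `z` back does
  -- arrive on that wire, just before the antidiagonal `δ e`, and its boxes match `H e z`. The two
  -- recursions are mutual because an elbow carries a strand from a row to a column or back.
  reachᴿ : ∀ e → e ℕ.≤ m → ∀ {z} → q z ≡ R → Visit (φ (D e z)) (H e z) (columnEdge (φ z) (φ (z + δ e)))
  reachᵁ : ∀ e → e ℕ.≤ m → ∀ {z} → q z ≡ U → Visit (φ (D e z)) (H e z) (rowEdge (φ (z - δ e) - 1ℤ) (φ z))

  reachᴿ zero _ {z} r rewrite r = 0 , edge , enter
    where
    pr = trans (sym (q≡p z)) r
    -- `φ (z + m) = φ z + n` is one period further, where `Y` has gained exactly the height `k` of
    -- the northern boundary.
    edge : N (φ z) ≡ columnEdge (φ z) (φ (z + δ 0))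
    edge = trans (cong (λ s → edgeFrom s ((X (φ z - 1ℤ) , Y (φ z - 1ℤ)) ⊕ (0ℤ , + k))) pr)
      (cong horizontal (cong₂ _,_ (ℤP.+-identityʳ _)
        (trans (cong (_+ + k) (sym (Y-R pr))) (trans (sym (Y-periodic (φ z)))
          (cong Y (trans (sym (φ-periodic z)) (cong (λ w → φ (z + w)) (sym (ℤP.+-identityʳ (+ m))))))))))
  reachᴿ (suc e) e<m {z} r =
    subst (λ w → Visit (φ (D (suc e) z)) (H (suc e) z) (columnEdge (φ z) (φ w))) (z+d-1 z e)
    (to-next-row r
      (lin< (1≤δ e<m) (((∀ z d → z + d - (z + 1ℤ) ≡ d - 1ℤ) ∋ solve-∀) z (δ e)))
      (ℤP.+-monoʳ-≤ z (δ≤m e)) turned)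
    where
    pr = trans (sym (q≡p z)) r
    not-left : ¬ Elbow (z - δ e) z
    not-left (_ , u , _) = R≢U r u
    turn-to : ∀ {s₊ y} → q (z + δ e) ≡ s₊ → τ (δ e) z ≡ y →
              Visit (φ (D e y)) (meet R s₊ R (δ e) z ++ H e y) (columnEdge (φ z) (φ (z + δ e) - 1ℤ)) →
              Visit (φ (D (suc e) z)) (H (suc e) z) (columnEdge (φ z) (φ (z + δ e) - 1ℤ))
    turn-to r₊ eq = subst₂ (λ d h → Visit (φ d) h (columnEdge (φ z) (φ (z + δ e) - 1ℤ)))
      (sym (cong (D e) eq)) (sym (H-suc-R e r r₊ eq))
    turned : Visit (φ (D (suc e) z)) (H (suc e) z) (columnEdge (φ z) (φ (z + δ e) - 1ℤ))
    turned with step-cases (q (z + δ e))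
    ... | inj₁ r₊ = turn-to r₊ (τ≡ (stay (λ el → R≢U r₊ (proj₁ (proj₂ el))) not-left))
      (subst (Visit _ _) (columnEdge-R (φ z) (trans (sym (q≡p (z + δ e))) r₊)) (reachᴿ e (ℕP.<⇒≤ e<m) r))
    ... | inj₂ u₊ with tile-cases (E z (z + δ e))
    ... | inj₁ eq with reachᴿ e (ℕP.<⇒≤ e<m) r
    ... | s , at , match =
        turn-to u₊ (τ≡ (stay (λ el → crossing≢elbow (trans (sym eq) (proj₂ (proj₂ el)))) not-left))
      (suc s , trans (cong (next T) at) (proj₁ (next-columnEdge pr pu) (trans (sym (E≡T r u₊)) eq)) ,
       hit match r u₊ (trans (cong boxEntered at) (boxEntered-columnEdge pr pu)))
      where
      pu = trans (sym (q≡p (z + δ e))) u₊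
    -- The strand that leaves an elbow downwards came from the left, so its past is that of row
    -- `z + δ e`.
    turned | inj₂ u₊ | inj₂ eq
        with subst (λ w → Visit (φ (D e (z + δ e))) (H e (z + δ e)) (rowEdge (φ w - 1ℤ) (φ (z + δ e))))
          (z+d-d z (δ e)) (reachᵁ e (ℕP.<⇒≤ e<m) u₊)
    ... | s , at , match = turn-to u₊ (τ≡ (forth (r , u₊ , eq)))
      (suc s , trans (cong (next T) at) (proj₂ (next-rowEdge pr pu) (trans (sym (E≡T r u₊)) eq)) ,
       hit match r u₊ (cong boxEntered at))
      where
      pu = trans (sym (q≡p (z + δ e))) u₊

  reachᵁ zero _ {z} u rewrite u = 0 , edge , enter
    where
    pu = trans (sym (q≡p z)) u
    φ-m : φ (z - + m) + + n ≡ φ z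
    φ-m = trans (sym (φ-periodic (z - + m))) (cong φ (z-d+d z (+ m)))
    pu′ : p (φ (z - + m)) ≡ U
    pu′ = trans (sym (p-periodic (φ (z - + m)))) (trans (cong p φ-m) pu)
    edge : N (φ (z - + m)) ≡ rowEdge (φ (z - δ 0) - 1ℤ) (φ z)
    edge = trans (cong (λ s → edgeFrom s ((X (φ (z - + m) - 1ℤ) , Y (φ (z - + m) - 1ℤ)) ⊕ (0ℤ , + k))) pu′)
      (cong vertical (cong₂ _,_
        (trans (ℤP.+-identityʳ _) (cong (λ w → X (φ (z - w) - 1ℤ)) (sym (ℤP.+-identityʳ (+ m)))))
        (trans (sym (Y-periodic (φ (z - + m) - 1ℤ)))
          (cong Y (trans (((∀ x n → x - 1ℤ + n ≡ x + n - 1ℤ) ∋ solve-∀) (φ (z - + m)) (+ n))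
            (cong (_- 1ℤ) φ-m))))))
  reachᵁ (suc e) e<m {z} u =
    subst (λ w → Visit (φ (D (suc e) z)) (H (suc e) z) (rowEdge (φ w - 1ℤ) (φ z))) (z-d+1 z e)
    (to-next-column u
      (lin< (1≤δ e<m) (((∀ z d → z - (z - d + 1ℤ) ≡ d - 1ℤ) ∋ solve-∀) z (δ e)))
      (lin (δ≤m e) (((∀ z d m → z - d + m - z ≡ m - d) ∋ solve-∀) z (δ e) (+ m))) turned)
    where
    pu = trans (sym (q≡p z)) u
    not-right : ¬ Elbow z (z + δ e)
    not-right (r , _ , _) = R≢U r u
    turn-to : ∀ {s₋ y} → q (z - δ e) ≡ s₋ → τ (δ e) z ≡ y →
              Visit (φ (D e y)) (meet U R s₋ (δ e) z ++ H e y) (rowEdge (φ (z - δ e)) (φ z)) →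
              Visit (φ (D (suc e) z)) (H (suc e) z) (rowEdge (φ (z - δ e)) (φ z))
    turn-to r₋ eq = subst₂ (λ d h → Visit (φ d) h (rowEdge (φ (z - δ e)) (φ z)))
      (sym (cong (D e) eq)) (sym (H-suc-U e u r₋ eq))
    turned : Visit (φ (D (suc e) z)) (H (suc e) z) (rowEdge (φ (z - δ e)) (φ z))
    turned with step-cases (q (z - δ e))
    ... | inj₂ u₋ = turn-to u₋ (τ≡ (stay not-right (λ el → R≢U (proj₁ el) u₋)))
      (subst (Visit _ _) (sym (rowEdge-U (φ z) (trans (sym (q≡p (z - δ e))) u₋))) (reachᵁ e (ℕP.<⇒≤ e<m) u))
    ... | inj₁ r₋ with tile-cases (E (z - δ e) z)
    ... | inj₁ eq with reachᵁ e (ℕP.<⇒≤ e<m) u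
    ... | s , at , match =
        turn-to r₋ (τ≡ (stay not-right (λ el → crossing≢elbow (trans (sym eq) (proj₂ (proj₂ el))))))
      (suc s , trans (cong (next T) at) (proj₁ (next-rowEdge pr pu) (trans (sym (E≡T r₋ u)) eq)) ,
       hit match r₋ u (cong boxEntered at))
      where
      pr = trans (sym (q≡p (z - δ e))) r₋
    turned | inj₁ r₋ | inj₂ eq
        with subst (λ w → Visit (φ (D e (z - δ e))) (H e (z - δ e)) (columnEdge (φ (z - δ e)) (φ w)))
          (z-d+d z (δ e)) (reachᴿ e (ℕP.<⇒≤ e<m) r₋)
    ... | s , at , match = turn-to r₋ (τ≡ (back (r₋ , u , eq)))
      (suc s , trans (cong (next T) at) (proj₂ (next-columnEdge pr pu) (trans (sym (E≡T r₋ u)) eq)) ,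
       hit match r₋ u (trans (cong boxEntered at) (boxEntered-columnEdge pr pu)))
      where
      pr = trans (sym (q≡p (z - δ e))) r₋

  -- Since `δ m = 0`, the edge reached after the last antidiagonal is the one where wire `φ z` meets
  -- itself, on the southern boundary.
  reach-south : ∀ z → ∃[ s ] walk (N (φ (D m z))) s ≡ S (φ z)
  reach-south z with step-cases (q z)
  ... | inj₁ r with reachᴿ m ℕP.≤-refl r
  ... | s , at , _ = s , trans at (trans (cong horizontal (cong₂ _,_ refl
          (trans (cong (Y ∘ φ) (((∀ z m → z + (m - m) ≡ z) ∋ solve-∀) z (+ m))) (Y-R pr))))
          (cong (λ s → edgeFrom s (X (φ z - 1ℤ) , Y (φ z - 1ℤ))) (sym pr)))
    where
    pr = trans (sym (q≡p z)) r
  reach-south z | inj₂ u with reachᵁ m ℕP.≤-refl u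
  ... | s , at , _ = s , trans at
      (trans (cong (λ w → vertical (X (φ w - 1ℤ) , Y (φ z - 1ℤ)))
        (((∀ z m → z - (m - m) ≡ z) ∋ solve-∀) z (+ m)))
          (cong (λ s → edgeFrom s (X (φ z - 1ℤ) , Y (φ z - 1ℤ))) (sym (trans (sym (q≡p z)) u))))

  private
    box-hit : ∀ {a b a′ b′} → q a ≡ R → q b ≡ U → q a′ ≡ R → q b′ ≡ U →
      Box (φ a) (φ b) ≡ Box (φ a′) (φ b′) → a ≡ a′ × b ≡ b′
    box-hit {a} {b} {a′} {b′} r u r′ u′ eq with Box-injective (pφ r) (pφ u) (pφ r′) (pφ u′) eq
      where
      pφ : ∀ {z s} → q z ≡ s → p (φ z) ≡ s
      pφ {z} = trans (sym (q≡p z))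
    ... | eqa , eqb = φ-injective eqa , φ-injective eqb

    skipped-box : ∀ {e} → Skipped e →
      ∃[ a ] ∃[ b ] p a ≡ R × p b ≡ U × boxEntered e ≡ Box a b × ¬ (In a × In b)
    skipped-box (a , b , r , u , inj₁ (ia , ¬ib , refl)) =
      a , b , r , u , boxEntered-columnEdge r u , ¬ib ∘ proj₂
    skipped-box (a , b , r , u , inj₂ (¬ia , ib , refl)) = a , b , r , u , refl , ¬ia ∘ proj₁

    skipped≢hit : ∀ {e a b} → Skipped e → q a ≡ R → q b ≡ U → boxEntered e ≢ Box (φ a) (φ b)
    skipped≢hit {e} {a} {b} sk r u eq with skipped-box sk
    ... | a′ , b′ , r′ , u′ , eq′ , ¬in with Box-injective r′ u′ (trans (sym (q≡p a)) r)
        (trans (sym (q≡p b)) u) (trans (sym eq′) eq)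
    ... | refl , refl = ¬in ((a , refl) , (b , refl))

    -- Exactly one wire of a skipped box belongs to the realization, and a skipped edge lies on that
    -- wire. By `walk-unique`, two different strands of the realization cannot both skip the same
    -- box.
    skipped-unique : ∀ {e e′} → Skipped e → Skipped e′ → boxEntered e ≡ boxEntered e′ → e ≡ e′
    skipped-unique sk sk′ eq with skipped-box sk | skipped-box sk′
    skipped-unique (a , b , r , u , c) (a′ , b′ , r′ , u′ , c′) eq | _ | _
      with Box-injective r u r′ u′ (trans (sym (entered c)) (trans eq (entered′ c′)))
      where
      entered : ∀ {e} → (In a × ¬ In b × e ≡ columnEdge a b) ⊎ (¬ In a × In b × e ≡ rowEdge (a - 1ℤ) b) →
        boxEntered e ≡ Box a b
      entered (inj₁ (_ , _ , refl)) = boxEntered-columnEdge r u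
      entered (inj₂ (_ , _ , refl)) = refl
      entered′ : ∀ {e} → (In a′ × ¬ In b′ × e ≡ columnEdge a′ b′) ⊎
        (¬ In a′ × In b′ × e ≡ rowEdge (a′ - 1ℤ) b′) → boxEntered e ≡ Box a′ b′
      entered′ (inj₁ (_ , _ , refl)) = boxEntered-columnEdge r′ u′
      entered′ (inj₂ (_ , _ , refl)) = refl
    skipped-unique (a , b , r , u , inj₁ (_ , _ , refl)) (_ , _ , _ , _ , inj₁ (_ , _ , refl)) eq | _ | _
      | refl , refl = refl
    skipped-unique (a , b , r , u , inj₂ (_ , _ , refl)) (_ , _ , _ , _ , inj₂ (_ , _ , refl)) eq | _ | _
      | refl , refl = refl
    skipped-unique (a , b , r , u , inj₁ (ia , _ , refl)) (_ , _ , _ , _ , inj₂ (¬ia , _ , refl)) eq | _ | _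
      | refl , refl = contradiction ia ¬ia
    skipped-unique (a , b , r , u , inj₂ (¬ia , _ , refl)) (_ , _ , _ , _ , inj₁ (ia , _ , refl)) eq | _ | _
      | refl , refl = contradiction ia ¬ia

    module _ {i j : ℤ} (i≢j : i ≢ j) where

      B : ℤ → ℕ → Point
      B l u = boxEntered (walk (N l) u)

      row-hit : ∀ {u a b h t} → q a ≡ R → q b ≡ U → B i u ≡ Box (φ a) (φ b) → Match j h t →
                Σ< t (λ v → indicator (cross? (B i u) (B j v))) ≡ Σ∈ h
                  (λ y → indicator (labelCross? (a , b) y))
      row-hit r u at enter = refl
      row-hit {v} {a} {b} r u at (hit {a = a′} {b′} match r′ u′ at′) = cong₂ ℕ._+_
        (indicator-cong (cross? _ _) (labelCross? _ _)
          (λ { (eq , c) → cong₂ _,_ (proj₁ (labels eq)) (proj₂ (labels eq)) , trans (E≡T r u)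
            (trans (cong T (sym at)) c) })
          (λ { (refl , c) → trans at (sym at′) , trans (cong T at) (trans (sym (E≡T r u)) c) }))
        (row-hit {v} r u at match)
        where
        labels : B i v ≡ _ → a ≡ a′ × b ≡ b′
        labels eq = box-hit r u r′ u′ (trans (sym at) (trans eq at′))
      row-hit {v} r u at (skip match sk) = cong₂ ℕ._+_
        (indicator-no (cross? _ _) (λ { (eq , _) → skipped≢hit sk r u (trans (sym eq) at) }))
        (row-hit {v} r u at match)

      row-skip : ∀ {u h t} → Skipped (walk (N i) u) → Match j h t →
        Σ< t (λ v → indicator (cross? (B i u) (B j v))) ≡ 0
      row-skip sk enter = refl
      row-skip {u} sk (hit match r u′ at) = cong₂ ℕ._+_
        (indicator-no (cross? _ _) (λ { (eq , _) → skipped≢hit sk r u′ (trans eq at) }))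
        (row-skip {u} sk match)
      row-skip {u} sk (skip {s = s} match sk′) = cong₂ ℕ._+_
        (indicator-no (cross? _ _)
          (λ { (eq , _) → i≢j (proj₁ (walk-unique T i u j s (skipped-unique sk sk′ eq))) }))
        (row-skip {u} sk match)

      -- A hit and a skip are in different boxes, and by `skipped-unique` so are two skips; only
      -- pairs of hits contribute, and they share a box exactly if their labels agree.
      crossings-match : ∀ {h s h′ t} → Match i h s → Match j h′ t → crossings i s j t ≡ labelCrossings h h′
      crossings-match enter match′ = refl
      crossings-match (hit {s = s} match r u at) match′ =
        cong₂ ℕ._+_ (row-hit {s} r u at match′) (crossings-match match match′)
      crossings-match (skip {s = s} match sk) match′ =
        cong₂ ℕ._+_ (row-skip {s} sk match′) (crossings-match match match′)

  -- By `walk-unique` each of the two edges is reached by a single strand after a single number of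
  -- boxes, namely as found by `reachᴿ` and `reachᵁ`.
  crossings-above : ∀ {e a} → e ℕ.≤ m → q a ≡ R → q (a + δ e) ≡ U → ∀ {i s j t} →
                    walk (N i) s ≡ top (Box (φ a) (φ (a + δ e))) →
                      walk (N j) t ≡ left (Box (φ a) (φ (a + δ e))) →
                    crossings i s j t ≡ labelCrossings (H e a) (H e (a + δ e))
  crossings-above {e} {a} e≤m r u {i} {s} {j} {t} eqi eqj with reachᴿ e e≤m r | reachᵁ e e≤m u
  ... | s′ , at , match | t′ , at′ , match′
    with walk-unique T i s _ s′
      (trans eqi (trans (top-Box (trans (sym (q≡p a)) r) (trans (sym (q≡p (a + δ e))) u)) (sym at)))
       | walk-unique T j t _ t′
         (trans eqj (trans (cong (λ w → rowEdge (φ w - 1ℤ) (φ (a + δ e))) (sym (z+d-d a (δ e)))) (sym at′)))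
  ... | refl , refl | refl , refl = crossings-match distinct match match′
    where
    q-minus : ∀ l → q (l - + m) ≡ q l
    q-minus l = trans (sym (q-periodic (l - + m))) (cong q (z-d+d l (+ m)))
    distinct : φ (D e a) ≢ φ (D e (a + δ e))
    distinct eq = R≢U r (trans (cong q (D-injective e q-minus (φ-injective eq))) u)

  reach-above : ∀ {e a} → e ℕ.≤ m → q a ≡ R → q (a + δ e) ≡ U →
                ∃[ i ] ∃[ s ] ∃[ j ] ∃[ t ] walk (N i) s ≡ top (Box (φ a) (φ (a + δ e))) × walk (N j) t ≡
                  left (Box (φ a) (φ (a + δ e)))
  reach-above {e} {a} e≤m r u with reachᴿ e e≤m r | reachᵁ e e≤m u
  ... | s , at , _ | t , at′ , _ = _ , s , _ , t ,
    trans at (sym (top-Box (trans (sym (q≡p a)) r) (trans (sym (q≡p (a + δ e))) u))) ,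
    trans at′ (cong (λ w → rowEdge (φ w - 1ℤ) (φ (a + δ e))) (z+d-d a (δ e)))

-- Sums over a period

module _ {A : Set} where
  Σℤ : List A → (A → ℤ) → ℤ
  Σℤ xs F = sumℤ (map F xs)

  Σℤ-cong : ∀ xs {F G : A → ℤ} → (∀ x → F x ≡ G x) → Σℤ xs F ≡ Σℤ xs G
  Σℤ-cong []       _  = refl
  Σℤ-cong (x ∷ xs) eq = cong₂ _+_ (eq x) (Σℤ-cong xs eq)

  Σℤ-+ : ∀ xs (F G : A → ℤ) → Σℤ xs (λ x → F x + G x) ≡ Σℤ xs F + Σℤ xs G
  Σℤ-+ []       F G = refl
  Σℤ-+ (x ∷ xs) F G = trans (cong (_+_ (F x + G x)) (Σℤ-+ xs F G))
    (((∀ a b c d → a + b + (c + d) ≡ a + c + (b + d)) ∋ solve-∀) (F x) (G x) (Σℤ xs F) (Σℤ xs G))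

  Σℤ-* : ∀ xs (F : A → ℤ) c → Σℤ xs (λ x → F x * c) ≡ Σℤ xs F * c
  Σℤ-* []       F c = refl
  Σℤ-* (x ∷ xs) F c = trans (cong (_+_ (F x * c)) (Σℤ-* xs F c)) (sym (ℤP.*-distribʳ-+ c (F x) (Σℤ xs F)))

  Σℤ-neg : ∀ xs (F : A → ℤ) → Σℤ xs (λ x → - F x) ≡ - Σℤ xs F
  Σℤ-neg []       F = refl
  Σℤ-neg (x ∷ xs) F = trans (cong (_+_ (- F x)) (Σℤ-neg xs F)) (sym (ℤP.neg-distrib-+ (F x) (Σℤ xs F)))

  Σℤ-↭ : ∀ {xs ys} → xs ↭ ys → (F : A → ℤ) → Σℤ xs F ≡ Σℤ ys F
  Σℤ-↭ Perm.refl F = refl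
  Σℤ-↭ (Perm.prep x p) F = cong (_+_ (F x)) (Σℤ-↭ p F)
  Σℤ-↭ (Perm.swap {xs} {ys} x y p) F = trans (cong (λ w → F x + (F y + w)) (Σℤ-↭ p F))
    (((∀ a b c → a + (b + c) ≡ b + (a + c)) ∋ solve-∀) (F x) (F y) (Σℤ ys F))
  Σℤ-↭ (Perm.trans p q) F = trans (Σℤ-↭ p F) (Σℤ-↭ q F)

  Σℤ-bounds : ∀ xs {F : A → ℤ} → (∀ x → 0ℤ ≤ᶻ F x × F x ≤ᶻ 1ℤ) → 0ℤ ≤ᶻ Σℤ xs F × Σℤ xs F ≤ᶻ + length xs
  Σℤ-bounds []       _ = ℤP.≤-refl , ℤP.≤-refl
  Σℤ-bounds (x ∷ xs) b with b x | Σℤ-bounds xs b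
  ... | lo , hi | lo′ , hi′ = (lo ⊹ lo′) , (hi ⊹ hi′)

Σℤ-map : ∀ {A B : Set} (f : A → B) xs (F : B → ℤ) → Σℤ (map f xs) F ≡ Σℤ xs (F ∘ f)
Σℤ-map f []       F = refl
Σℤ-map f (x ∷ xs) F = cong (_+_ (F (f x))) (Σℤ-map f xs F)

ΣPeriod : ∀ n → (ℤ → ℤ) → ℤ
ΣPeriod n F = Σℤ (allFin n) (F ∘ rep)

ΣPeriod-telescope : ∀ n (Z : ℤ → ℤ) → ΣPeriod n (λ l → Z l - Z (l - 1ℤ)) ≡ Z (+ n) - Z 0ℤ
ΣPeriod-telescope n Z =
  trans (Σℤ-cong (allFin n)
    (λ i → cong (λ w → Z (rep i) - Z w) (((∀ i → 1ℤ + i - 1ℤ ≡ i) ∋ solve-∀) (+ toℕ i))))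
  (from n 0)
  where
  from : ∀ n c → Σℤ (allFin n) (λ i → Z (+ (c ℕ.+ suc (toℕ i))) - Z (+ (c ℕ.+ toℕ i))) ≡ Z (+ (c ℕ.+ n)) - Z
    (+ c)
  from zero    c = trans (sym (ℤP.+-inverseʳ (Z (+ c))))
    (cong (λ w → Z (+ w) - Z (+ c)) (sym (ℕP.+-identityʳ c)))
  from (suc n) c = trans
    (cong₂ _+_ (cong₂ (λ u v → Z (+ u) - Z (+ v)) (trans (ℕP.+-suc c 0) (cong suc (ℕP.+-identityʳ c)))
      (ℕP.+-identityʳ c)) tail-sum)
    (trans (((∀ a b c → a - b + (c - a) ≡ c - b) ∋ solve-∀) (Z (+ suc c)) (Z (+ c)) (Z (+ (suc c ℕ.+ n))))
      (cong (λ w → Z (+ w) - Z (+ c)) (sym (ℕP.+-suc c n))))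
    where
    F : Fin (suc n) → ℤ
    F i = Z (+ (c ℕ.+ suc (toℕ i))) - Z (+ (c ℕ.+ toℕ i))
    tail-sum : Σℤ (tabulate {n = n} Fin.suc) F ≡ Z (+ (suc c ℕ.+ n)) - Z (+ suc c)
    tail-sum = trans (cong (λ w → Σℤ w F) (sym (ListP.map-tabulate {n = n} id Fin.suc)))
      (trans (Σℤ-map Fin.suc (allFin n) F)
        (trans (Σℤ-cong (allFin n)
          (λ i → cong₂ (λ u v → Z (+ u) - Z (+ v)) (ℕP.+-suc c (suc (toℕ i))) (ℕP.+-suc c (toℕ i))))
            (from n (suc c))))

module _ {n : ℕ} .{{_ : NonZero n}} where

  reduce-res : ∀ {g} → IsAffinePermutation n g → ∀ z → reduce n g (res n z) ≡ res n (g z)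
  reduce-res {g} g-aff z = trans (sym (res-shift n (g (rep (res n z))) (quot n z)))
    (cong (res n) (trans (sym
      (shift-map g (+ n) (+ n) (IsAffinePermutation.periodic g-aff) (quot n z) (rep (res n z))))
        (cong g (sym (rep-res-quot n z)))))

  reduce-injective : ∀ {g} → IsAffinePermutation n g → ∀ {i j} → reduce n g i ≡ reduce n g j → i ≡ j
  reduce-injective {g} g-aff {i} {j} eq =
    trans (sym (res-rep n i)) (trans (cong (res n) rep≡) (res-rep+ n j q))
    where
    open IsAffinePermutation g-aff
    q = quot n (g (rep i)) - quot n (g (rep j))
    rep≡ : rep i ≡ rep j + q * + n
    rep≡ = proj₁ bijective
      (trans (res≡⇒shift n {g (rep i)} {g (rep j)} eq) (sym (shift-map g (+ n) (+ n) periodic q (rep j))))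

  reduce-surjective : ∀ {g} → IsAffinePermutation n g → ∀ i → ∃[ j ] reduce n g j ≡ i
  reduce-surjective {g} g-aff i with proj₂ (IsAffinePermutation.bijective g-aff) (rep i)
  ... | z , g-z = res n z , trans (reduce-res g-aff z) (trans (cong (res n) (g-z refl)) (res-rep n i))

  reduce-↭ : ∀ {g} → IsAffinePermutation n g → map (reduce n g) (allFin n) ↭ allFin n
  reduce-↭ {g} g-aff = ∼bag⇒↭
    (unique∧set⇒bag (UniqueP.map⁺ (reduce-injective g-aff) (allFin⁺ n)) (allFin⁺ n)
    (λ {i} → mk⇔ (λ _ → ∈-allFin i)
      (λ _ → subst (_∈ₗ map (reduce n g) (allFin n)) (proj₂ (reduce-surjective g-aff i))
        (∈-map⁺ (reduce n g) (∈-allFin (proj₁ (reduce-surjective g-aff i)))))))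

  periodic-res : (F : ℤ → ℤ) → (∀ z → F (z + + n) ≡ F z) → ∀ z → F (rep (res n z)) ≡ F z
  periodic-res F F-per z =
    trans (sym (trans (shift-map F (+ n) 0ℤ (λ i → trans (F-per i) (sym (ℤP.+-identityʳ (F i)))) (quot n z)
      (rep (res n z)))
    (((∀ u q → u + q * 0ℤ ≡ u) ∋ solve-∀) (F (rep (res n z))) (quot n z))))
      (cong F (sym (rep-res-quot n z)))

  ΣPeriod-permute : ∀ {g} → IsAffinePermutation n g → (F : ℤ → ℤ) → (∀ z → F (z + + n) ≡ F z) →
    ΣPeriod n (F ∘ g) ≡ ΣPeriod n F
  ΣPeriod-permute {g} g-aff F F-per =
    trans (Σℤ-cong (allFin n) (λ i → sym (periodic-res F F-per (g (rep i)))))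
    (trans (sym (Σℤ-map (reduce n g) (allFin n) (F ∘ rep))) (Σℤ-↭ (reduce-↭ g-aff) (F ∘ rep)))

  inverse⇒affine : ∀ {g h : ℤ → ℤ} → (∀ z → g (h z) ≡ z) → (∀ z → h (g z) ≡ z) →
    (∀ z → g (z + + n) ≡ g z + + n) → IsAffinePermutation n g
  inverse⇒affine {g} {h} gh hg g-per = record
    { bijective = (λ {x} {y} eq → trans (sym (hg x)) (trans (cong h eq) (hg y))) ,
      (λ y → h y , λ eq → trans (cong g eq) (gh y))
    ; periodic  = g-per }

  -- Modulo n, g permutes a period, so the values of g and of the identity differ by
  -- multiples of n in total.
  displacement-sum : ∀ {g} → IsAffinePermutation n g → (∀ z → z ≤ᶻ g z) → (∀ z → g z ≤ᶻ z + + n) →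
                     ∃[ k ] k ℕ.≤ n × ΣPeriod n (λ z → g z - z) ≡ + k * + n
  displacement-sum {g} g-aff lo hi = ∣ K ∣ , ∣K∣≤n , trans sum-K (cong (_* + n) (sym +∣K∣))
    where
    K = ΣPeriod n (quot n ∘ g)
    sum-K : ΣPeriod n (λ z → g z - z) ≡ K * + n
    sum-K = begin
      ΣPeriod n (λ z → g z - z) ≡⟨
        Σℤ-cong (allFin n) (λ i → trans (cong (_- rep i) (rep-res-quot n (g (rep i))))
                                     (trans (((∀ a b c → a + b - c ≡ (a + (- c)) + b) ∋ solve-∀)
                                       (rep (res n (g (rep i)))) (quot n (g (rep i)) * + n) (rep i))
                                       (cong (λ w → rep (res n (g (rep i))) + (- rep w) + quot n (g (rep i))
                                         * + n) (sym (res-rep n i))))) ⟩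
      ΣPeriod n (λ z → r (g z) + (- r z) + quot n (g z) * + n) ≡⟨
        Σℤ-+ (allFin n) (λ i → r (g (rep i)) + (- r (rep i))) (λ i → quot n (g (rep i)) * + n) ⟩
      ΣPeriod n (λ z → r (g z) + (- r z)) + ΣPeriod n (λ z → quot n (g z) * + n) ≡⟨
        cong₂ _+_ (Σℤ-+ (allFin n) (r ∘ g ∘ rep) (λ i → - r (rep i)))
          (Σℤ-* (allFin n) (quot n ∘ g ∘ rep) (+ n)) ⟩
      ΣPeriod n (r ∘ g) + ΣPeriod n (λ z → - r z) + K * + n ≡⟨
        cong₂ (λ u v → u + v + K * + n) (ΣPeriod-permute g-aff r (λ z → cong rep (res-+n n z)))
          (Σℤ-neg (allFin n) (r ∘ rep)) ⟩
      ΣPeriod n r + (- ΣPeriod n r) + K * + n ≡⟨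
        ((∀ a b → a + (- a) + b ≡ b) ∋ solve-∀) (ΣPeriod n r) (K * + n) ⟩
      K * + n ∎
      where
      open ≡-Reasoning
      r : ℤ → ℤ
      r z = rep (res n z)
    -- Here `1 ≤ g (rep i) ≤ 2n`, so the quotient is 0 or 1, and `K` counts the `i` that `g` sends
    -- beyond `n`.
    quot-bounds : ∀ i → 0ℤ ≤ᶻ quot n (g (rep i)) × quot n (g (rep i)) ≤ᶻ 1ℤ
    quot-bounds i with ≤-split 0ℤ q | ≤-split q 1ℤ
      where q = quot n (g (rep {n} i))
    ... | inj₁ 0≤q | inj₁ q≤1 = 0≤q , q≤1
    ... | inj₂ q<0 | _ = ⊥-elim
        (lin-absurd (lo (rep i) ⊹ rep-lower n i ⊹ rep-upper n (res n (g (rep i))) ⊹ ℤP.*-monoʳ-≤-nonNeg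
          (+ n) (<⇒+1≤ q<0))
        (trans (cong (λ w → w + rep i + + n + 0ℤ * + n -
          (rep i + 1ℤ + rep (res n (g (rep i))) + (q + 1ℤ) * + n)) (rep-res-quot n (g (rep i))))
          (((∀ r q n i → r + q * n + i + n + 0ℤ * n - (i + 1ℤ + r + (q + 1ℤ) * n) ≡ - 1ℤ) ∋ solve-∀)
            (rep (res n (g (rep i)))) q (+ n) (rep i))))
      where q = quot n (g (rep {n} i))
    ... | _ | inj₂ 1<q = ⊥-elim
        (lin-absurd (hi (rep i) ⊹ rep-upper n i ⊹ rep-lower n (res n (g (rep i))) ⊹ ℤP.*-monoʳ-≤-nonNeg
          (+ n) (<⇒+1≤ 1<q))
        (trans (cong (λ w → rep i + + n + + n + rep (res n (g (rep i))) + q * + n -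
          (w + rep i + 1ℤ + (1ℤ + 1ℤ) * + n)) (rep-res-quot n (g (rep i))))
          (((∀ r q n i → i + n + n + r + q * n - (r + q * n + i + 1ℤ + (1ℤ + 1ℤ) * n) ≡ - 1ℤ) ∋ solve-∀)
            (rep (res n (g (rep i)))) q (+ n) (rep i))))
      where q = quot n (g (rep {n} i))
    bounds = Σℤ-bounds (allFin n) quot-bounds
    +∣K∣ : + ∣ K ∣ ≡ K
    +∣K∣ = ℤP.0≤i⇒+∣i∣≡i (proj₁ bounds)
    ∣K∣≤n : ∣ K ∣ ℕ.≤ n
    ∣K∣≤n = ℤP.drop‿+≤+ (subst₂ _≤ᶻ_ (sym +∣K∣) (cong +_ (ListP.length-tabulate {n = n} id)) (proj₂ bounds))

av-sum : ∀ n .{{_ : NonZero n}} g k → ΣPeriod n (λ z → g z - z) ≡ + k * + n → av n g ≡ + k / 1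
av-sum (suc d) g k eq = fromℚᵘ-cong {mkℚᵘ (ΣPeriod (suc d) (λ z → g z - z)) d} {mkℚᵘ (+ k) 0}
  (*≡* (trans (ℤP.*-identityʳ (ΣPeriod (suc d) (λ z → g z - z))) eq))

module _ {m : ℕ} .{{_ : NonZero m}} {p : ℤ → Step} {E : ℤ → ℤ → Tile} where
  open Labels m p E

  module _ (p-periodic : ∀ l → p (l + + m) ≡ p l)
           (E-periodic : ∀ {a b} → p a ≡ R → p b ≡ U → a <ᶻ b → b <ᶻ a + + m →
             E (a + + m) (b + + m) ≡ E a b)
           (Y : ℤ → ℤ) (Y-R : ∀ {l} → p l ≡ R → Y l ≡ Y (l - 1ℤ))
             (Y-U : ∀ {l} → p l ≡ U → Y l ≡ Y (l - 1ℤ) + 1ℤ) where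

    private
      τ-affine : ∀ {e} → e ℕ.< m → IsAffinePermutation m (τ (δ e))
      τ-affine {e} e<m = inverse⇒affine (τ-involutive (δ e)) (τ-involutive (δ e))
        (τ-periodic p-periodic E-periodic e<m)

      -- Replacing `z` by `τ (δ e) z` permutes the terms of the period and, `τ` being an involution,
      -- also negates them. The sum is thus its own negative.
      τ-sum : ∀ {e} → e ℕ.< m → ΣPeriod m (λ z → z - τ (δ e) z) ≡ 0ℤ
      τ-sum {e} e<m = self-negative (trans (sym (ΣPeriod-permute (τ-affine e<m) F F-per))
        (trans (Σℤ-cong (allFin m)
          (λ i → trans (cong (λ w → τ (δ e) (rep i) - w) (τ-involutive (δ e) (rep i)))
            (((∀ x y → y - x ≡ - (x - y)) ∋ solve-∀) (rep i) (τ (δ e) (rep i)))))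
          (Σℤ-neg (allFin m) (F ∘ rep))))
        where
        F : ℤ → ℤ
        F z = z - τ (δ e) z
        F-per : ∀ z → F (z + + m) ≡ F z
        F-per z = trans (cong (λ w → z + + m - w) (τ-periodic p-periodic E-periodic e<m z))
          (((∀ z t m → z + m - (t + m) ≡ z - t) ∋ solve-∀) z (τ (δ e) z) (+ m))
        self-negative : ∀ {x} → x ≡ - x → x ≡ 0ℤ
        self-negative {+ zero}  _ = refl
        self-negative {+ suc _} ()
        self-negative { -[1+ _ ]} ()

    -- An elbow exchanges two wires, which leaves the sum of the displacements unchanged.
    D-sum : ∀ {e} → e ℕ.≤ m → ΣPeriod m (λ z → z - D e z) ≡ (Y (+ m) - Y 0ℤ) * + m
    D-sum {zero} _ = trans (Σℤ-cong (allFin m) (λ i → displacement (rep i)))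
      (trans (Σℤ-* (allFin m) (λ i → Y (rep i) - Y (rep i - 1ℤ)) (+ m))
        (cong (_* + m) (ΣPeriod-telescope m Y)))
      where
      -- A U-step enters `m` labels earlier and raises `Y` by one; an R-step does neither. So the
      -- sum of the displacements telescopes.
      displacement : ∀ z → z - start (p z) z ≡ (Y z - Y (z - 1ℤ)) * + m
      displacement z with p z in eq
      ... | R = trans (((∀ z y m → z - z ≡ (y - y) * m) ∋ solve-∀) z (Y (z - 1ℤ)) (+ m))
          (cong (λ w → (w - Y (z - 1ℤ)) * + m) (sym (Y-R eq)))
      ... | U = trans (((∀ z y m → z - (z - m) ≡ (y + 1ℤ - y) * m) ∋ solve-∀) z (Y (z - 1ℤ)) (+ m))
          (cong (λ w → (w - Y (z - 1ℤ)) * + m) (sym (Y-U eq)))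
    D-sum {suc e} e<m = begin
      ΣPeriod m (λ z → z - D e (τ (δ e) z)) ≡⟨
        Σℤ-cong (allFin m) (λ i →
          ((∀ z t d → z - d ≡ z - t + (t - d)) ∋ solve-∀) (rep i) (τ (δ e) (rep i)) (D e (τ (δ e) (rep i))))
            ⟩
      ΣPeriod m (λ z → z - τ (δ e) z + F (τ (δ e) z)) ≡⟨
        Σℤ-+ (allFin m) (λ i → rep i - τ (δ e) (rep i)) (F ∘ τ (δ e) ∘ rep) ⟩
      ΣPeriod m (λ z → z - τ (δ e) z) + ΣPeriod m (F ∘ τ (δ e)) ≡⟨
        cong₂ _+_ (τ-sum e<m) (ΣPeriod-permute (τ-affine e<m) F F-per) ⟩
      0ℤ + ΣPeriod m F ≡⟨ ℤP.+-identityˡ _ ⟩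
      ΣPeriod m F ≡⟨ D-sum (ℕP.<⇒≤ e<m) ⟩
      (Y (+ m) - Y 0ℤ) * + m ∎
      where
      open ≡-Reasoning
      F : ℤ → ℤ
      F z = z - D e z
      F-per : ∀ z → F (z + + m) ≡ F z
      F-per z = trans (cong (λ w → z + + m - w) (D-periodic p-periodic E-periodic (ℕP.<⇒≤ e<m) z))
        (((∀ z t m → z + m - (t + m) ≡ z - t) ∋ solve-∀) z (D e z) (+ m))

    -- `D m` is the inverse of `g`. Substituting `D m z` for `z` permutes the period and turns
    -- `g z - z` into `z - D m z`, whose sum is known from `D-sum`.
    permutation-displacement : ∀ {g} → IsAffinePermutation m g → (∀ z → D m (g z) ≡ z) →
                               ΣPeriod m (λ z → g z - z) ≡ (Y (+ m) - Y 0ℤ) * + m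
    permutation-displacement {g} g-aff Dg = trans (sym (ΣPeriod-permute D-affine (λ z → g z - z) F-per))
      (trans (Σℤ-cong (allFin m) (λ i → cong (_- D m (rep i)) (gD (rep i)))) (D-sum ℕP.≤-refl))
      where
      open IsAffinePermutation g-aff
      gD : ∀ z → g (D m z) ≡ z
      gD z with proj₂ bijective z
      ... | y , g-y = trans (cong (g ∘ D m) (sym (g-y refl))) (trans (cong g (Dg y)) (g-y refl))
      D-affine : IsAffinePermutation m (D m)
      D-affine = inverse⇒affine {h = g} Dg gD (D-periodic p-periodic E-periodic ℕP.≤-refl)
      F-per : ∀ z → g (z + + m) - (z + + m) ≡ g z - z
      F-per z = trans (cong (_- (z + + m)) (periodic z))
        (((∀ z t m → t + m - (z + m) ≡ t - z) ∋ solve-∀) z (g z) (+ m))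

-- Forests and cycles

module _ {A : Set} where
  lookup-injective : ∀ {xs : List A} → Unique xs → ∀ {i j} → lookup xs i ≡ lookup xs j → i ≡ j
  lookup-injective (_ ∷ _)    {Fin.zero}  {Fin.zero}  _  = refl
  lookup-injective (x∉ ∷ _)   {Fin.zero}  {Fin.suc j} eq = contradiction eq (All.lookup x∉ (∈-lookup j))
  lookup-injective (x∉ ∷ _)   {Fin.suc i} {Fin.zero}  eq =
    contradiction (sym eq) (All.lookup x∉ (∈-lookup i))
  lookup-injective (_ ∷ uniq) {Fin.suc i} {Fin.suc j} eq = cong Fin.suc (lookup-injective uniq eq)

  Unique-++ : ∀ (xs : List A) {ys} → Unique (xs ++ ys) →
    Unique xs × Unique ys × (∀ {x} → x ∈ₗ xs → ¬ x ∈ₗ ys)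
  Unique-++ []       uniq = [] , uniq , λ ()
  Unique-++ (x ∷ xs) (x∉ ∷ uniq) with Unique-++ xs uniq
  ... | uxs , uys , disjoint = All.tabulate (λ y∈ → All.lookup x∉ (∈-++⁺ˡ y∈)) ∷ uxs , uys ,
    λ { (here refl) x∈ → All.lookup x∉ (∈-++⁺ʳ xs x∈) refl ; (there y∈) → disjoint y∈ }

  unique-resp-↭ : ∀ {xs ys : List A} → xs ↭ ys → Unique xs → Unique ys
  unique-resp-↭ p = PermS.Unique-resp-↭ (setoid A) (↭⇒↭ₛ p)

unique-length : ∀ {r} {xs : List (Fin r)} → Unique xs → length xs ℕ.≤ r
unique-length uniq = FinP.injective⇒≤ (lookup-injective uniq)

unique-covers : ∀ {r} {xs : List (Fin r)} → Unique xs → r ℕ.≤ length xs → ∀ c → c ∈ₗ xs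
unique-covers {xs = xs} uniq r≤ c with decide-∈ FinP._≟_ c xs
... | yes c∈ = c∈
... | no  c∉ = contradiction (unique-length (All.tabulate (λ { x∈ refl → c∉ x∈ }) ∷ uniq))
    (ℕP.<⇒≱ (ℕ.s≤s r≤))

Separated : ∀ {A B : Set} → (A → B) → List A → Set
Separated f = AllPairs (λ x y → f x ≢ f y)

separated-unique : ∀ {A B : Set} (f : A → B) {xs} → Separated f xs → Unique (map f xs)
separated-unique f = AllPairsP.map⁺

module _ {n : ℕ} where

  Respects : (Fin n → Fin n) → Fin n × Fin n → Set
  Respects comp (a , b) = comp a ≡ comp b

  private
    merge : Fin n → Fin n → Fin n → Fin n
    merge u v x with x FinP.≟ u
    ... | yes _ = v
    ... | no  _ = x

    merge-≡ : ∀ u v → merge u v u ≡ v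
    merge-≡ u v with u FinP.≟ u
    ... | yes _  = refl
    ... | no u≢u = contradiction refl u≢u

    merge-≢ : ∀ u v {x} → x ≢ u → merge u v x ≡ x
    merge-≢ u v {x} x≢u with x FinP.≟ u
    ... | yes eq = contradiction eq x≢u
    ... | no  _  = refl

    merge-v : ∀ u v → merge u v v ≡ v
    merge-v u v with v FinP.≟ u
    ... | yes _ = refl
    ... | no  _ = refl

    module _ (comp : Fin n → Fin n) (u : Fin n) where
      keep? : ∀ x → Dec (comp x ≢ u)
      keep? x = ¬? (comp x FinP.≟ u)

      -- The entries represent different classes, so at most one of them lies in the class `u` that
      -- is about to be merged into another.
      drop-one : ∀ {xs} → Separated comp xs → length xs ℕ.≤ suc (length (filter keep? xs))
      drop-one [] = ℕ.z≤n
      drop-one {x ∷ xs} (x∉ ∷ sep) with comp x FinP.≟ u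
      ... | no _    = ℕ.s≤s (drop-one sep)
      ... | yes x≡u = ℕ.s≤s (ℕP.≤-reflexive (cong length (sym (ListP.filter-all keep? all-kept))))
        where
        all-kept : All (λ y → comp y ≢ u) xs
        all-kept = All.map (λ neq eq → neq (trans x≡u (sym eq))) x∉

      merge-separated : ∀ v {xs} → All (λ x → comp x ≢ u) xs → Separated comp xs →
        Separated (merge u v ∘ comp) xs
      merge-separated v []       []         = []
      merge-separated v (k ∷ ks) (x∉ ∷ sep) =
        All.zipWith (λ { (neq , k′) eq → neq (trans (sym (merge-≢ u v k)) (trans eq (merge-≢ u v k′))) })
          (x∉ , ks) ∷ merge-separated v ks sep

  -- Each edge merges at most two components.
  components : (es : List (Fin n × Fin n)) →
    ∃[ comp ] ∃[ xs ] Separated comp xs × n ℕ.≤ length xs ℕ.+ length es × All (Respects comp) es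
  components [] = id , allFin n , allFin⁺ n ,
    ℕP.≤-reflexive (sym (trans (ℕP.+-identityʳ _) (ListP.length-tabulate {n = n} id))) , []
  components ((a , b) ∷ es) with components es
  ... | comp , xs , sep , n≤ , resp = merge (comp a) (comp b) ∘ comp , filter (keep? comp (comp a)) xs ,
    merge-separated comp (comp a) (comp b)
      (All.tabulate (λ x∈ → proj₂ (∈-filter⁻ (keep? comp (comp a)) {xs = xs} x∈)))
        (AllPairsP.filter⁺ (keep? comp (comp a)) sep) ,
    ℕP.≤-trans n≤ (ℕP.≤-trans (ℕP.+-monoˡ-≤ (length es) (drop-one comp (comp a) sep))
      (ℕP.≤-reflexive (sym (ℕP.+-suc _ (length es))))) ,
    (trans (merge-≡ (comp a) (comp b)) (sym (merge-v (comp a) (comp b)))) ∷ All.map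
      (cong (merge (comp a) (comp b))) resp

  -- The hypothesis says that each colour class lies in one component of the graph.
  module _ {r : ℕ} (colour : Fin n → Fin r) (es : List (Fin n × Fin n))
           (connected : ∀ comp → All (Respects comp) es → ∀ {x y} → colour x ≡ colour y → comp x ≡ comp y)
             where

    private
      colours-separated : ∀ {comp xs} → All (Respects comp) es → Separated comp xs → Separated colour xs
      colours-separated {comp} resp = AllPairs.map (λ neq eq → neq (connected comp resp eq))

    edges-bound : n ℕ.≤ r ℕ.+ length es
    edges-bound with components es
    ... | comp , xs , sep , n≤ , resp = ℕP.≤-trans n≤ (ℕP.+-monoˡ-≤ (length es)
      (subst (ℕ._≤ r) (ListP.length-map colour xs)
        (unique-length (separated-unique colour (colours-separated resp sep)))))

    -- Equality forces at least `r` separated representatives, hence one of every colour. A colour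
    -- class lies in the component of its representative, so the representatives of the colours at
    -- the two ends of an edge lie in one component and coincide.
    monochromatic : n ≡ r ℕ.+ length es → All (λ e → colour (proj₁ e) ≡ colour (proj₂ e)) es
    monochromatic n≡ with components es
    ... | comp , xs , sep , n≤ , resp = All.map mono resp
      where
      uniq : Unique (map colour xs)
      uniq = separated-unique colour (colours-separated resp sep)
      r≤ : r ℕ.≤ length (map colour xs)
      r≤ = subst (r ℕ.≤_) (sym (ListP.length-map colour xs))
        (ℕP.+-cancelʳ-≤ (length es) r (length xs) (subst (ℕ._≤ length xs ℕ.+ length es) n≡ n≤))
      same : ∀ {zs x y} → Separated comp zs → x ∈ₗ zs → y ∈ₗ zs → comp x ≡ comp y → x ≡ y
      same _ (here refl) (here refl) _ = refl
      same (x∉ ∷ _) (here refl) (there y∈) eq = contradiction eq (All.lookup x∉ y∈)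
      same (y∉ ∷ _) (there x∈) (here refl) eq = contradiction (sym eq) (All.lookup y∉ x∈)
      same (_ ∷ s) (there x∈) (there y∈) eq = same s x∈ y∈ eq
      mono : ∀ {e} → Respects comp e → colour (proj₁ e) ≡ colour (proj₂ e)
      mono {a , b} eq with ∈-map⁻ colour (unique-covers uniq r≤ (colour a)) | ∈-map⁻ colour
        (unique-covers uniq r≤ (colour b))
      ... | x , x∈ , ca | y , y∈ , cb with same sep x∈ y∈
          (trans (connected comp resp (sym ca)) (trans eq (connected comp resp cb)))
      ... | refl = trans ca (sym cb)

  #classes : ∀ {r} (colour : Fin n → Fin r) → (∀ c → ∃[ x ] colour x ≡ c) →
    ∀ {Q : Fin n → Fin n → Set} (Q? : ∀ x y → Dec (Q x y)) →
             (∀ {x y} → Q x y → colour x ≡ colour y) → (∀ {x y} → colour x ≡ colour y → Q x y) →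
             length (deduplicate Q? (allFin n)) ≡ r
  #classes {r} colour onto {Q} Q? sound complete = ℕP.≤-antisym
    (subst (ℕ._≤ r) (ListP.length-map colour (deduplicate Q? (allFin n))) (unique-length uniq))
    (subst₂ ℕ._≤_ (ListP.length-tabulate {n = r} id) (ListP.length-map colour (deduplicate Q? (allFin n)))
      (ℕP.≤-reflexive (↭-length
        (∼bag⇒↭ (unique∧set⇒bag (allFin⁺ r) uniq (λ {c} → mk⇔ (λ _ → all-colours c) (λ _ → ∈-allFin c)))))))
    where
    separated : ∀ xs → Separated colour (deduplicate Q? xs)
    separated []       = []
    separated (x ∷ xs) = All.tabulate
      (λ y∈ eq → proj₂ (∈-filter⁻ (λ y → ¬? (Q? x y)) {xs = deduplicate Q? xs} y∈) (complete eq)) ∷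
        AllPairsP.filter⁺ (λ y → ¬? (Q? x y)) (separated xs)
    represented : ∀ {x} xs → x ∈ₗ xs → ∃[ y ] y ∈ₗ deduplicate Q? xs × colour y ≡ colour x
    represented (x ∷ xs) (here refl) = x , here refl , refl
    represented (x ∷ xs) (there z∈) with represented xs z∈
    ... | y , y∈ , eq with Q? x y
    ... | yes q = x , here refl , trans (sound q) eq
    ... | no ¬q = y , there (∈-filter⁺ (λ y → ¬? (Q? x y)) y∈ ¬q) , eq
    uniq : Unique (map colour (deduplicate Q? (allFin n)))
    uniq = separated-unique colour (separated (allFin n))
    all-colours : ∀ c → c ∈ₗ map colour (deduplicate Q? (allFin n))
    all-colours c with onto c
    ... | x , refl with represented (allFin n) (∈-allFin x)
    ... | y , y∈ , eq = subst (_∈ₗ map colour (deduplicate Q? (allFin n))) eq (∈-map⁺ colour y∈)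

module _ {n : ℕ} (σ : Fin n → Fin n) where

  fold-+ : ∀ (x : Fin n) s t → fold x σ (s ℕ.+ t) ≡ fold (fold x σ t) σ s
  fold-+ x zero    t = refl
  fold-+ x (suc s) t = cong σ (fold-+ x s t)

  -- Pigeonhole: any point of an orbit is reached in fewer than n steps.
  reachable⇒sameCycle : ∀ t {x y} → fold x σ t ≡ y → SameCycle σ x y
  reachable⇒sameCycle t = <-rec (λ t → ∀ {x y} → fold x σ t ≡ y → SameCycle σ x y) shorten t
    where
    shorten : ∀ t → (∀ {s} → s ℕ.< t → ∀ {x y} → fold x σ s ≡ y → SameCycle σ x y) → ∀ {x y} →
      fold x σ t ≡ y → SameCycle σ x y
    shorten t rec {x} {y} eq with t ℕP.<? n
    ... | yes t<n = fromℕ< t<n , trans (cong (fold x σ) (toℕ-fromℕ< t<n)) eq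
    ... | no  t≮n with FinP.pigeonhole (ℕP.n<1+n n) (λ (i : Fin (suc n)) → fold x σ (toℕ i))
    ... | i , j , i<j , same = rec {t ℕ.∸ toℕ j ℕ.+ toℕ i}
      (subst (t ℕ.∸ toℕ j ℕ.+ toℕ i ℕ.<_) (ℕP.m∸n+n≡m j≤t) (ℕP.+-monoʳ-< (t ℕ.∸ toℕ j) i<j))
      (trans (fold-+ x (t ℕ.∸ toℕ j) (toℕ i)) (trans (cong (λ w → fold w σ (t ℕ.∸ toℕ j)) same)
        (trans (sym (fold-+ x (t ℕ.∸ toℕ j) (toℕ j))) (trans (cong (fold x σ) (ℕP.m∸n+n≡m j≤t)) eq))))
      where
      j≤t : toℕ j ℕ.≤ t
      j≤t = ℕP.≤-trans (ℕ.s≤s⁻¹ (toℕ<n j)) (ℕP.≮⇒≥ t≮n)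

  Reach : Fin n → Fin n → Set
  Reach x y = ∃[ t ] fold x σ t ≡ y

  private
    Reach-trans : ∀ {x y z} → Reach x y → Reach y z → Reach x z
    Reach-trans {x} (s , refl) (t , refl) = t ℕ.+ s , fold-+ x t s

    along : ∀ x xs y → map σ (x ∷ xs) ≡ xs ∷ʳ y →
      (∀ {z} → z ∈ₗ x ∷ xs → Reach x z) × (∀ {z} → z ∈ₗ x ∷ xs → Reach z y)
    along x []        y eq =
      (λ { (here refl) → 0 , refl }) , (λ { (here refl) → 1 , ListP.∷-injectiveˡ eq })
    along x (x′ ∷ xs) y eq with along x′ xs y (ListP.∷-injectiveʳ eq)
    ... | from , to = (λ { (here refl) → 0 , refl ; (there z∈) →
        Reach-trans (1 , ListP.∷-injectiveˡ eq) (from z∈) }) ,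
                      (λ { (here refl) → Reach-trans (1 , ListP.∷-injectiveˡ eq)
                        (to (here refl)) ; (there z∈) → to z∈ })

  cycle-reach : ∀ {c x y} → IsCycle σ c → x ∈ₗ toList c → y ∈ₗ toList c → Reach x y
  cycle-reach {c} isCycle x∈ y∈ with along (head c) (tail c) (head c) isCycle
  ... | from , to = Reach-trans (to x∈) (from y∈)

  cycle-closed : ∀ {c x} → IsCycle σ c → x ∈ₗ toList c → σ x ∈ₗ toList c
  cycle-closed {c} {x} isCycle x∈ with ∈-++⁻ (tail c) (subst (σ x ∈ₗ_) isCycle (∈-map⁺ σ x∈))
  ... | inj₁ t∈ = there t∈
  ... | inj₂ (here eq) = here eq

module Colours {n : ℕ} {σ : Fin n → Fin n} (D : CycleDecomposition σ) where
  open CycleDecomposition D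

  private
    Unique-concatMap : ∀ (cs : List (List⁺ (Fin n))) → Unique (concatMap toList cs) →
      (∀ j → Unique (toList (lookup cs j))) ×
        (∀ {i j x} → x ∈ₗ toList (lookup cs i) → x ∈ₗ toList (lookup cs j) → i ≡ j)
    Unique-concatMap [] _ = (λ ()) , λ { {()} }
    Unique-concatMap (c ∷ cs) uniq with Unique-++ (toList c) uniq
    ... | uc , ucs , disjoint with Unique-concatMap cs ucs
    ... | each , once = (λ { Fin.zero → uc ; (Fin.suc j) → each j }) , λ { {i} {j} → index-unique i j }
      where
      later : ∀ {x} j → x ∈ₗ toList (lookup cs j) → x ∈ₗ concatMap toList cs
      later {x} j x∈ = ∈-concatMap⁺ toList (Any.map (λ { refl → x∈ }) (∈-lookup {xs = cs} j))
      index-unique : ∀ i j {x} → x ∈ₗ toList (lookup (c ∷ cs) i) → x ∈ₗ toList (lookup (c ∷ cs) j) → i ≡ j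
      index-unique Fin.zero    Fin.zero    _  _  = refl
      index-unique Fin.zero    (Fin.suc j) x∈ y∈ = contradiction (later j y∈) (disjoint x∈)
      index-unique (Fin.suc i) Fin.zero    x∈ y∈ = contradiction (later i x∈) (disjoint y∈)
      index-unique (Fin.suc i) (Fin.suc j) x∈ y∈ = cong Fin.suc (once x∈ y∈)

    all-unique : Unique (concatMap toList cycles)
    all-unique = unique-resp-↭ (↭-sym partition) (allFin⁺ n)

    located : ∀ x → Any (λ c → x ∈ₗ toList c) cycles
    located x = ∈-concatMap⁻ toList {xs = cycles} (∈-resp-↭ (↭-sym partition) (∈-allFin x))

  cycle-unique : ∀ j → Unique (toList (cycle j))
  cycle-unique = proj₁ (Unique-concatMap cycles all-unique)

  colour : Fin n → Fin r
  colour x = Any.index (located x)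

  ∈-colour : ∀ x → x ∈ₗ toList (cycle (colour x))
  ∈-colour x = AnyP.lookup-index (located x)

  colour-∈ : ∀ {x j} → x ∈ₗ toList (cycle j) → colour x ≡ j
  colour-∈ {x} x∈ = proj₂ (Unique-concatMap cycles all-unique) (∈-colour x) x∈

  colour-σ : ∀ x → colour (σ x) ≡ colour x
  colour-σ x = colour-∈ (cycle-closed σ (areCycles (colour x)) (∈-colour x))

  colour-reach : ∀ {x y} → colour x ≡ colour y → Reach σ x y
  colour-reach {x} {y} eq =
    cycle-reach σ (areCycles (colour x)) (∈-colour x)
      (subst (λ c → y ∈ₗ toList (cycle c)) (sym eq) (∈-colour y))

  colour-fold : ∀ x t → colour (fold x σ t) ≡ colour x
  colour-fold x zero    = refl
  colour-fold x (suc t) = trans (colour-σ (fold x σ t)) (colour-fold x t)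

  #cycles≡r : #cycles σ ≡ r
  #cycles≡r = #classes colour (λ c → head (cycle c) , colour-∈ (here refl)) (sameCycle? σ)
    (λ { {x} (t , refl) → sym (colour-fold x (toℕ t)) })
    (λ { eq → reachable⇒sameCycle σ (proj₁ (colour-reach eq)) (proj₂ (colour-reach eq)) })

-- The order-preserving indexing of a cycle

module _ {A : Set} where
  lookup-AllPairs : ∀ {_~_ : A → A → Set} {xs} → AllPairs _~_ xs → ∀ {i j} → toℕ i ℕ.< toℕ j →
    lookup xs i ~ lookup xs j
  lookup-AllPairs (x∼ ∷ _) {Fin.zero}  {Fin.suc j} _ = All.lookup x∼ (∈-lookup j)
  lookup-AllPairs (_ ∷ xs) {Fin.suc i} {Fin.suc j} i<j = lookup-AllPairs xs (ℕ.s<s⁻¹ i<j)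

rank-lookup : ∀ {n} {xs : List (Fin n)} → AllPairs Fin._<_ xs → ∀ i →
  length (filter (FinP._<? lookup xs i) xs) ≡ toℕ i
rank-lookup {xs = x ∷ xs} (x< ∷ _) Fin.zero = cong length
  (trans (ListP.filter-reject (FinP._<? x) (ℕP.<-irrefl refl))
    (ListP.filter-none (FinP._<? x) (All.map (λ x<y y<x → ℕP.<-asym x<y y<x) x<)))
rank-lookup {xs = x ∷ xs} (x< ∷ xs<) (Fin.suc i) = trans
  (cong length (ListP.filter-accept (FinP._<? lookup xs i) (All.lookup x< (∈-lookup i))))
    (cong suc (rank-lookup xs< i))

module Indexing {n : ℕ} .{{_ : NonZero n}} (c : List⁺ (Fin n)) (uniq : Unique (toList c)) where

  open Data.List.Sort (FinP.≤-decTotalOrder n) using (sort; sort-↭; sort-↗)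

  private
    m = size c

    sorted : List (Fin n)
    sorted = sort (toList c)

    sorted-↭ : sorted ↭ toList c
    sorted-↭ = sort-↭ (toList c)

    strictly-sorted : AllPairs Fin._<_ sorted
    strictly-sorted = AllPairs.zipWith (λ { (x≤y , x≢y) → FinP.≤∧≢⇒< x≤y x≢y })
      (Sorted⇒AllPairs (DecTotalOrder.totalOrder (FinP.≤-decTotalOrder n)) (sort-↗ (toList c)) ,
        unique-resp-↭ (↭-sym sorted-↭) uniq)

    length≡ : m ≡ length sorted
    length≡ = sym (↭-length sorted-↭)

    position : Fin m → Fin (length sorted)
    position = Fin.cast length≡

    toℕ-position : ∀ i → toℕ (position i) ≡ toℕ i
    toℕ-position = FinP.toℕ-cast length≡

  enumerate-mono : ∀ {i j} → toℕ i ℕ.< toℕ j → toℕ (enumerate c i) ℕ.< toℕ (enumerate c j)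
  enumerate-mono {i} {j} i<j =
    lookup-AllPairs strictly-sorted (subst₂ ℕ._<_ (sym (toℕ-position i)) (sym (toℕ-position j)) i<j)

  enumerate-∈ : ∀ i → enumerate c i ∈ₗ toList c
  enumerate-∈ i = ∈-resp-↭ sorted-↭ (∈-lookup (position i))

  rank-enumerate : ∀ i → rank c (enumerate c i) ≡ toℕ i
  rank-enumerate i = trans (sym (↭-length (filter-↭ (FinP._<? enumerate c i) sorted-↭)))
    (trans (rank-lookup strictly-sorted (position i)) (toℕ-position i))

  enumerate-surjective : ∀ {x} → x ∈ₗ toList c → ∃[ i ] enumerate c i ≡ x
  enumerate-surjective {x} x∈ = Fin.cast (sym length≡) (Any.index x∈s) ,
    trans (cong (lookup sorted)
      (toℕ-injective (trans (toℕ-position _) (FinP.toℕ-cast (sym length≡) (Any.index x∈s)))))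
        (sym (AnyP.lookup-index x∈s))
    where
    x∈s : x ∈ₗ sorted
    x∈s = ∈-resp-↭ (↭-sym sorted-↭) x∈

  enumerate-injective : ∀ {i j} → enumerate c i ≡ enumerate c j → i ≡ j
  enumerate-injective {i} {j} eq =
    toℕ-injective (trans (sym (rank-enumerate i)) (trans (cong (rank c) eq) (rank-enumerate j)))

  enumerate-↭ : map (enumerate c) (allFin m) ↭ toList c
  enumerate-↭ = ∼bag⇒↭ (unique∧set⇒bag (UniqueP.map⁺ enumerate-injective (allFin⁺ m)) uniq
    (λ {x} → mk⇔ to (from x)))
    where
    to : ∀ {x} → x ∈ₗ map (enumerate c) (allFin m) → x ∈ₗ toList c
    to x∈ with ∈-map⁻ (enumerate c) x∈
    ... | i , _ , refl = enumerate-∈ i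
    from : ∀ x → x ∈ₗ toList c → x ∈ₗ map (enumerate c) (allFin m)
    from x x∈ with enumerate-surjective x∈
    ... | i , refl = ∈-map⁺ (enumerate c) (∈-allFin i)

  φ ψ : ℤ → ℤ
  φ = fromIndex c
  ψ = toIndex c

  res-φ : ∀ z → res n (φ z) ≡ enumerate c (res m z)
  res-φ z = res-rep+ n (enumerate c (res m z)) (quot m z)

  quot-φ : ∀ z → quot n (φ z) ≡ quot m z
  quot-φ z = quot-rep+ n (enumerate c (res m z)) (quot m z)

  φ-∈ : ∀ z → res n (φ z) ∈ₗ toList c
  φ-∈ z = subst (_∈ₗ toList c) (sym (res-φ z)) (enumerate-∈ (res m z))

  ψ-φ : ∀ z → ψ (φ z) ≡ z
  ψ-φ z = trans (cong₂ (λ i q → + suc (rank c i) + q * + m) (res-φ z) (quot-φ z))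
    (trans (cong (λ w → + suc w + quot m z * + m) (rank-enumerate (res m z))) (sym (rep-res-quot m z)))

  φ-ψ : ∀ {x} → res n x ∈ₗ toList c → φ (ψ x) ≡ x
  φ-ψ {x} x∈ with enumerate-surjective x∈
  ... | i , eq = trans (cong φ ψ-x)
      (trans (cong₂ (λ j q → rep (enumerate c j) + q * + n) (res-rep+ m i (quot n x))
        (quot-rep+ m i (quot n x)))
    (trans (cong (λ j → rep j + quot n x * + n) eq) (sym (rep-res-quot n x))))
    where
    ψ-x : ψ x ≡ rep i + quot n x * + m
    ψ-x = cong (λ w → + suc w + quot n x * + m) (trans (cong (rank c) (sym eq)) (rank-enumerate i))

  φ-rep : ∀ i → φ (rep i) ≡ rep (enumerate c i)
  φ-rep i = trans (cong₂ (λ j q → rep (enumerate c j) + q * + n) (res-rep m i) (quot-rep m i))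
    (((∀ x n → x + 0ℤ * n ≡ x) ∋ solve-∀) (rep (enumerate c i)) (+ n))

  φ-periodic : ∀ z → φ (z + + m) ≡ φ z + + n
  φ-periodic z = trans (cong₂ (λ j q → rep (enumerate c j) + q * + n) (res-+n m z) (quot-+n m z))
    (((∀ e q n → e + (q + 1ℤ) * n ≡ e + q * n + n) ∋ solve-∀) (rep (enumerate c (res m z))) (quot m z)
      (+ n))

  -- The order on ℤ is lexicographic in quotient and residue, for `m` as for `n`; `φ` keeps the
  -- quotient and acts on residues by the increasing map `enumerate`.
  φ-increasing : ∀ {a b} → a <ᶻ b → φ a <ᶻ φ b
  φ-increasing {a} {b} a<b with ≤-split (quot m b) (quot m a) | ≤-split (quot m a) (quot m b)
  ... | inj₂ qa<qb | _ = lin< (ℤP.*-monoʳ-≤-nonNeg (+ n) (<⇒+1≤ qa<qb) ⊹ rep-upper n ea ⊹ rep-lower n eb)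
    (((∀ qa qb n ea eb → eb + qb * n - (ea + qa * n + 1ℤ) ≡ qb * n + n + eb - ((qa + 1ℤ) * n + ea + 1ℤ)) ∋
      solve-∀) (quot m a) (quot m b) (+ n) (rep ea) (rep eb))
    where
    ea = enumerate c (res m a)
    eb = enumerate c (res m b)
  ... | _ | inj₂ qb<qa = ⊥-elim (lin-absurd
    (ℤP.*-monoʳ-≤-nonNeg (+ m) (<⇒+1≤ qb<qa) ⊹ rep-lower m (res m a) ⊹ rep-upper m (res m b) ⊹ ℤP.<⇒≤ a<b)
    (trans (cong₂ (λ x y →
      quot m a * + m + rep (res m a) + + m + y - ((quot m b + 1ℤ) * + m + 1ℤ + rep (res m b) + x))
        (rep-res-quot m a) (rep-res-quot m b))
      (((∀ qa qb ra rb m → qa * m + ra + m + (rb + qb * m) - ((qb + 1ℤ) * m + 1ℤ + rb + (ra + qa * m)) ≡ -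
        1ℤ) ∋ solve-∀) (quot m a) (quot m b) (rep (res m a)) (rep (res m b)) (+ m))))
  ... | inj₁ qb≤qa | inj₁ qa≤qb =
      subst (λ q → rep (enumerate c (res m a)) + q * + n <ᶻ rep (enumerate c (res m b)) + quot m b * + n)
        (sym qa≡qb)
    (ℤP.+-monoˡ-< (quot m b * + n) (+<+ (ℕ.s<s (enumerate-mono res<))))
    where
    qa≡qb : quot m a ≡ quot m b
    qa≡qb = ℤP.≤-antisym qa≤qb qb≤qa
    res< : toℕ (res m a) ℕ.< toℕ (res m b)
    res< = ℕ.s<s⁻¹ (ℤP.drop‿+<+ (lin< (<⇒+1≤ a<b) (trans
      (((∀ ra rb w → rb - (ra + 1ℤ) ≡ rb + w - (ra + w + 1ℤ)) ∋ solve-∀) (rep (res m a)) (rep (res m b))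
        (quot m b * + m))
      (cong₂ (λ x y → x - (y + 1ℤ)) (sym (rep-res-quot m b))
        (trans (cong (λ q → rep (res m a) + q * + m) (sym qa≡qb)) (sym (rep-res-quot m a)))))))

-- Counting elbows

module _ {A : Set} where
  Σ∈-cong : ∀ xs {F G : A → ℕ} → (∀ x → F x ≡ G x) → Σ∈ xs F ≡ Σ∈ xs G
  Σ∈-cong []       _  = refl
  Σ∈-cong (x ∷ xs) eq = cong₂ ℕ._+_ (eq x) (Σ∈-cong xs eq)

  Σ∈-++ : ∀ xs ys (F : A → ℕ) → Σ∈ (xs ++ ys) F ≡ Σ∈ xs F ℕ.+ Σ∈ ys F
  Σ∈-++ []       ys F = refl
  Σ∈-++ (x ∷ xs) ys F = trans (cong (F x ℕ.+_) (Σ∈-++ xs ys F)) (sym (ℕP.+-assoc (F x) (Σ∈ xs F) (Σ∈ ys F)))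

  Σ∈-↭ : ∀ {xs ys} → xs ↭ ys → (F : A → ℕ) → Σ∈ xs F ≡ Σ∈ ys F
  Σ∈-↭ Perm.refl F = refl
  Σ∈-↭ (Perm.prep x p) F = cong (F x ℕ.+_) (Σ∈-↭ p F)
  Σ∈-↭ (Perm.swap {xs} {ys} x y p) F = trans (cong (λ w → F x ℕ.+ (F y ℕ.+ w)) (Σ∈-↭ p F))
    (trans (sym (ℕP.+-assoc (F x) (F y) (Σ∈ ys F)))
      (trans (cong (ℕ._+ Σ∈ ys F) (ℕP.+-comm (F x) (F y))) (ℕP.+-assoc (F y) (F x) (Σ∈ ys F))))
  Σ∈-↭ (Perm.trans p q) F = trans (Σ∈-↭ p F) (Σ∈-↭ q F)

  length-filter : ∀ {Q : A → Set} (Q? : ∀ x → Dec (Q x)) xs →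
    length (filter Q? xs) ≡ Σ∈ xs (λ x → indicator (Q? x))
  length-filter Q? []       = refl
  length-filter Q? (x ∷ xs) with Q? x
  ... | yes _ = cong suc (length-filter Q? xs)
  ... | no  _ = length-filter Q? xs

  Σ∈-one : ∀ (xs : List A) → Σ∈ xs (λ _ → 1) ≡ length xs
  Σ∈-one []       = refl
  Σ∈-one (x ∷ xs) = cong suc (Σ∈-one xs)

module _ {A B : Set} where
  Σ∈-map : ∀ (f : A → B) xs (F : B → ℕ) → Σ∈ (map f xs) F ≡ Σ∈ xs (F ∘ f)
  Σ∈-map f []       F = refl
  Σ∈-map f (x ∷ xs) F = cong (F (f x) ℕ.+_) (Σ∈-map f xs F)

  Σ∈-concatMap : ∀ (f : A → List B) xs (F : B → ℕ) → Σ∈ (concatMap f xs) F ≡ Σ∈ xs (λ x → Σ∈ (f x) F)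
  Σ∈-concatMap f []       F = refl
  Σ∈-concatMap f (x ∷ xs) F =
    trans (Σ∈-++ (f x) (concatMap f xs) F) (cong (Σ∈ (f x) F ℕ.+_) (Σ∈-concatMap f xs F))

module _ {A B : Set} where
  Σ∈-product : ∀ (xs : List A) (ys : List B) (F : A × B → ℕ) →
    Σ∈ (cartesianProduct xs ys) F ≡ Σ∈ xs (λ x → Σ∈ ys (λ y → F (x , y)))
  Σ∈-product []       ys F = refl
  Σ∈-product (x ∷ xs) ys F =
    trans (Σ∈-++ (map (x ,_) ys) (cartesianProduct xs ys) F)
      (cong₂ ℕ._+_ (Σ∈-map (x ,_) ys F) (Σ∈-product xs ys F))

Σ∈-upTo : ∀ s F → Σ∈ (upTo s) F ≡ Σ< s F
Σ∈-upTo zero    F = refl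
Σ∈-upTo (suc s) F = trans (cong (λ xs → Σ∈ xs F) (sym (ListP.upTo-∷ʳ s)))
  (trans (Σ∈-++ (upTo s) (s ∷ []) F)
    (trans (ℕP.+-comm (Σ∈ (upTo s) F) (F s ℕ.+ 0)) (cong₂ ℕ._+_ (ℕP.+-identityʳ (F s)) (Σ∈-upTo s F))))

Σ<-extend : ∀ g s F → (∀ u → s ℕ.≤ u → u ℕ.< g ℕ.+ s → F u ≡ 0) → Σ< (g ℕ.+ s) F ≡ Σ< s F
Σ<-extend zero    s F _ = refl
Σ<-extend (suc g) s F z =
  cong₂ ℕ._+_ (z (g ℕ.+ s) (ℕP.m≤n+m s g) ℕP.≤-refl)
    (Σ<-extend g s F (λ u s≤u u< → z u s≤u (ℕP.m<n⇒m<1+n u<)))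

module _ {n k : ℕ} (Γ : PeriodicPath n k) (T : Filling) where
  open PeriodicPath Γ
  open Geometry Γ

  ElbowIn : ℤ → ℤ → Set
  ElbowIn = Labels.Elbow n p (λ a b → T (Box a b))

  elbowIn? : ∀ a b → Dec (ElbowIn a b)
  elbowIn? = Labels.elbow? n p (λ a b → T (Box a b))

  elbowAt? : ∀ a b → Dec (p a ≡ R × T b ≡ elbow)
  elbowAt? a b = (p a ≟ˢ R) ×-dec (T b ≟ₜ elbow)

  -- The boxes above step a are counted by their heights and by the labels of their rows.
  column-labels : ∀ a →
    Σ< k (λ h → indicator (elbowAt? a ((X (a - 1ℤ) , Y (a - 1ℤ)) ⊕ (0ℤ , + h)))) ≡ Σ< n
      (λ t → indicator (elbowIn? a (a + + t)))
  column-labels a = climb n k (Y-periodic (a - 1ℤ))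
    where
    heights : ℕ → ℕ
    heights h = Σ< h (λ h → indicator (elbowAt? a ((X (a - 1ℤ) , Y (a - 1ℤ)) ⊕ (0ℤ , + h))))
    -- Both counts grow together: a U-step accounts for one more height and one more label, an
    -- R-step for no height and a vanishing term.
    climb : ∀ t h → Y (a - 1ℤ + + t) ≡ Y (a - 1ℤ) + + h →
      heights h ≡ Σ< t (λ t → indicator (elbowIn? a (a + + t)))
    climb zero zero eq = refl
    climb zero (suc h) eq = ⊥-elim (ℤP.<-irrefl (trans (cong Y (sym (ℤP.+-identityʳ (a - 1ℤ)))) eq)
      (lin< (+≤+ {0} {h} ℕ.z≤n)
        (((∀ y h → y + (1ℤ + h) - (y + 1ℤ) ≡ h - 0ℤ) ∋ solve-∀) (Y (a - 1ℤ)) (+ h))))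
    climb (suc t) h eq = go (step-cases (p l)) h (trans (cong Y l≡) eq)
      where
      l = a + + t
      l≡ : l ≡ a - 1ℤ + + suc t
      l≡ = ((∀ a t → a + t ≡ a - 1ℤ + (1ℤ + t)) ∋ solve-∀) a (+ t)
      l-1 : l - 1ℤ ≡ a - 1ℤ + + t
      l-1 = ((∀ a t → a + t - 1ℤ ≡ a - 1ℤ + t) ∋ solve-∀) a (+ t)
      go : p l ≡ R ⊎ p l ≡ U → ∀ h → Y l ≡ Y (a - 1ℤ) + + h →
        heights h ≡ indicator (elbowIn? a l) ℕ.+ Σ< t (λ t → indicator (elbowIn? a (a + + t)))
      go (inj₁ r) h eq = trans (climb t h (trans (cong Y (sym l-1)) (trans (sym (Y-R r)) eq)))
        (cong (ℕ._+ Σ< t (λ t → indicator (elbowIn? a (a + + t))))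
          (sym (indicator-no (elbowIn? a l) (λ e → R≢U r (proj₁ (proj₂ e))))))
      go (inj₂ u) zero eq = ⊥-elim (ℤP.<-irrefl (trans (sym (ℤP.+-identityʳ (Y (a - 1ℤ)))) (sym eq))
        (ℤP.≤-<-trans (Y-mono (subst (a - 1ℤ ≤ᶻ_) (sym l-1) (ℤP.i≤i+j (a - 1ℤ) (+ t))))
          (Y-strict u ℤP.≤-refl)))
      go (inj₂ u) (suc h) eq = cong₂ ℕ._+_
        (indicator-cong (elbowAt? a _) (elbowIn? a l)
          (λ { (r , e) → r , u , trans (cong T (sym box)) e })
            (λ { (r , _ , e) → r , trans (cong T box) e }))
        (climb t h (trans (cong Y (sym l-1)) Yl-1))
        where
        Yl-1 : Y (l - 1ℤ) ≡ Y (a - 1ℤ) + + h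
        Yl-1 = trans (sym (z+d-d (Y (l - 1ℤ)) 1ℤ))
          (trans (cong (_- 1ℤ) (trans (sym (Y-U u)) eq))
            (((∀ y h → y + (1ℤ + h) - 1ℤ ≡ y + h) ∋ solve-∀) (Y (a - 1ℤ)) (+ h)))
        box : (X (a - 1ℤ) , Y (a - 1ℤ)) ⊕ (0ℤ , + h) ≡ Box a l
        box = cong₂ _,_ (ℤP.+-identityʳ (X (a - 1ℤ))) (sym Yl-1)

module _ {n k} {Γ : PeriodicPath n k} {T m q E} (ρ : Realization Γ T m q E) where
  open PeriodicPath Γ
  open Geometry Γ
  open Realization ρ
  open Realized ρ using (gap; φ-mono; φ-injective)
  open Labels m q E

  -- By `elbow-In`, an elbow in a column of the realization is in one of its rows, so the labels
  -- strictly between consecutive values of `φ` contribute nothing.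
  column-restrict : ∀ z →
    Σ< n (λ t → indicator (elbowIn? Γ T (φ z) (φ z + + t))) ≡ Σ< m (λ s → indicator (elbow? z (z + + s)))
  column-restrict z = climb m n ℕP.≤-refl (φ-periodic z)
    where
    F : ℕ → ℕ
    F t = indicator (elbowIn? Γ T (φ z) (φ z + + t))
    agree : ∀ s t → φ (z + + s) ≡ φ z + + t → F t ≡ indicator (elbow? z (z + + s))
    agree s t eq = indicator-cong (elbowIn? Γ T (φ z) (φ z + + t)) (elbow? z (z + + s))
      (λ { (r , u , e) → let r′ = trans (q≡p z) r ; u′ = trans (q≡p (z + + s)) (trans (cong p eq) u) in
             r′ , u′ , trans (E≡T r′ u′) (trans (cong (T ∘ Box (φ z)) eq) e) })
      (λ { (r , u , e) → trans (sym (q≡p z)) r , trans (cong p (sym eq)) (trans (sym (q≡p (z + + s))) u) ,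
             trans (cong (T ∘ Box (φ z)) (sym eq)) (trans (sym (E≡T r u)) e) })
    climb : ∀ s t → s ℕ.≤ m → φ (z + + s) ≡ φ z + + t → Σ< t F ≡ Σ< s (λ s → indicator (elbow? z (z + + s)))
    climb zero zero _ _ = refl
    climb zero (suc t) _ eq = ⊥-elim (ℤP.<-irrefl (trans (cong φ (sym (ℤP.+-identityʳ z))) eq)
      (lin< (+≤+ {0} {t} ℕ.z≤n) (((∀ y h → y + (1ℤ + h) - (y + 1ℤ) ≡ h - 0ℤ) ∋ solve-∀) (φ z) (+ t))))
    climb (suc s) t s<m eq with ≤⇒distance (φ-mono (ℤP.i≤i+j z (+ s)))
    ... | t′ , eq′ with ℕP.m≤n⇒∃[o]m+o≡n {suc t′} {t} (ℤP.drop‿+<+ t′<t)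
      where
      t′<t : + t′ <ᶻ + t
      t′<t = lin< (<⇒+1≤ (subst₂ _<ᶻ_ eq′ eq (φ-increasing (ℤP.+-monoʳ-< z (+<+ (ℕP.n<1+n s))))))
        (((∀ y t′ t → t - (t′ + 1ℤ) ≡ y + t - (y + t′ + 1ℤ)) ∋ solve-∀) (φ z) (+ t′) (+ t))
    ... | g , refl = trans (cong (λ w → Σ< w F) (ℕP.+-comm (suc t′) g))
        (trans (Σ<-extend g (suc t′) F outside)
      (cong₂ ℕ._+_ (agree s t′ eq′) (climb s t′ (ℕP.<⇒≤ s<m) eq′)))
      where
      outside : ∀ u → suc t′ ℕ.≤ u → u ℕ.< g ℕ.+ suc t′ → F u ≡ 0
      outside u t′<u u<t = indicator-no (elbowIn? Γ T (φ z) (φ z + + u))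
        (λ { (r , uu , e) → gap {z + + s} {φ z + + u}
          (subst (_<ᶻ φ z + + u) (sym eq′) (ℤP.+-monoʳ-< (φ z) (+<+ t′<u)))
          (subst (φ z + + u <ᶻ_)
            (sym (trans (cong φ (((∀ z s → z + s + 1ℤ ≡ z + (1ℤ + s)) ∋ solve-∀) z (+ s))) eq)) u<)
          (proj₁ (elbow-In r uu
             (lin< (+≤+ (ℕP.≤-trans (ℕ.s≤s ℕ.z≤n) t′<u))
               (((∀ y u → y + u - (y + 1ℤ) ≡ u - 1ℤ) ∋ solve-∀) (φ z) (+ u)))
             (ℤP.<-≤-trans u< (subst₂ _≤ᶻ_ eq (φ-periodic z) (φ-mono (ℤP.+-monoʳ-≤ z (+≤+ s<m))))) e)
               (z , refl)) })
        where
        u< : φ z + + u <ᶻ φ z + + (suc t′ ℕ.+ g)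
        u< = ℤP.+-monoʳ-< (φ z) (+<+ (subst (u ℕ.<_) (ℕP.+-comm g (suc t′)) u<t))

-- The extended lattice path

module _ {n : ℕ} .{{_ : NonZero n}} (P : Path n) where

  private
    vertex-suc : ∀ i → vertex P (i + 1ℤ) ≡ vertex P i ⊕ direction (step P (i + 1ℤ))
    vertex-suc (+ m) rewrite ℕP.+-comm m 1 = refl
    vertex-suc -[1+ zero ] =
      sym (cong₂ _,_ (z-d+d 0ℤ (proj₁ (direction (step P 0ℤ)))) (z-d+d 0ℤ (proj₂ (direction (step P 0ℤ)))))
    vertex-suc -[1+ suc m ] =
      sym (cong₂ _,_ (z-d+d (proj₁ (backward P (suc m))) (proj₁ (direction (step P -[1+ m ]))))
                                             (z-d+d (proj₂ (backward P (suc m)))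
                                               (proj₂ (direction (step P -[1+ m ])))))

    vertex-pred : ∀ l → vertex P l ≡ vertex P (l - 1ℤ) ⊕ direction (step P l)
    vertex-pred l = subst (λ i → vertex P i ≡ vertex P (l - 1ℤ) ⊕ direction (step P i)) (z-d+d l 1ℤ)
      (vertex-suc (l - 1ℤ))

  height : ℤ → ℤ
  height l = proj₂ (vertex P l)

  height-R : ∀ {l} → step P l ≡ R → height l ≡ height (l - 1ℤ)
  height-R {l} r = trans (cong proj₂ (vertex-pred l))
    (trans (cong (λ s → height (l - 1ℤ) + proj₂ (direction s)) r) (ℤP.+-identityʳ _))

  height-U : ∀ {l} → step P l ≡ U → height l ≡ height (l - 1ℤ) + 1ℤ
  height-U {l} u = trans (cong proj₂ (vertex-pred l)) (cong (λ s → height (l - 1ℤ) + proj₂ (direction s)) u)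

  -- After `n` unit steps the two coordinates sum to `n`, so the height fixes the endpoint.
  height⇒𝒫 : ∀ k → height (+ n) ≡ + k → P ∈ 𝒫 k n
  height⇒𝒫 k eq = cong₂ _,_
    (trans (((∀ x y → x ≡ x + y - y) ∋ solve-∀) (proj₁ (forward P n)) (height (+ n)))
    (cong₂ _-_ (coordinates n) eq)) eq
    where
    coordinates : ∀ m → proj₁ (forward P m) + proj₂ (forward P m) ≡ + m
    coordinates zero = refl
    coordinates (suc m) =
      trans (((∀ x y a b → x + a + (y + b) ≡ a + b + (x + y)) ∋ solve-∀) (proj₁ (forward P m))
        (proj₂ (forward P m)) (proj₁ (direction (step P (+ suc m)))) (proj₂ (direction (step P (+ suc m)))))
      (cong₂ _+_ (unit (step P (+ suc m))) (coordinates m))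
      where
      unit : ∀ s → proj₁ (direction s) + proj₂ (direction s) ≡ 1ℤ
      unit R = refl
      unit U = refl

  private
    module _ (k : ℕ) (P∈ : P ∈ 𝒫 k n) where
      step-periodic : ∀ l → step P (l + + n) ≡ step P l
      step-periodic l = cong P (res-+n n l)

      vertex-periodic : ∀ l → vertex P (l + + n) ≡ vertex P l ⊕ (+ n - + k , + k)
      vertex-periodic = ℤ-induction (λ l → vertex P (l + + n) ≡ vertex P l ⊕ (+ n - + k , + k))
        (trans P∈ (sym (cong₂ _,_ (ℤP.+-identityˡ (+ n - + k)) (ℤP.+-identityˡ (+ k)))))
        (λ l H → trans (after l)
          (trans (cong (_⊕ d l) H)
            (trans (shuffle (vertex P l) (+ n - + k , + k) (d l))
              (cong (_⊕ (+ n - + k , + k)) (sym (vertex-suc l))))))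
        (λ l H → cancel (d l)
          (trans (sym (after l))
            (trans H (trans (cong (_⊕ (+ n - + k , + k)) (vertex-suc l))
              (sym (shuffle (vertex P l) (+ n - + k , + k) (d l)))))))
        where
        d : ℤ → Point
        d l = direction (step P (l + 1ℤ))
        swap : ∀ l n → l + 1ℤ + n ≡ l + n + 1ℤ
        swap = solve-∀
        after : ∀ l → vertex P (l + 1ℤ + + n) ≡ vertex P (l + + n) ⊕ d l
        after l = trans (cong (vertex P) (swap l (+ n))) (trans (vertex-suc (l + + n))
          (cong (λ s → vertex P (l + + n) ⊕ direction s)
            (trans (cong (step P) (sym (swap l (+ n)))) (step-periodic (l + 1ℤ)))))
        shuffle : ∀ a b c → a ⊕ b ⊕ c ≡ a ⊕ c ⊕ b
        shuffle (x , y) (x′ , y′) (x″ , y″) = cong₂ _,_ (exchange x x′ x″) (exchange y y′ y″)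
          where
          exchange : ∀ a b c → a + b + c ≡ a + c + b
          exchange = solve-∀
        cancel : ∀ c {a b} → a ⊕ c ≡ b ⊕ c → a ≡ b
        cancel (x , y) {a} {b} eq =
          cong₂ _,_ (cancel-+ (proj₁ a) (proj₁ b) x (cong proj₁ eq))
            (cancel-+ (proj₂ a) (proj₂ b) y (cong proj₂ eq))
          where
          cancel-+ : ∀ a b c → a + c ≡ b + c → a ≡ b
          cancel-+ a b c eq = trans (sym (z+d-d a c)) (trans (cong (_- c) eq) (z+d-d b c))

  periodicPath : ∀ {k} → P ∈ 𝒫 k n → PeriodicPath n k
  periodicPath {k} P∈ = record
    { p           = step P
    ; X           = λ l → proj₁ (vertex P l)
    ; Y           = height
    ; vertex-step = vertex-pred
    ; p-periodic  = step-periodic k P∈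
    ; X-periodic  = λ l → cong proj₁ (vertex-periodic k P∈ l)
    ; Y-periodic  = λ l → cong proj₂ (vertex-periodic k P∈ l)
    }

-- The elbow graph and its components

module _ (m : ℕ) .{{_ : NonZero m}} (q : ℤ → Step) (E : ℤ → ℤ → Tile) where
  open Labels m q E

  elbowPositions : List (Fin m × ℕ)
  elbowPositions = filter (λ it → elbow? (rep (proj₁ it)) (rep (proj₁ it) + + proj₂ it))
    (cartesianProduct (allFin m) (upTo m))

  elbowCount : ℕ
  elbowCount = Σ∈ (allFin m) (λ i → Σ< m (λ t → indicator (elbow? (rep i) (rep i + + t))))

  -- Each elbow joins the two wires through its box, taken modulo m.
  elbowGraph : List (Fin m × Fin m)
  elbowGraph = map (λ it → proj₁ it , res m (rep (proj₁ it) + + proj₂ it)) elbowPositions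

  length-elbowGraph : length elbowGraph ≡ elbowCount
  length-elbowGraph = trans (ListP.length-map _ elbowPositions)
    (trans (length-filter (λ it → elbow? (rep (proj₁ it)) (rep (proj₁ it) + + proj₂ it))
      (cartesianProduct (allFin m) (upTo m)))
      (trans (Σ∈-product (allFin m) (upTo m)
        (λ it → indicator (elbow? (rep (proj₁ it)) (rep (proj₁ it) + + proj₂ it))))
        (Σ∈-cong (allFin m) (λ i → Σ∈-upTo m (λ t → indicator (elbow? (rep i) (rep i + + t)))))))

  module _ (q-periodic : ∀ l → q (l + + m) ≡ q l)
           (E-periodic : ∀ {a b} → q a ≡ R → q b ≡ U → a <ᶻ b → b <ᶻ a + + m →
             E (a + + m) (b + + m) ≡ E a b) where

    private
      elbow-rep : ∀ {z t} → 0 ℕ.< t → t ℕ.< m → Elbow z (z + + t) →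
        Elbow (rep (res m z)) (rep (res m z) + + t)
      elbow-rep {z} {t} 0<t t<m el =
        subst (λ w → Elbow w (w + + t)) (sym rep≡)
          (shift-all (λ i → Elbow i (i + + t)) (+ m) up down (- quot m z) z el)
        where
        rep≡ : rep (res m z) ≡ z + - quot m z * + m
        rep≡ = trans (((∀ r q m → r ≡ r + q * m + (- q) * m) ∋ solve-∀) (rep (res m z)) (quot m z) (+ m))
          (cong (_+ - quot m z * + m) (sym (rep-res-quot m z)))
        swap : ∀ i → i + + m + + t ≡ i + + t + + m
        swap i = ((∀ i m t → i + m + t ≡ i + t + m) ∋ solve-∀) i (+ m) (+ t)
        lo : ∀ i → i <ᶻ i + + t
        lo i = lin< (+≤+ 0<t) (((∀ i t → i + t - (i + 1ℤ) ≡ t - 1ℤ) ∋ solve-∀) i (+ t))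
        up : ∀ i → Elbow i (i + + t) → Elbow (i + + m) (i + + m + + t)
        up i (r , u , e) = trans (q-periodic i) r , trans (cong q (swap i)) (trans (q-periodic (i + + t)) u)
          ,
          trans (cong (E (i + + m)) (swap i)) (trans (E-periodic r u (lo i) (ℤP.+-monoʳ-< i (+<+ t<m))) e)
        down : ∀ i → Elbow (i + + m) (i + + m + + t) → Elbow i (i + + t)
        down i (r , u , e) = r′ , u′ , trans (sym (E-periodic r′ u′ (lo i) (ℤP.+-monoʳ-< i (+<+ t<m))))
          (trans (cong (E (i + + m)) (sym (swap i))) e)
          where
          r′ = trans (sym (q-periodic i)) r
          u′ = trans (sym (q-periodic (i + + t))) (trans (cong q (sym (swap i))) u)

    elbow-∈ : ∀ {a b} → a <ᶻ b → b <ᶻ a + + m → Elbow a b → (res m a , res m b) ∈ₗ elbowGraph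
    elbow-∈ {a} {b} a<b b<a+m el with ≤⇒distance (ℤP.<⇒≤ a<b)
    ... | t , refl = subst (λ j → (res m a , j) ∈ₗ elbowGraph) res≡
      (∈-map⁺ (λ it → proj₁ it , res m (rep (proj₁ it) + + proj₂ it))
        (∈-filter⁺ (λ it → elbow? (rep (proj₁ it)) (rep (proj₁ it) + + proj₂ it))
          (∈-cartesianProduct⁺ (∈-allFin (res m a)) (∈-upTo⁺ t<m)) (elbow-rep {a} {t} 0<t t<m el)))
      where
      0<t : 0 ℕ.< t
      0<t = ℤP.drop‿+<+ (lin< (<⇒+1≤ a<b) (((∀ a t → t - (0ℤ + 1ℤ) ≡ a + t - (a + 1ℤ)) ∋ solve-∀) a (+ t)))
      t<m : t ℕ.< m
      t<m = ℤP.drop‿+<+ (lin< (<⇒+1≤ b<a+m)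
        (((∀ a t m → m - (t + 1ℤ) ≡ a + m - (a + t + 1ℤ)) ∋ solve-∀) a (+ t) (+ m)))
      res≡ : res m (rep (res m a) + + t) ≡ res m (a + + t)
      res≡ = trans (sym (res-shift m (rep (res m a) + + t) (quot m a)))
        (cong (res m) (trans (((∀ r t w → r + t + w ≡ r + w + t) ∋ solve-∀) (rep (res m a)) (+ t)
          (quot m a * + m)) (cong (_+ + t) (sym (rep-res-quot m a)))))

    module _ {comp : Fin m → Fin m} (resp : All (Respects comp) elbowGraph) where

      private
        along-elbow : ∀ {e z} → e ℕ.< m → Elbow z (z + δ e) → comp (res m z) ≡ comp (res m (z + δ e))
        along-elbow {e} {z} e<m el with elbow-range q-periodic E-periodic {e} {z} e<m (proj₁ el)
          (proj₁ (proj₂ el))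
        ... | lo , hi = All.lookup resp (elbow-∈ lo hi el)

        comp-τ : ∀ {e} → e ℕ.< m → ∀ z → comp (res m (τ (δ e) z)) ≡ comp (res m z)
        comp-τ {e} e<m z with turn (δ e) z
        ... | _ , stay _ _ = refl
        ... | _ , forth el = sym (along-elbow e<m el)
        ... | _ , back el  = trans
            (along-elbow {e} {z - δ e} e<m (subst (Elbow (z - δ e)) (sym (z-d+d z (δ e))) el))
              (cong (comp ∘ res m) (z-d+d z (δ e)))

        res-start : ∀ s z → res m (start s z) ≡ res m z
        res-start R z = refl
        res-start U z = trans (sym (res-+n m (z - + m))) (cong (res m) (z-d+d z (+ m)))

      comp-D : ∀ {e} → e ℕ.≤ m → ∀ z → comp (res m (D e z)) ≡ comp (res m z)
      comp-D {zero}  _   z = cong comp (res-start (q z) z)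
      comp-D {suc e} e<m z = trans (comp-D (ℕP.<⇒≤ e<m) (τ (δ e) z)) (comp-τ e<m z)

      comp-orbit : ∀ {g} → (∀ z → D m (g z) ≡ z) → ∀ {x y} → Reach (reduce m g) x y → comp x ≡ comp y
      comp-orbit {g} Dg {x} (t , refl) = go t
        where
        once : ∀ x → comp (reduce m g x) ≡ comp x
        once x = trans (sym (comp-D ℕP.≤-refl (g (rep x))))
          (trans (cong (comp ∘ res m) (Dg (rep x))) (cong comp (res-rep m x)))
        go : ∀ t → comp x ≡ comp (fold x (reduce m g) t)
        go zero    = refl
        go (suc t) = trans (go t) (sym (once (fold x (reduce m g) t)))

-- Deograms in terms of label tilings

identityRealization : ∀ {n k} (Γ : PeriodicPath n k) (T : Filling) {q : ℤ → Step} {E : ℤ → ℤ → Tile} →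
  let open PeriodicPath Γ ; open Geometry Γ in
  (∀ z → q z ≡ p z) → (∀ {a b} → q a ≡ R → q b ≡ U → E a b ≡ T (Box a b)) → Realization Γ T n q E
identityRealization Γ T q≡p E≡T = record
  { φ            = id
  ; φ-increasing = id
  ; φ-periodic   = λ _ → refl
  ; q≡p          = q≡p
  ; E≡T          = E≡T
  ; elbow-In     = λ {a} {b} _ _ _ _ _ → (λ _ → b , refl) , (λ _ → a , refl)
  }

-- The box `(a , a + δ e)` is entered from the top along wire `a` and from the left along wire
-- `a + δ e`; the histories `H e` contain what these two strands have visited before it.
LabelDistinguished : (m : ℕ) (q : ℤ → Step) (E : ℤ → ℤ → Tile) → Set
LabelDistinguished m q E = ∀ e a → e ℕ.≤ m → q a ≡ R → q (a + δ e) ≡ U → a <ᶻ a + δ e → a + δ e <ᶻ a + + m →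
  E a (a + δ e) ≡ elbow → 2 ∣ labelCrossings (H e a) (H e (a + δ e))
  where open Labels m q E

stripElbows : ∀ {n k} → PeriodicPath n k → Filling → ℕ
stripElbows {n} Γ T = Σ∈ (allFin n) (λ i → Σ< n (λ t → indicator (elbowIn? Γ T (rep i) (rep i + + t))))

record StripDeogram {n k} (Γ : PeriodicPath n k) (T : Filling) (f : ℤ → ℤ) : Set where
  open PeriodicPath Γ
  open StripLabels Γ
  open StrandCrossings Γ T
  open Tiles T
  field
    periodic          : ∀ b → InStrip b → T (b ⊕ (+ n - + k , + k)) ≡ T b
    strandPermutation : ∀ i → ∃[ t ] walk (N i) t ≡ S (f i)
    distinguished     : ∀ b i s j t → InStrip b → T b ≡ elbow → walk (N i) s ≡ top b →
      walk (N j) t ≡ left b → 2 ∣ crossings i s j t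

periodic-Box : ∀ {n k} (Γ : PeriodicPath n k) {T f} → StripDeogram Γ T f → let open PeriodicPath Γ ; open Geometry Γ in
  ∀ {a b} → p a ≡ R → p b ≡ U → a <ᶻ b → b <ᶻ a + + n → T (Box (a + + n) (b + + n)) ≡ T (Box a b)
periodic-Box Γ {T} deo {a} {b} a-R b-U a<b b<a+n =
  trans (cong T (Box-+n a b)) (StripDeogram.periodic deo (Box a b) (labels-strip a-R b-U a<b b<a+n))
  where
  open StripLabels Γ
  open Geometry Γ

module DeogramRealized {n k} {Γ : PeriodicPath n k} {T m q E} (ρ : Realization Γ T m q E) where
  open PeriodicPath Γ
  open Geometry Γ
  open StripLabels Γ
  open StrandCrossings Γ T
  open Tiles T
  open Realization ρ
  open Realized ρ
  open Labels m q E

  labels⇒permutation : ∀ {g : ℤ → ℤ} → (∀ z → D m (g z) ≡ z) → ∀ z → ∃[ t ] walk (N (φ z)) t ≡ S (φ (g z))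
  labels⇒permutation {g} Dg z with reach-south (g z)
  ... | s , eq = s , trans (cong (λ w → walk (N (φ w)) s) (sym (Dg z))) eq

  labels⇒distinguished : LabelDistinguished m q E → ∀ {a b} → q a ≡ R → q b ≡ U → φ a <ᶻ φ b →
    φ b <ᶻ φ a + + n → T (Box (φ a) (φ b)) ≡ elbow →
    ∀ {i s j t} → walk (N i) s ≡ top (Box (φ a) (φ b)) → walk (N j) t ≡ left (Box (φ a) (φ b)) →
      2 ∣ crossings i s j t
  labels⇒distinguished dist {a} {b} r u φa<φb φb< el {i} {s} {j} {t} eqi eqj with ≤⇒distance
    (ℤP.<⇒≤ (φ-cancel-< φa<φb))
  -- The box `(a , a + d)` is on the antidiagonal `δ e = d`, that is, `e = m ∸ d`.
  ... | d , refl = subst (2 ∣_)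
      (sym (crossings-above {m ℕ.∸ d} {a} e≤m r u′ {i} {s} {j} {t}
        (trans eqi (cong (λ w → top (Box (φ a) (φ w))) b≡))
          (trans eqj (cong (λ w → left (Box (φ a) (φ w))) b≡))))
      (dist (m ℕ.∸ d) a e≤m r u′ (subst (a <ᶻ_) b≡ (φ-cancel-< φa<φb)) (subst (_<ᶻ a + + m) b≡ a+d<a+m)
        (trans (E≡T r u′) (trans (cong (λ w → T (Box (φ a) (φ w))) (sym b≡)) el)))
    where
    a+d<a+m : a + + d <ᶻ a + + m
    a+d<a+m = φ-cancel-< (subst (φ (a + + d) <ᶻ_) (sym (φ-periodic a)) φb<)
    d<m : d ℕ.< m
    d<m = ℤP.drop‿+<+ (lin< (<⇒+1≤ a+d<a+m)
      (((∀ a t m → m - (t + 1ℤ) ≡ a + m - (a + t + 1ℤ)) ∋ solve-∀) a (+ d) (+ m)))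
    e≤m : m ℕ.∸ d ℕ.≤ m
    e≤m = ℕP.m∸n≤m m d
    b≡ : a + + d ≡ a + δ (m ℕ.∸ d)
    b≡ = cong (_+_ a) (trans (((∀ d m → d ≡ m - (m - d)) ∋ solve-∀) (+ d) (+ m))
      (cong (λ w → + m - w) (trans (ℤP.m-n≡m⊖n m d) (ℤP.⊖-≥ (ℕP.<⇒≤ d<m)))))
    u′ : q (a + δ (m ℕ.∸ d)) ≡ U
    u′ = trans (cong q (sym b≡)) u

  module _ {f} (deo : StripDeogram Γ T f) where
    open StripDeogram deo

    -- Two strands end at the southern edge of `φ (g z)`: the one from `φ z`, by the strand
    -- permutation, and the one named by `D m (g z)`. They are the same by `walk-unique`.
    deogram⇒labels : ∀ {g : ℤ → ℤ} → (∀ z → φ (g z) ≡ f (φ z)) → ∀ z → D m (g z) ≡ z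
    deogram⇒labels {g} φg z with strandPermutation (φ z) | reach-south (g z)
    ... | t , eq | s , eq′ =
        φ-injective (proj₁ (walk-unique T (φ (D m (g z))) s (φ z) t
          (trans eq′ (trans (cong S (φg z)) (sym eq)))))

    deogram⇒distinguished : LabelDistinguished m q E
    deogram⇒distinguished e a e≤m r u a<b b<a+m el with reach-above {e} {a} e≤m r u
    ... | i , s , j , t , eqi , eqj = subst (2 ∣_) (crossings-above {e} {a} e≤m r u {i} {s} {j} {t} eqi eqj)
      (distinguished (Box (φ a) (φ (a + δ e))) i s j t
        (labels-strip (trans (sym (q≡p a)) r) (trans (sym (q≡p (a + δ e))) u) (φ-increasing a<b)
          (subst (φ (a + δ e) <ᶻ_) (φ-periodic a) (φ-increasing b<a+m)))
        (trans (sym (E≡T r u)) el) eqi eqj)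

    E-periodic : ∀ {a b} → q a ≡ R → q b ≡ U → a <ᶻ b → b <ᶻ a + + m → E (a + + m) (b + + m) ≡ E a b
    E-periodic {a} {b} a-R b-U a<b b<a+m = begin
      E (a + + m) (b + + m)                 ≡⟨ E≡T (trans (q-periodic a) a-R) (trans (q-periodic b) b-U) ⟩
      T (Box (φ (a + + m)) (φ (b + + m)))   ≡⟨ cong₂ (λ x y → T (Box x y)) (φ-periodic a) (φ-periodic b) ⟩
      T (Box (φ a + + n) (φ b + + n))       ≡⟨
        periodic-Box Γ deo (trans (sym (q≡p a)) a-R) (trans (sym (q≡p b)) b-U) (φ-increasing a<b)
          (subst (φ b <ᶻ_) (φ-periodic a) (φ-increasing b<a+m)) ⟩
      T (Box (φ a) (φ b))                   ≡⟨ E≡T a-R b-U ⟨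
      E a b                                 ∎
      where open ≡-Reasoning

-- The elbow graph of a Deogram with n - r elbows is a forest whose components are the
-- r cycles of its permutation.
deogram⇒monochromatic : ∀ {n k} .{{_ : NonZero n}} (Γ : PeriodicPath n k) {T f} → StripDeogram Γ T f →
  ∀ {r} (colour : Fin n → Fin r) → (∀ {x y} → colour x ≡ colour y → Reach (reduce n f) x y) →
    n ≡ r ℕ.+ stripElbows Γ T →
  let open PeriodicPath Γ ; open Geometry Γ in
  ∀ {a b} → p a ≡ R → p b ≡ U → a <ᶻ b → b <ᶻ a + + n → T (Box a b) ≡ elbow →
    colour (res n a) ≡ colour (res n b)
deogram⇒monochromatic {n} Γ {T} {f} deo {r} colour reach n≡ a-R b-U a<b b<a+n el =
  All.lookup (monochromatic colour (elbowGraph n p E) connected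
    (trans n≡ (cong (r ℕ.+_) (sym (length-elbowGraph n p E)))))
    (elbow-∈ n p E p-periodic (periodic-Box Γ deo) a<b b<a+n (a-R , b-U , el))
  where
  open PeriodicPath Γ
  open Geometry Γ
  E : ℤ → ℤ → Tile
  E a b = T (Box a b)
  connected : ∀ comp → All (Respects comp) (elbowGraph n p E) → ∀ {x y} → colour x ≡ colour y →
    comp x ≡ comp y
  connected comp resp eq = comp-orbit n p E p-periodic (periodic-Box Γ deo) resp {g = f}
    (DeogramRealized.deogram⇒labels (identityRealization Γ T (λ _ → refl) (λ _ _ → refl)) deo (λ _ → refl))
      (reach eq)

-- The case of a single colour: a permutation with one orbit makes the elbow graph connected, and a
-- connected graph on `n` vertices has at least `n - 1` edges.
transitive⇒elbows : ∀ {n k} .{{_ : NonZero n}} (Γ : PeriodicPath n k) {T f} → StripDeogram Γ T f →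
  (∀ x y → Reach (reduce n f) x y) → n ℕ.≤ 1 ℕ.+ stripElbows Γ T
transitive⇒elbows {n} Γ {T} {f} deo reach = subst (λ w → n ℕ.≤ 1 ℕ.+ w) (length-elbowGraph n p E)
  (edges-bound {r = 1} (λ _ → Fin.zero) (elbowGraph n p E)
    (λ comp resp {x} {y} _ → comp-orbit n p E p-periodic (periodic-Box Γ deo) resp {g = f}
    (DeogramRealized.deogram⇒labels (identityRealization Γ T (λ _ → refl) (λ _ _ → refl)) deo (λ _ → refl))
      (reach x y)))
  where
  open PeriodicPath Γ
  open Geometry Γ
  E : ℤ → ℤ → Tile
  E a b = T (Box a b)

module _ {n k} .{{_ : NonZero n}} {P : Path n} (P∈ : P ∈ 𝒫 k n) (T : Filling) where
  private Γ = periodicPath P P∈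
  open StrandCrossings Γ T

  #elbows≡ : #elbows k P T ≡ stripElbows Γ T
  #elbows≡ = trans (length-filter (elbowAbove? k P T) (cartesianProduct (allFin n) (upTo k)))
    (trans (Σ∈-product (allFin n) (upTo k) (λ ih → indicator (elbowAbove? k P T ih)))
      (Σ∈-cong (allFin n) (λ i → trans (Σ∈-upTo k (λ h → indicator (elbowAbove? k P T (i , h))))
        (trans (Σ<-cong k (λ h _ →
          indicator-cong (elbowAbove? k P T (i , h)) (elbowAt? Γ T (rep i) (boxAbove P (rep i) h))
          (λ { (r , e) → trans (cong P (res-rep n i)) r , e })
            (λ { (r , e) → trans (cong P (sym (res-rep n i))) r , e })))
          (column-labels Γ T (rep i))))))

  #crossings≡ : ∀ i s j t → #crossings k P T i s j t ≡ crossings i s j t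
  #crossings≡ i s j t = trans (length-filter (crossAt? k P T i j) (cartesianProduct (upTo s) (upTo t)))
    (trans (Σ∈-product (upTo s) (upTo t) (λ st → indicator (crossAt? k P T i j st)))
      (trans (Σ∈-upTo s (λ u → Σ∈ (upTo t) (λ v → indicator (crossAt? k P T i j (u , v)))))
        (Σ<-cong s (λ u _ → Σ∈-upTo t (λ v → indicator (crossAt? k P T i j (u , v)))))))

  fromDeogram : ∀ {f} → IsDeogram k P T f → StripDeogram Γ T f
  fromDeogram deo = record
    { periodic          = periodic
    ; strandPermutation = strandPermutation
    ; distinguished     = λ b i s j t b∈ el eqi eqj →
      subst (2 ∣_) (#crossings≡ i s j t) (distinguished b i s j t b∈ el eqi eqj)
    }
    where open IsDeogram deo

  toDeogram : ∀ {f} → StripDeogram Γ T f → IsDeogram k P T f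
  toDeogram deo = record
    { periodic          = periodic
    ; strandPermutation = strandPermutation
    ; distinguished     = λ b i s j t b∈ el eqi eqj →
      subst (2 ∣_) (sym (#crossings≡ i s j t)) (distinguished b i s j t b∈ el eqi eqj)
    }
    where open StripDeogram deo

-- Restriction to colours and superposition

Σ∈-tight : ∀ {A : Set} (xs : List A) {F G : A → ℕ} → (∀ x → F x ℕ.≤ G x) → Σ∈ xs F ≡ Σ∈ xs G → ∀ {x} →
  x ∈ₗ xs → F x ≡ G x
Σ∈-tight (y ∷ ys) {F} {G} F≤G eq = λ
  { (here refl) → head≡ ; (there x∈) →
    Σ∈-tight ys F≤G (ℕP.+-cancelˡ-≡ (F y) (Σ∈ ys F) (Σ∈ ys G) (trans eq (cong (ℕ._+ Σ∈ ys G) (sym head≡))))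
      x∈ }
  where
  Σ≤ : ∀ ys → Σ∈ ys F ℕ.≤ Σ∈ ys G
  Σ≤ []       = ℕ.z≤n
  Σ≤ (y ∷ ys) = ℕP.+-mono-≤ (F≤G y) (Σ≤ ys)
  head≡ : F y ≡ G y
  head≡ = ℕP.≤-antisym (F≤G y) (ℕP.+-cancelʳ-≤ (Σ∈ ys F) (G y) (F y)
    (ℕP.≤-trans (ℕP.+-monoʳ-≤ (G y) (Σ≤ ys)) (ℕP.≤-reflexive (sym eq))))

colourRealization : ∀ {n k r} (Γ : PeriodicPath n k) (T : Filling) {col : ℤ → Fin r} → let open PeriodicPath Γ ; open Geometry Γ in
  (∀ {a b} → p a ≡ R → p b ≡ U → a <ᶻ b → b <ᶻ a + + n → T (Box a b) ≡ elbow → col a ≡ col b) →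
  ∀ {c m} (φ ψ : ℤ → ℤ) → (∀ {a b} → a <ᶻ b → φ a <ᶻ φ b) → (∀ z → φ (z + + m) ≡ φ z + + n) →
  (∀ z → col (φ z) ≡ c) → (∀ {x} → col x ≡ c → φ (ψ x) ≡ x) → ∀ {q} → (∀ z → q z ≡ p (φ z)) →
  Realization Γ T m q (λ a b → T (Box (φ a) (φ b)))
colourRealization Γ T mono φ ψ φ-increasing φ-periodic col-φ φ-ψ q≡p = record
  { φ            = φ
  ; φ-increasing = φ-increasing
  ; φ-periodic   = φ-periodic
  ; q≡p          = q≡p
  ; E≡T          = λ _ _ → refl
  ; elbow-In     = λ {a} {b} a-R b-U a<b b<a+n el → let eq = mono a-R b-U a<b b<a+n el in
      (λ { (z , refl) → ψ b , φ-ψ (trans (sym eq) (col-φ z)) }) ,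
      (λ { (z , refl) → ψ a , φ-ψ (trans eq (col-φ z)) })
  }

-- The strip of Γ together with a colouring of its columns and rows; the columns and rows
-- of colour c, listed in order by φ c, form the strip of Γ| c.
record Colouring {n k : ℕ} (Γ : PeriodicPath n k) (f : ℤ → ℤ) (r : ℕ) : Set where
  open PeriodicPath Γ
  field
    m k|         : Fin r → ℕ
    {{m-nonZero}} : ∀ {c} → NonZero (m c)
    Γ|           : ∀ c → PeriodicPath (m c) (k| c)
    f|           : Fin r → ℤ → ℤ
    col          : ℤ → Fin r
    φ ψ          : Fin r → ℤ → ℤ
    col-+n       : ∀ x → col (x + + n) ≡ col x
    col-φ        : ∀ c z → col (φ c z) ≡ c
    φ-ψ          : ∀ {c x} → col x ≡ c → φ c (ψ c x) ≡ x
    ψ-φ          : ∀ c z → ψ c (φ c z) ≡ z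
    φ-increasing : ∀ c {a b} → a <ᶻ b → φ c a <ᶻ φ c b
    φ-periodic   : ∀ c z → φ c (z + + m c) ≡ φ c z + + n
    φ-f|         : ∀ c z → φ c (f| c z) ≡ f (φ c z)
    p-φ          : ∀ c z → p (φ c z) ≡ PeriodicPath.p (Γ| c) z
    by-colour    : ∀ (F : ℤ → ℕ) →
      Σ∈ (allFin n) (F ∘ rep) ≡ Σ∈ (allFin r) (λ c → Σ∈ (allFin (m c)) (F ∘ φ c ∘ rep))
    f|-transitive : ∀ c i j → Reach (reduce (m c) (f| c)) i j

module Gluing {n k r} .{{_ : NonZero n}} {Γ : PeriodicPath n k} {f : ℤ → ℤ} (C : Colouring Γ f r) where
  open Colouring C
  open PeriodicPath Γ
  open Geometry Γ
  open StripLabels Γ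

  private
    module M (c : Fin r) = Increasing {φ c} (φ-increasing c)
    module G (c : Fin r) = Geometry (Γ| c)
    module L (c : Fin r) = StripLabels (Γ| c)

  q : Fin r → ℤ → Step
  q c = PeriodicPath.p (Γ| c)

  private
    in-period : ∀ c {a b} → b <ᶻ a + + m c → φ c b <ᶻ φ c a + + n
    in-period c {a} {b} b<a+m = subst (φ c b <ᶻ_) (φ-periodic c a) (φ-increasing c b<a+m)

    in-period⁻¹ : ∀ c {a b} → φ c b <ᶻ φ c a + + n → b <ᶻ a + + m c
    in-period⁻¹ c {a} {b} lt = M.φ-cancel-< c (subst (φ c b <ᶻ_) (sym (φ-periodic c a)) lt)

  BoxIn : ℤ → ℤ → Set
  BoxIn a b = p a ≡ R × p b ≡ U × a <ᶻ b × b <ᶻ a + + n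

  BoxIn| : Fin r → ℤ → ℤ → Set
  BoxIn| c a b = q c a ≡ R × q c b ≡ U × a <ᶻ b × b <ᶻ a + + m c

  private
    BoxIn-φ : ∀ c {a b} → BoxIn| c a b → BoxIn (φ c a) (φ c b)
    BoxIn-φ c {a} {b} (a-R , b-U , a<b , b<a+m) =
      trans (p-φ c a) a-R , trans (p-φ c b) b-U , φ-increasing c a<b , in-period c b<a+m

    BoxIn-φ⁻¹ : ∀ c {a b} → BoxIn (φ c a) (φ c b) → BoxIn| c a b
    BoxIn-φ⁻¹ c {a} {b} (a-R , b-U , a<b , b<a+n) =
      trans (sym (p-φ c a)) a-R , trans (sym (p-φ c b)) b-U , M.φ-cancel-< c a<b , in-period⁻¹ c b<a+n

  -- A box with both wires of one colour `c` is the image under `φ c` of a box of the strip of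
  -- `Γ| c`, so a property of such boxes may be proved in that form only.
  same-colour : ∀ (Q : ℤ → ℤ → Set) → (∀ c {a b} → BoxIn| c a b → Q (φ c a) (φ c b)) → ∀ {x y} → BoxIn x y →
    col x ≡ col y → Q x y
  same-colour Q Qφ {x} {y} box eq =
    subst₂ Q x≡ y≡ (Qφ (col x) (BoxIn-φ⁻¹ (col x) (subst₂ BoxIn (sym x≡) (sym y≡) box)))
    where
    x≡ : φ (col x) (ψ (col x) x) ≡ x
    x≡ = φ-ψ refl
    y≡ : φ (col x) (ψ (col x) y) ≡ y
    y≡ = φ-ψ (sym eq)

  Monochromatic : Filling → Set
  Monochromatic T = ∀ {a b} → BoxIn a b → T (Box a b) ≡ elbow → col a ≡ col b

  E| : Filling → Fin r → ℤ → ℤ → Tile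
  E| T c a b = T (Box (φ c a) (φ c b))

  -- The large and the small fillings are linked only by agreement on boxes of one colour. Both
  -- directions of the bijection are thus instances: with `restrict-tile` for the small fillings,
  -- and with `extend-tile` for the large one. Through `link`, each small strip realizes the label
  -- tiling `E| T c` taken from the large strip.
  module Restriction {T : Filling} (mono : Monochromatic T) {T| : Fin r → Filling}
                     (link : ∀ c {a b} → q c a ≡ R → q c b ≡ U → E| T c a b ≡ T| c (G.Box c a b)) where

    private
      big : ∀ c → Realization Γ T (m c) (q c) (E| T c)
      big c = colourRealization Γ T (λ r u lo hi → mono (r , u , lo , hi)) (φ c) (ψ c) (φ-increasing c)
        (φ-periodic c) (col-φ c) φ-ψ (λ z → sym (p-φ c z))

      small : ∀ c → Realization (Γ| c) (T| c) (m c) (q c) (E| T c)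
      small c = identityRealization (Γ| c) (T| c) (λ _ → refl) (link c)

      module B (c : Fin r) = DeogramRealized (big c)
      module S| (c : Fin r) = DeogramRealized (small c)

    -- The columns are sorted by colour, and in a column of colour `c` the elbows of either strip
    -- are counted by the common label tiling `E| T c`.
    elbows-sum : stripElbows Γ T ≡ Σ∈ (allFin r) (λ c → stripElbows (Γ| c) (T| c))
    elbows-sum = trans (by-colour (λ a → Σ< n (λ t → indicator (elbowIn? Γ T a (a + + t)))))
      (Σ∈-cong (allFin r) (λ c →
        Σ∈-cong (allFin (m c))
          (λ i → trans (column-restrict (big c) (rep i)) (sym (column-restrict (small c) (rep i))))))

    restrict-deogram : StripDeogram Γ T f → ∀ c → StripDeogram (Γ| c) (T| c) (f| c)
    restrict-deogram deo c = record
      { periodic          = periodic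
      ; strandPermutation = S|.labels⇒permutation c {f| c} (B.deogram⇒labels c deo {f| c} (φ-f| c))
      ; distinguished     = distinguished
      }
      where
      open PeriodicPath (Γ| c) using () renaming (p-periodic to q-periodic)
      periodic : ∀ b → L.InStrip c b → T| c (b ⊕ (+ m c - + k| c , + k| c)) ≡ T| c b
      periodic b b∈ with L.strip-labels c b∈
      ... | x , y , x-R , y-U , x<y , y<x+m , refl = begin
        T| c (G.Box c x y ⊕ (+ m c - + k| c , + k| c)) ≡⟨ cong (T| c) (L.Box-+n c x y) ⟨
        T| c (G.Box c (x + + m c) (y + + m c))         ≡⟨
          link c (trans (q-periodic x) x-R) (trans (q-periodic y) y-U) ⟨
        E| T c (x + + m c) (y + + m c)                 ≡⟨ B.E-periodic c deo x-R y-U x<y y<x+m ⟩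
        E| T c x y                                     ≡⟨ link c x-R y-U ⟩
        T| c (G.Box c x y)                             ∎
        where open ≡-Reasoning
      distinguished : ∀ b i s j t → L.InStrip c b → T| c b ≡ elbow →
        Tiles.walk (T| c) (PeriodicPath.N (Γ| c) i) s ≡ top b →
                      Tiles.walk (T| c) (PeriodicPath.N (Γ| c) j) t ≡ left b →
                        2 ∣ StrandCrossings.crossings (Γ| c) (T| c) i s j t
      distinguished b i s j t b∈ el eqi eqj with L.strip-labels c b∈
      ... | x , y , x-R , y-U , x<y , y<x+m , refl =
        S|.labels⇒distinguished c (B.deogram⇒distinguished c deo) {x} {y} x-R y-U x<y y<x+m el {i} {s} {j}
          {t} eqi eqj

    extend-deogram : (∀ c → StripDeogram (Γ| c) (T| c) (f| c)) → StripDeogram Γ T f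
    extend-deogram deo = record
      { periodic          = periodic
      ; strandPermutation = strandPermutation
      ; distinguished     = distinguished
      }
      where
      open Tiles T using (walk)
      open StrandCrossings Γ T using (crossings)
      periodic-Box′ : ∀ {a b} → BoxIn a b → T (Box (a + + n) (b + + n)) ≡ T (Box a b)
      periodic-Box′ {a} {b} box@(a-R , b-U , a<b , b<a+n) with col a FinP.≟ col b
      ... | yes eq = same-colour (λ x y → T (Box (x + + n) (y + + n)) ≡ T (Box x y))
        (λ { c {x} {y} (x-R , y-U , x<y , y<x+m) →
          trans (cong₂ (λ u v → T (Box u v)) (sym (φ-periodic c x)) (sym (φ-periodic c y)))
            (S|.E-periodic c (deo c) x-R y-U x<y y<x+m) })
        box eq
      -- A box of mixed colours is a crossing, and so is its translate, because translation by the
      -- period preserves colours.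
      ... | no ¬eq with tile-cases (T (Box a b)) | tile-cases (T (Box (a + + n) (b + + n)))
      ... | inj₂ el | _        = contradiction (mono box el) ¬eq
      ... | inj₁ cr | inj₁ cr′ = trans cr′ (sym cr)
      ... | inj₁ _  | inj₂ el  = contradiction (trans (sym (col-+n a)) (trans
        (mono (trans (p-periodic a) a-R , trans (p-periodic b) b-U , ℤP.+-monoˡ-< (+ n) a<b , ℤP.+-monoˡ-<
          (+ n) b<a+n) el) (col-+n b))) ¬eq
      periodic : ∀ b → InStrip b → T (b ⊕ (+ n - + k , + k)) ≡ T b
      periodic b b∈ with strip-labels b∈
      ... | x , y , x-R , y-U , x<y , y<x+n , refl =
          trans (cong T (sym (Box-+n x y))) (periodic-Box′ (x-R , y-U , x<y , y<x+n))
      strandPermutation : ∀ i → ∃[ t ] walk (N i) t ≡ S (f i)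
      strandPermutation i = subst (λ w → ∃[ t ] walk (N w) t ≡ S (f w)) (φ-ψ {col i} refl) exits
        where
        z = ψ (col i) i
        exits : ∃[ t ] walk (N (φ (col i) z)) t ≡ S (f (φ (col i) z))
        exits with B.labels⇒permutation (col i) {f| (col i)}
          (S|.deogram⇒labels (col i) (deo (col i)) {f| (col i)} (λ _ → refl)) z
        ... | t , eq = t , trans eq (cong S (φ-f| (col i) z))
      DistinguishedAt : ℤ → ℤ → Set
      DistinguishedAt x y = T (Box x y) ≡ elbow → ∀ i s j t → walk (N i) s ≡ top (Box x y) →
        walk (N j) t ≡ left (Box x y) → 2 ∣ crossings i s j t
      distinguished-φ : ∀ c {a b} → BoxIn| c a b → DistinguishedAt (φ c a) (φ c b)
      distinguished-φ c {a} {b} box el i s j t eqi eqj =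
        B.labels⇒distinguished c (S|.deogram⇒distinguished c (deo c)) {a} {b} (proj₁ box)
          (proj₁ (proj₂ box))
          (proj₁ (proj₂ (proj₂ (BoxIn-φ c box)))) (proj₂ (proj₂ (proj₂ (BoxIn-φ c box)))) el {i} {s} {j} {t}
            eqi eqj
      distinguished : ∀ b i s j t → InStrip b → T b ≡ elbow → walk (N i) s ≡ top b → walk (N j) t ≡ left b →
        2 ∣ crossings i s j t
      distinguished b i s j t b∈ el eqi eqj with strip-labels b∈
      ... | x , y , x-R , y-U , x<y , y<x+n , refl =
        same-colour DistinguishedAt distinguished-φ (x-R , y-U , x<y , y<x+n)
          (mono (x-R , y-U , x<y , y<x+n) el) el i s j t eqi eqj

    private
      e : Fin r → ℕ
      e c = stripElbows (Γ| c) (T| c)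

      n≡Σm : n ≡ Σ∈ (allFin r) m
      n≡Σm = begin
        n                                            ≡⟨ ListP.length-tabulate {n = n} id ⟨
        length (allFin n)                            ≡⟨ Σ∈-one (allFin n) ⟨
        Σ∈ (allFin n) (λ _ → 1)                      ≡⟨ by-colour (λ _ → 1) ⟩
        Σ∈ (allFin r) (λ c → Σ∈ (allFin (m c)) (λ _ → 1)) ≡⟨
          Σ∈-cong (allFin r) (λ c → trans (Σ∈-one (allFin (m c))) (ListP.length-tabulate {n = m c} id)) ⟩
        Σ∈ (allFin r) m                              ∎
        where open ≡-Reasoning

      Σ1+e : Σ∈ (allFin r) (λ c → 1 ℕ.+ e c) ≡ r ℕ.+ stripElbows Γ T
      Σ1+e = trans (count (allFin r)) (cong₂ ℕ._+_ (ListP.length-tabulate {n = r} id) (sym elbows-sum))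
        where
        count : ∀ cs → Σ∈ cs (λ c → 1 ℕ.+ e c) ≡ length cs ℕ.+ Σ∈ cs e
        count []       = refl
        count (c ∷ cs) = cong suc
          (trans (cong (e c ℕ.+_) (count cs)) (trans (sym (ℕP.+-assoc (e c) (length cs) (Σ∈ cs e)))
          (trans (cong (ℕ._+ Σ∈ cs e) (ℕP.+-comm (e c) (length cs)))
            (ℕP.+-assoc (length cs) (e c) (Σ∈ cs e)))))

    -- The inequalities `m c ≤ 1 + e c` hold for every colour and both sides have the same sum over
    -- all colours, so none of them is strict.
    restrict-maximal : StripDeogram Γ T f → n ≡ r ℕ.+ stripElbows Γ T → ∀ c → m c ≡ 1 ℕ.+ e c
    restrict-maximal deo max c =
      Σ∈-tight (allFin r) (λ c → transitive⇒elbows (Γ| c) (restrict-deogram deo c) (f|-transitive c))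
      (trans (sym n≡Σm) (trans max (sym Σ1+e))) (∈-allFin c)

    extend-maximal : (∀ c → m c ≡ 1 ℕ.+ e c) → n ≡ r ℕ.+ stripElbows Γ T
    extend-maximal max = trans n≡Σm (trans (Σ∈-cong (allFin r) max) Σ1+e)

  restrict-tile : Filling → Fin r → Filling
  restrict-tile T c = L.fill c (E| T c)

  restrict-tile-Box : ∀ T c {a b} → q c a ≡ R → q c b ≡ U → E| T c a b ≡ restrict-tile T c (G.Box c a b)
  restrict-tile-Box T c a-R b-U = sym (L.fill-Box c (E| T c) a-R b-U)

  module _ (T| : Fin r → Filling) where

    private
      combined : (c c′ : Fin r) → Dec (c ≡ c′) → ℤ → ℤ → Tile
      combined c c′ (yes _) a b = T| c (G.Box c (ψ c a) (ψ c b))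
      combined c c′ (no _)  a b = crossing

      extend-label : ℤ → ℤ → Tile
      extend-label a b = combined (col a) (col b) (col a FinP.≟ col b) a b

      extend-label-φ : ∀ c a b → extend-label (φ c a) (φ c b) ≡ T| c (G.Box c a b)
      extend-label-φ c a b = go (col-φ c a) (col-φ c b) (col (φ c a) FinP.≟ col (φ c b))
        where
        go : ∀ {c₁ c₂} → c₁ ≡ c → c₂ ≡ c → (d : Dec (c₁ ≡ c₂)) →
          combined c₁ c₂ d (φ c a) (φ c b) ≡ T| c (G.Box c a b)
        go refl refl (yes _)  = cong₂ (λ x y → T| c (G.Box c x y)) (ψ-φ c a) (ψ-φ c b)
        go refl refl (no neq) = contradiction refl neq

    extend-tile : Filling
    extend-tile = fill extend-label

    extend-tile-Box : ∀ c {a b} → q c a ≡ R → q c b ≡ U → E| extend-tile c a b ≡ T| c (G.Box c a b)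
    extend-tile-Box c {a} {b} a-R b-U =
      trans (fill-Box extend-label (trans (p-φ c a) a-R) (trans (p-φ c b) b-U)) (extend-label-φ c a b)

    extend-tile-monochromatic : Monochromatic extend-tile
    extend-tile-monochromatic {a} {b} (a-R , b-U , _) el =
      go (col a FinP.≟ col b) (trans (sym (fill-Box extend-label a-R b-U)) el)
      where
      go : (d : Dec (col a ≡ col b)) → combined (col a) (col b) d a b ≡ elbow → col a ≡ col b
      go (yes eq) _ = eq
      go (no _)   ()

  restrict-cong : ∀ {T T′ : Filling} → (∀ b → InStrip b → T b ≡ T′ b) → ∀ c b → L.InStrip c b →
    restrict-tile T c b ≡ restrict-tile T′ c b
  restrict-cong {T} {T′} T≈T′ c b b∈ with L.strip-labels c b∈
  ... | x , y , x-R , y-U , x<y , y<x+m , refl with BoxIn-φ c (x-R , y-U , x<y , y<x+m)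
  ... | r′ , u′ , lo , hi =
      trans (sym (restrict-tile-Box T c x-R y-U))
        (trans (T≈T′ _ (labels-strip r′ u′ lo hi)) (restrict-tile-Box T′ c x-R y-U))

  -- The restrictions determine the boxes of one colour, and a monochromatic filling has crossings
  -- in all other boxes of the strip.
  restrict-injective : ∀ {T T′} → Monochromatic T → Monochromatic T′ →
    (∀ c b → L.InStrip c b → restrict-tile T c b ≡ restrict-tile T′ c b) → ∀ b → InStrip b → T b ≡ T′ b
  restrict-injective {T} {T′} mono mono′ eq| b b∈ with strip-labels b∈
  ... | x , y , x-R , y-U , x<y , y<x+n , refl with col x FinP.≟ col y
  ... | yes eq = same-colour (λ x y → T (Box x y) ≡ T′ (Box x y))
    (λ { c {a} {b} (a-R , b-U , a<b , b<a+m) →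
      trans (restrict-tile-Box T c a-R b-U)
        (trans (eq| c (G.Box c a b) (L.labels-strip c a-R b-U a<b b<a+m))
          (sym (restrict-tile-Box T′ c a-R b-U))) })
    (x-R , y-U , x<y , y<x+n) eq
  ... | no ¬eq with tile-cases (T (Box x y)) | tile-cases (T′ (Box x y))
  ... | inj₁ cr | inj₁ cr′ = trans cr (sym cr′)
  ... | inj₂ el | _        = contradiction (mono (x-R , y-U , x<y , y<x+n) el) ¬eq
  ... | inj₁ _  | inj₂ el  = contradiction (mono′ (x-R , y-U , x<y , y<x+n) el) ¬eq

  restrict-extend : ∀ T| c b → L.InStrip c b → restrict-tile (extend-tile T|) c b ≡ T| c b
  restrict-extend T| c b b∈ with L.strip-labels c b∈
  ... | x , y , x-R , y-U , _ , _ , refl =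
      trans (sym (restrict-tile-Box (extend-tile T|) c x-R y-U)) (extend-tile-Box T| c x-R y-U)

-- The colouring by the cycles of the reduced permutation

module Decomposition {k n : ℕ} .{{_ : NonZero n}} {f : ℤ → ℤ} (f∈ : f ∈ 𝐁 k n) {P : Path n} (P∈ : P ∈ 𝒫 k n)
                     (D : CycleDecomposition (reduce n f)) where
  open CycleDecomposition D
  open Colours D

  private
    Γ : PeriodicPath n k
    Γ = periodicPath P P∈

    f-affine : IsAffinePermutation n f
    f-affine = 𝐁.isAffinePermutation f∈

  open PeriodicPath Γ using (p; p-periodic)
  open Geometry Γ using (Box)

  m : Fin r → ℕ
  m c = size (cycle c)

  module I (c : Fin r) = Indexing (cycle c) (cycle-unique c)
  open I using (φ; ψ)
  module M (c : Fin r) = Increasing {φ c} (I.φ-increasing c)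

  col : ℤ → Fin r
  col x = colour (res n x)

  col-f : ∀ x → col (f x) ≡ col x
  col-f x = trans (cong colour (sym (reduce-res f-affine x))) (colour-σ (res n x))

  col-φ : ∀ c z → col (φ c z) ≡ c
  col-φ c z = colour-∈ (I.φ-∈ c z)

  col-+n : ∀ x → col (x + + n) ≡ col x
  col-+n x = cong colour (res-+n n x)

  φ-ψ : ∀ {c x} → col x ≡ c → φ c (ψ c x) ≡ x
  φ-ψ {c} {x} eq = I.φ-ψ c (subst (λ c → res n x ∈ₗ toList (cycle c)) eq (∈-colour (res n x)))

  f| : Fin r → ℤ → ℤ
  f| c = restrict (cycle c) f

  P| : ∀ c → Path (m c)
  P| c = restrictPath (cycle c) P

  φ-f| : ∀ c z → φ c (f| c z) ≡ f (φ c z)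
  φ-f| c z = φ-ψ (trans (col-f (φ c z)) (col-φ c z))

  f|-affine : ∀ c → IsAffinePermutation (m c) (f| c)
  f|-affine c = record
    { bijective = (λ {z} {w} eq →
      M.φ-injective c (proj₁ bijective (trans (sym (φ-f| c z)) (trans (cong (φ c) eq) (φ-f| c w))))) ,
                  surjective
    ; periodic  = λ z → M.φ-injective c (begin
        φ c (f| c (z + + m c)) ≡⟨ φ-f| c (z + + m c) ⟩
        f (φ c (z + + m c))    ≡⟨ cong f (I.φ-periodic c z) ⟩
        f (φ c z + + n)        ≡⟨ periodic (φ c z) ⟩
        f (φ c z) + + n        ≡⟨ cong (_+ + n) (φ-f| c z) ⟨
        φ c (f| c z) + + n     ≡⟨ I.φ-periodic c (f| c z) ⟨
        φ c (f| c z + + m c)   ∎)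
    }
    where
    open IsAffinePermutation f-affine
    open ≡-Reasoning
    surjective : ∀ y → ∃[ z ] (∀ {w} → w ≡ z → f| c w ≡ y)
    surjective y with proj₂ bijective (φ c y)
    ... | x , fx = ψ c x ,
        λ { refl → M.φ-injective c (trans (φ-f| c (ψ c x)) (trans (cong f (φ-ψ col-x)) (fx refl))) }
      where
      col-x : col x ≡ c
      col-x = trans (sym (col-f x)) (trans (cong col (fx refl)) (col-φ c y))

  f|-lower : ∀ c z → z ≤ᶻ f| c z
  f|-lower c z = M.φ-cancel-≤ c (subst (φ c z ≤ᶻ_) (sym (φ-f| c z)) (𝐁.lower f∈ (φ c z)))

  f|-upper : ∀ c z → f| c z ≤ᶻ z + + m c
  f|-upper c z = M.φ-cancel-≤ c (subst₂ _≤ᶻ_ (sym (φ-f| c z)) (sym (I.φ-periodic c z)) (𝐁.upper f∈ (φ c z)))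

  private
    displacement : ∀ c → ∃[ k′ ] k′ ℕ.≤ m c × ΣPeriod (m c) (λ z → f| c z - z) ≡ + k′ * + m c
    displacement c = displacement-sum (f|-affine c) (f|-lower c) (f|-upper c)

  k| : Fin r → ℕ
  k| c = proj₁ (displacement c)

  k|≤m : ∀ c → k| c ℕ.≤ m c
  k|≤m c = proj₁ (proj₂ (displacement c))

  f|∈𝐁 : ∀ c → f| c ∈ 𝐁 (k| c) (m c)
  f|∈𝐁 c = record
    { isAffinePermutation = f|-affine c
    ; average             = av-sum (m c) (f| c) (k| c) (proj₂ (proj₂ (displacement c)))
    ; lower               = f|-lower c
    ; upper               = f|-upper c
    }

  enumerate-reduce : ∀ c i →
    enumerate (cycle c) (reduce (m c) (f| c) i) ≡ reduce n f (enumerate (cycle c) i)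
  enumerate-reduce c i = begin
    enumerate (cycle c) (res (m c) (f| c (rep i))) ≡⟨ I.res-φ c (f| c (rep i)) ⟨
    res n (φ c (f| c (rep i)))                     ≡⟨ cong (res n) (φ-f| c (rep i)) ⟩
    res n (f (φ c (rep i)))                        ≡⟨ cong (res n ∘ f) (I.φ-rep c i) ⟩
    reduce n f (enumerate (cycle c) i)             ∎
    where open ≡-Reasoning

  f|-transitive : ∀ c i j → Reach (reduce (m c) (f| c)) i j
  f|-transitive c i j with cycle-reach (reduce n f) (areCycles c) (I.enumerate-∈ c i) (I.enumerate-∈ c j)
  ... | t , eq = t , I.enumerate-injective c (trans (enumerate-fold t) eq)
    where
    enumerate-fold : ∀ t →
      enumerate (cycle c) (fold i (reduce (m c) (f| c)) t) ≡ fold (enumerate (cycle c) i) (reduce n f) t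
    enumerate-fold zero    = refl
    enumerate-fold (suc t) =
      trans (enumerate-reduce c (fold i (reduce (m c) (f| c)) t)) (cong (reduce n f) (enumerate-fold t))

  #cycles-f| : ∀ c → #cycles (reduce (m c) (f| c)) ≡ 1
  #cycles-f| c = #classes {r = 1} (λ _ → Fin.zero) (λ { Fin.zero → Fin.zero , refl })
    (sameCycle? (reduce (m c) (f| c)))
    (λ _ → refl)
    (λ {i} {j} _ → reachable⇒sameCycle (reduce (m c) (f| c)) (proj₁ (f|-transitive c i j))
      (proj₂ (f|-transitive c i j)))

  -- Lets the truncated difference in the definition of maximality be rewritten as the equation
  -- `n ≡ r + elbows`.
  r≤n : r ℕ.≤ n
  r≤n = FinP.injective⇒≤ {f = λ c → head (cycle c)} (λ {c} {c′} eq → trans (sym (colour-∈ (here refl)))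
    (colour-∈ (subst (_∈ₗ toList (cycle c′)) (sym eq) (here refl))))

  private
    by-colour : ∀ (F : ℤ → ℕ) →
      Σ∈ (allFin n) (F ∘ rep) ≡ Σ∈ (allFin r) (λ c → Σ∈ (allFin (m c)) (F ∘ φ c ∘ rep))
    by-colour F = begin
      Σ∈ (allFin n) (F ∘ rep)                                      ≡⟨ Σ∈-↭ partition (F ∘ rep) ⟨
      Σ∈ (concatMap toList cycles) (F ∘ rep)                       ≡⟨ Σ∈-concatMap toList cycles (F ∘ rep) ⟩
      Σ∈ cycles (λ c → Σ∈ (toList c) (F ∘ rep))                    ≡⟨
        cong (λ cs → Σ∈ cs (λ c → Σ∈ (toList c) (F ∘ rep))) cycles≡ ⟩
      Σ∈ (map cycle (allFin r)) (λ c → Σ∈ (toList c) (F ∘ rep))    ≡⟨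
        Σ∈-map cycle (allFin r) (λ c → Σ∈ (toList c) (F ∘ rep)) ⟩
      Σ∈ (allFin r) (λ c → Σ∈ (toList (cycle c)) (F ∘ rep))        ≡⟨
        Σ∈-cong (allFin r) (λ c → trans (sym (Σ∈-↭ (I.enumerate-↭ c) (F ∘ rep)))
                                                                        (trans (Σ∈-map (enumerate (cycle c))
                                                                          (allFin (m c)) (F ∘ rep))
                                                                            (Σ∈-cong (allFin (m c))
                                                                              (λ i → cong F (sym (I.φ-rep c
                                                                                i)))))) ⟩
      Σ∈ (allFin r) (λ c → Σ∈ (allFin (m c)) (F ∘ φ c ∘ rep))      ∎
      where
      open ≡-Reasoning
      cycles≡ : cycles ≡ map cycle (allFin r)
      cycles≡ = trans (sym (ListP.tabulate-lookup cycles)) (sym (ListP.map-tabulate id cycle))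

    p-φ : ∀ c z → p (φ c z) ≡ step (P| c) z
    p-φ c z = cong P (I.res-φ c z)

    deogram : (M : MaximalDeogram k n f P) → StripDeogram Γ (MaximalDeogram.tile M) f
    deogram M = fromDeogram P∈ (MaximalDeogram.tile M) (MaximalDeogram.isDeogram M)

    elbows : (M : MaximalDeogram k n f P) → n ≡ r ℕ.+ stripElbows Γ (MaximalDeogram.tile M)
    elbows M = sym (trans
      (cong (r ℕ.+_) (trans (sym (#elbows≡ P∈ tile)) (trans maximal (cong (n ℕ.∸_) #cycles≡r))))
        (ℕP.m+[n∸m]≡n r≤n))
      where open MaximalDeogram M

    monochromatic-elbow : (M : MaximalDeogram k n f P) → ∀ {a b} → p a ≡ R → p b ≡ U → a <ᶻ b →
      b <ᶻ a + + n →
                          MaximalDeogram.tile M (Box a b) ≡ elbow → col a ≡ col b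
    monochromatic-elbow M = deogram⇒monochromatic Γ (deogram M) colour colour-reach (elbows M)

  -- The total displacement of `f| c` over a period is `k| c * m c` by definition of the average,
  -- and the number of up-steps of `P| c` times `m c` by following the strands; cancel `m c`. The
  -- strands are followed in the large strip, on the wires of colour `c`.
  maximal⇒P|∈𝒫 : MaximalDeogram k n f P → ∀ c → P| c ∈ 𝒫 (k| c) (m c)
  maximal⇒P|∈𝒫 M c = height⇒𝒫 (P| c) (k| c) (trans (sym (ℤP.+-identityʳ (height (P| c) (+ m c))))
    (ℤP.*-cancelʳ-≡ (height (P| c) (+ m c) - 0ℤ) (+ k| c) (+ m c)
      (trans (sym sum≡) (proj₂ (proj₂ (displacement c))))))
    where
    open MaximalDeogram M using (tile)
    ρ : Realization Γ tile (m c) (step (P| c)) (λ a b → tile (Box (φ c a) (φ c b)))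
    ρ = colourRealization Γ tile (monochromatic-elbow M) (φ c) (ψ c) (I.φ-increasing c) (I.φ-periodic c)
      (col-φ c) (φ-ψ {c}) (λ z → sym (p-φ c z))
    sum≡ : ΣPeriod (m c) (λ z → f| c z - z) ≡ (height (P| c) (+ m c) - 0ℤ) * + m c
    sum≡ = permutation-displacement {p = step (P| c)} {λ a b → tile (Box (φ c a) (φ c b))}
      (Realized.q-periodic ρ) (DeogramRealized.E-periodic ρ (deogram M))
      (height (P| c)) (λ {z} → height-R (P| c) {z}) (λ {z} → height-U (P| c) {z})
      (f|-affine c) (DeogramRealized.deogram⇒labels ρ (deogram M) {f| c} (φ-f| c))

  module _ (P|∈ : ∀ c → P| c ∈ 𝒫 (k| c) (m c)) where

    private
      colouring : Colouring Γ f r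
      colouring = record
        { m             = m
        ; k|            = k|
        ; Γ|            = λ c → periodicPath (P| c) (P|∈ c)
        ; f|            = f|
        ; col           = col
        ; φ             = φ
        ; ψ             = ψ
        ; col-+n        = col-+n
        ; col-φ         = col-φ
        ; φ-ψ           = λ {c} {x} → φ-ψ {c} {x}
        ; ψ-φ           = I.ψ-φ
        ; φ-increasing  = λ c {a} {b} → I.φ-increasing c {a} {b}
        ; φ-periodic    = I.φ-periodic
        ; φ-f|          = φ-f|
        ; p-φ           = p-φ
        ; by-colour     = by-colour
        ; f|-transitive = f|-transitive
        }

      open Gluing colouring

      elbows| : ∀ c (T : Filling) → #elbows (k| c) (P| c) T ≡ m c ℕ.∸ #cycles (reduce (m c) (f| c)) →
        m c ≡ 1 ℕ.+ stripElbows (periodicPath (P| c) (P|∈ c)) T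
      -- The size of a cycle unfolds to a successor, so `suc (m c ∸ 1)` computes to `m c`.
      elbows| c T max = sym
        (cong suc (trans (sym (#elbows≡ (P|∈ c) T)) (trans max (cong (m c ℕ.∸_) (#cycles-f| c)))))

      mono : (M : MaximalDeogram k n f P) → Monochromatic (MaximalDeogram.tile M)
      mono M {a} {b} (a-R , b-U , a<b , b<a+n) = monochromatic-elbow M {a} {b} a-R b-U a<b b<a+n

      restrictDeogram : MaximalDeogram k n f P → ∀ c → MaximalDeogram (k| c) (m c) (f| c) (P| c)
      restrictDeogram M c = record
        { tile      = restrict-tile tile c
        ; isDeogram = toDeogram (P|∈ c) (restrict-tile tile c) (Rs.restrict-deogram (deogram M) c)
        ; maximal   = trans (#elbows≡ (P|∈ c) (restrict-tile tile c))
                        (trans (cong (ℕ._∸ 1) (sym (Rs.restrict-maximal (deogram M) (elbows M) c)))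
                          (cong (m c ℕ.∸_) (sym (#cycles-f| c))))
        }
        where
        open MaximalDeogram M using (tile)
        module Rs = Restriction {tile} (mono M) {restrict-tile tile} (restrict-tile-Box tile)

      extendDeogram : (∀ c → MaximalDeogram (k| c) (m c) (f| c) (P| c)) → MaximalDeogram k n f P
      extendDeogram N = record
        { tile      = extend-tile T|
        ; isDeogram = toDeogram P∈ (extend-tile T|)
          (Rs.extend-deogram (λ c → fromDeogram (P|∈ c) (T| c) (MaximalDeogram.isDeogram (N c))))
        ; maximal   = trans (#elbows≡ P∈ (extend-tile T|))
          (trans (sym (ℕP.m+n∸m≡n r (stripElbows Γ (extend-tile T|))))
                        (cong₂ ℕ._∸_ (sym (Rs.extend-maximal
                          (λ c → elbows| c (T| c) (MaximalDeogram.maximal (N c))))) (sym #cycles≡r)))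
        }
        where
        T| : Fin r → Filling
        T| c = MaximalDeogram.tile (N c)
        module Rs = Restriction {extend-tile T|} (extend-tile-monochromatic T|) {T|} (extend-tile-Box T|)

    deogramBijection : Bijection (Deoᵐᵃˣ k n f P) (Πₛ (λ c → Deoᵐᵃˣ (k| c) (m c) (f| c) (P| c)))
    deogramBijection = record
      { to        = restrictDeogram
      ; cong      = λ {M} {M′} → restrict-cong {tile M} {tile M′}
      ; bijective = (λ {M} {M′} → restrict-injective {tile M} {tile M′} (mono M) (mono M′)) ,
                    (λ N → extendDeogram N , λ {M} M≈ c b b∈ →
                      trans (restrict-cong {tile M} {tile (extendDeogram N)} M≈ c b b∈)
                        (restrict-extend (λ c → tile (N c)) c b b∈))
      }
      where open MaximalDeogram

theorem1p2 :
  ∀ (k n : ℕ) .{{_ : NonZero n}} → k ≤ n →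
  ∀ (f : ℤ → ℤ) → f ∈ 𝐁 k n →
  ∀ (P : Path n) → P ∈ 𝒫 k n →
  ∀ (D : CycleDecomposition (reduce n f)) →
  let open CycleDecomposition D
      nⱼ = λ (j : Fin r) → size (cycle j)
      fⱼ = λ (j : Fin r) → restrict (cycle j) f
      Pⱼ = λ (j : Fin r) → restrictPath (cycle j) P
  in
  -- 𝐁 includes the condition av (fⱼ j) ≡ kⱼ j, which determines kⱼ.
  Σ[ kⱼ ∈ (Fin r → ℕ) ]
    (∀ j → kⱼ j ≤ nⱼ j × fⱼ j ∈ 𝐁 (kⱼ j) (nⱼ j)) ×
    ((∃[ j ] Pⱼ j ∉ 𝒫 (kⱼ j) (nⱼ j)) →
      ¬ Setoid.Carrier (Deoᵐᵃˣ k n f P)) ×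
    ((∀ j → Pⱼ j ∈ 𝒫 (kⱼ j) (nⱼ j)) →
      Bijection (Deoᵐᵃˣ k n f P)
                (Πₛ (λ j → Deoᵐᵃˣ (kⱼ j) (nⱼ j) (fⱼ j) (Pⱼ j))))
theorem1p2 k n _ f f∈ P P∈ D = k| , (λ j → k|≤m j , f|∈𝐁 j) ,
  (λ { (j , P|∉) M → P|∉ (maximal⇒P|∈𝒫 M j) }) , deogramBijection
  where open Decomposition f∈ P∈ D
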